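{- Let $(\mathcal{S}^x,H)$ be a finite thick STGQ of order $(s,t)$ with group of symmetries $\mathbb{S}$, and suppose that either $s=t$ is odd, or $s\neq t$ and property (*) holds. If $M\le H$ satisfies $M\mathbb{S}=H$ (i.e. $M$ projects onto $H/\mathbb{S}$), then $M=H$.
   Context: A finite GQ of order $(s,t)$: every line has $s+1$ points, every point lies on $t+1$ lines, and for each point $p$ and line $L$ not through $p$ exactly one point of $L$ is collinear with $p$; thick means $s,t\ge2$. An EGQ $(\mathcal{S}^x,H)$: $H\le\mathrm{Aut}(\mathcal{S})$ fixes every line through $x$ and acts sharply transitively on the points not collinear with $x$. A symmetry with center $x$ fixes every point collinear with $x$; an STGQ is an EGQ of order $(s,t)$ whose elation group contains a group $\mathbb{S}$ of $t$ symmetries with center $x$. Property (*): whenever an element of $H$ fixes a point $y\ne x$ collinear with $x$, it fixes every point of $xy$. -}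

module Defs where

open import Data.Nat using (ℕ; zero; suc; _+_; _≤_; _%_)
open import Data.Fin using (Fin; zero; suc)
open import Data.Bool using (Bool; true; false; if_then_else_)
open import Data.Product using (Σ; _×_; _,_; ∃)
open import Data.Sum using (_⊎_)
open import Data.Empty using (⊥)
open import Relation.Nullary using (¬_)
open import Relation.Binary.PropositionalEquality using (_≡_; _≢_)
open import Function using (_∘_)

count : {n : ℕ} → (Fin n → Bool) → ℕ
count {zero}  f = 0
count {suc n} f = (if f zero then 1 else 0) + count (f ∘ suc)

record Incidence : Set where
  field
    np : ℕ
    nl : ℕ
    I  : Fin np → Fin nl → Bool

module _ (S : Incidence) where
  open Incidence S

  Point : Set
  Point = Fin np

  Line : Set
  Line = Fin nl

  _on_ : Point → Line → Set
  p on L = I p L ≡ true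

  -- p and q are collinear (p ~ q): some line contains both (so p ~ p).
  Collinear : Point → Point → Set
  Collinear p q = ∃ λ L → p on L × q on L

  -- Generalized quadrangle of order (s , t) (Payne–Thas definition).
  record IsGQ (s t : ℕ) : Set where
    field
      lineSize  : ∀ L → count (λ p → I p L) ≡ suc s
      pointDeg  : ∀ p → count (λ L → I p L) ≡ suc t
      atMostOne : ∀ p q L M → p ≢ q → p on L → q on L → p on M → q on M → L ≡ M
      gqExists  : ∀ p L → ¬ (p on L) → ∃ λ q → q on L × Collinear p q
      gqUnique  : ∀ p L q q' → ¬ (p on L) → q on L → Collinear p q →
                  q' on L → Collinear p q' → q ≡ q'

  record IsThickGQ (s t : ℕ) : Set where
    field
      isGQ   : IsGQ s t
      s≥2    : 2 ≤ s
      t≥2    : 2 ≤ t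

  record Aut : Set where
    field
      pt      : Point → Point
      ln      : Line → Line
      pt⁻     : Point → Point
      ln⁻     : Line → Line
      pt-inv₁ : ∀ p → pt⁻ (pt p) ≡ p
      pt-inv₂ : ∀ p → pt (pt⁻ p) ≡ p
      ln-inv₁ : ∀ L → ln⁻ (ln L) ≡ L
      ln-inv₂ : ∀ L → ln (ln⁻ L) ≡ L
      pres    : ∀ p L → I (pt p) (ln L) ≡ I p L
  open Aut public

  _≈_ : Aut → Aut → Set
  f ≈ g = (∀ p → pt f p ≡ pt g p) × (∀ L → ln f L ≡ ln g L)

  _·_ : Aut → Aut → Aut
  f · g = record
    { pt = pt f ∘ pt g ; ln = ln f ∘ ln g
    ; pt⁻ = pt⁻ g ∘ pt⁻ f ; ln⁻ = ln⁻ g ∘ ln⁻ f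
    ; pt-inv₁ = λ p → helper₁ (pt-inv₁ f (pt g p)) (pt-inv₁ g p)
    ; pt-inv₂ = λ p → helper₂ (pt-inv₂ g (pt⁻ f p)) (pt-inv₂ f p)
    ; ln-inv₁ = λ L → helper₃ (ln-inv₁ f (ln g L)) (ln-inv₁ g L)
    ; ln-inv₂ = λ L → helper₄ (ln-inv₂ g (ln⁻ f L)) (ln-inv₂ f L)
    ; pres = λ p L → trans′ (pres f (pt g p) (ln g L)) (pres g p L)
    }
    where
    open import Relation.Binary.PropositionalEquality using (cong; trans)
    helper₁ : ∀ {p} → pt⁻ f (pt f (pt g p)) ≡ pt g p → pt⁻ g (pt g p) ≡ p →
              pt⁻ g (pt⁻ f (pt f (pt g p))) ≡ p
    helper₁ e₁ e₂ = trans (cong (pt⁻ g) e₁) e₂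
    helper₂ : ∀ {p} → pt g (pt⁻ g (pt⁻ f p)) ≡ pt⁻ f p → pt f (pt⁻ f p) ≡ p →
              pt f (pt g (pt⁻ g (pt⁻ f p))) ≡ p
    helper₂ e₁ e₂ = trans (cong (pt f) e₁) e₂
    helper₃ : ∀ {L} → ln⁻ f (ln f (ln g L)) ≡ ln g L → ln⁻ g (ln g L) ≡ L →
              ln⁻ g (ln⁻ f (ln f (ln g L))) ≡ L
    helper₃ e₁ e₂ = trans (cong (ln⁻ g) e₁) e₂
    helper₄ : ∀ {L} → ln g (ln⁻ g (ln⁻ f L)) ≡ ln⁻ f L → ln f (ln⁻ f L) ≡ L →
              ln f (ln g (ln⁻ g (ln⁻ f L))) ≡ L
    helper₄ e₁ e₂ = trans (cong (ln f) e₁) e₂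
    trans′ : ∀ {a b c : Bool} → a ≡ b → b ≡ c → a ≡ c
    trans′ = trans

  idAut : Aut
  idAut = record
    { pt = λ p → p ; ln = λ L → L ; pt⁻ = λ p → p ; ln⁻ = λ L → L
    ; pt-inv₁ = λ _ → Relation.Binary.PropositionalEquality.refl
    ; pt-inv₂ = λ _ → Relation.Binary.PropositionalEquality.refl
    ; ln-inv₁ = λ _ → Relation.Binary.PropositionalEquality.refl
    ; ln-inv₂ = λ _ → Relation.Binary.PropositionalEquality.refl
    ; pres = λ _ _ → Relation.Binary.PropositionalEquality.refl }

  inv : Aut → Aut
  inv f = record
    { pt = pt⁻ f ; ln = ln⁻ f ; pt⁻ = pt f ; ln⁻ = ln f
    ; pt-inv₁ = pt-inv₂ f ; pt-inv₂ = pt-inv₁ f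
    ; ln-inv₁ = ln-inv₂ f ; ln-inv₂ = ln-inv₁ f
    ; pres = λ p L → Relation.Binary.PropositionalEquality.trans
               (Relation.Binary.PropositionalEquality.sym
                  (pres f (pt⁻ f p) (ln⁻ f L)))
               (Relation.Binary.PropositionalEquality.cong₂ I
                  (pt-inv₂ f p) (ln-inv₂ f L)) }

  record IsSubgroup (G : Aut → Set) : Set where
    field
      resp   : ∀ {f g} → f ≈ g → G f → G g
      hasId  : G idAut
      closed : ∀ {f g} → G f → G g → G (f · g)
      invCl  : ∀ {f} → G f → G (inv f)

  _⊆_ : (Aut → Set) → (Aut → Set) → Set
  K ⊆ G = ∀ f → K f → G f

  HasCard : (Aut → Set) → ℕ → Set
  HasCard G n = Σ (Fin n → Aut) λ e →
      (∀ i → G (e i))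
    × (∀ i j → e i ≈ e j → i ≡ j)
    × (∀ f → G f → ∃ λ i → f ≈ e i)

  record IsElationGroup (x : Point) (H : Aut → Set) : Set where
    field
      subgroup   : IsSubgroup H
      fixLines   : ∀ h → H h → ∀ L → x on L → ln h L ≡ L
      transitive : ∀ y z → ¬ Collinear x y → ¬ Collinear x z →
                   ∃ λ h → H h × pt h y ≡ z
      sharp      : ∀ y h h' → ¬ Collinear x y → H h → H h' →
                   pt h y ≡ pt h' y → h ≈ h'

  IsSymmetry : Point → Aut → Set
  IsSymmetry x f = ∀ y → Collinear x y → pt f y ≡ y

  record IsSTGQ (s t : ℕ) (x : Point) (H Sym : Aut → Set) : Set where
    field
      gq        : IsGQ s t
      elation   : IsElationGroup x H
      symSub    : IsSubgroup Sym
      sym⊆H     : Sym ⊆ H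
      symmetric : ∀ f → Sym f → IsSymmetry x f
      symCard   : HasCard Sym t

  PropertyStar : Point → (Aut → Set) → Set
  PropertyStar x H = ∀ h y L → H h → y ≢ x → x on L → y on L →
                     pt h y ≡ y → ∀ z → z on L → pt h z ≡ z

Odd : ℕ → Set
Odd n = n % 2 ≡ 1

{-# OPTIONS --safe #-}
module Submission where

-- Fix a point y₀ not collinear with x. Identify the elation group with the finite group G of its translates of
-- y₀, let F i (i = 0, …, t) be the stabilizers of the lines on y₀ and S ⊴ G the group of symmetries. Either
-- hypothesis makes G / S commutative. Restricting to {g ∣ gᵉ ∈ S} for a suitable prime power e = rᵏ, all F i may
-- be assumed to have exponent e; here |F i| is odd or different from t.
--
-- (1) Every proper subgroup M of G has index divisible by r. If MS ≠ G, an element outside MS acts freely on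
-- G / MS. If MS = G and r ∤ [G : M], each of the t + 1 groups F i fixes a point of G / M, so a conjugate of M
-- contains more than |M ∩ S| of them; it then meets every other F j trivially, so |F j| |M ∩ S| ≤ t ≤ |F j|,
-- which forces [G : M] = t = |F j|, a multiple of r.
--
-- (2) S ⊆ [G , G]: if K ⊂ S and G / K is commutative, counting the pairs (b , j) with b ∈ F 1 ∩ F 0 F j K gives
-- |F 1| ≤ t, hence |F 1| = t, and the involution exchanging a and b on {(a , b) ∈ F i × F j ∣ ab ∈ gτK} shows
-- that t is even.
--
-- (3) Let MS = G and M ≠ G, and let K be the largest normal subgroup of G in M ∩ S. By (1) and the class
-- equation there is z ∈ S ∖ K centralized by G modulo K. It lies outside M and normalizes M, so inductively the
-- normalizer of M, and then the preimage of the center of G / M, are all of G, contradicting (2).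

open import Algebra.Bundles using (Group)
open import Algebra.Structures using (IsGroup)
import Algebra.Properties.Group as GroupProperties
open import Data.Bool using (Bool; true; false; not; if_then_else_) renaming (_≟_ to _≟B_)
open import Data.Empty using (⊥; ⊥-elim)
open import Data.Fin using (Fin; zero; suc; toℕ; fromℕ<; punchIn; punchOut) renaming (_≟_ to _≟F_; _<_ to _<F_)
open import Data.Fin.Properties using (any?; all?; ¬∀⟶∃¬; ¬∀⟶∃¬-smallest; pigeonhole; punchIn-injective; punchInᵢ≢i; suc-injective; toℕ<n; toℕ-fromℕ<; toℕ-injective) renaming (<-cmp to <F-cmp)
open import Data.List using (List; []; _∷_; allFin)
open import Data.List.Membership.Propositional.Properties using (∈-allFin)
open import Data.List.Relation.Unary.All as All using (All; []; _∷_)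
open import Data.Nat hiding (_≟_)
open import Data.Nat.Coprimality using (prime⇒coprime; coprime-Bézout)
open import Data.Nat.Divisibility hiding (quotient)
open import Data.Nat.DivMod using (m≡m%n+[m/n]*n; m%n<n)
open import Data.Nat.GCD using (module Bézout)
open import Data.Nat.ListAction using (product)
open import Data.Nat.Primality using (Prime; prime[2]; prime⇒nonZero; prime⇒nonTrivial; euclidsLemma)
open import Data.Nat.Primality.Factorisation using (factorise; PrimeFactorisation)
open import Data.Nat.Properties hiding (suc-injective; 0≢1+n; _≟_)
open import Algebra.Properties.CommutativeMonoid.Sum +-0-commutativeMonoid using (sum; sum-cong-≗; ∑-comm; ∑-distrib-+)
open import Algebra.Properties.Semiring.Sum +-*-semiring using (*-distribˡ-sum; *-distribʳ-sum)
open import Data.Product using (Σ; ∃; _×_; _,_; proj₁; proj₂)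
open import Data.Sum using (_⊎_; inj₁; inj₂)
open import Data.Unit using (⊤; tt)
open import Data.Vec using (Vec; lookup)
open import Function using (_∘_; id; case_of_)
open import Level using () renaming (_⊔_ to _⊔ˡ_)
open import Relation.Binary.Definitions using (tri<; tri≈; tri>)
open import Relation.Binary.PropositionalEquality
import Relation.Binary.Reasoning.Setoid as SetoidReasoning
import Relation.Binary.Reflection as Reflection
open import Relation.Nullary
open import Relation.Nullary.Decidable using (_×-dec_; _⊎-dec_; _→-dec_; ¬?; does; map′; dec-true; dec-false; decidable-stable)
open import Relation.Unary using (Decidable)

-- Cardinalities of decidable subsets of Fin n

-- If `G` were known to be an `r`-group, (2) would suffice, because the maximal subgroups of a
-- finite `r`-group contain `[G , G]`. But only `G / S` is known to have exponent `e`; the order `t`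
-- of `S` is a priori arbitrary. Statement (1) makes up for this: a Sylow `r`-subgroup has index
-- prime to `r`, so (1) amounts to `G` being an `r`-group. It enters the class equation of (3)
-- directly as divisibility of the indices of centralizers, and the climb from `M` to its normalizer
-- and to the preimage of the center replaces maximal subgroups. The restriction costs nothing on
-- the side of `S`: the torsion subgroup contains `S`, so `t` is unchanged, and `M` contains `S` as
-- soon as its intersection with the torsion subgroup does. An odd prime `r` is preferred, since it
-- makes the order of `F i` odd whatever it was before. Only if no `F i` has a nontrivial element of
-- odd order is `e` a power of 2; then no `F i` shrinks, and the given condition on the order of
-- `F i` is inherited unchanged.

𝟙 : {A : Set} → Dec A → ℕ
𝟙 d = if does d then 1 else 0

𝟙-yes : {A : Set} (d : Dec A) → A → 𝟙 d ≡ 1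
𝟙-yes d a rewrite dec-true d a = refl

𝟙-no : {A : Set} (d : Dec A) → ¬ A → 𝟙 d ≡ 0
𝟙-no d na rewrite dec-false d na = refl

𝟙-mono : {A B : Set} (d : Dec A) (e : Dec B) → (A → B) → 𝟙 d ≤ 𝟙 e
𝟙-mono (no _) e f = z≤n
𝟙-mono (yes a) e f = ≤-reflexive (sym (𝟙-yes e (f a)))

# : {n : ℕ} {P : Fin n → Set} → Decidable P → ℕ
# P? = sum (λ i → 𝟙 (P? i))

sum-mono : ∀ {n} (f g : Fin n → ℕ) → (∀ i → f i ≤ g i) → sum f ≤ sum g
sum-mono {zero} f g h = z≤n
sum-mono {suc n} f g h = +-mono-≤ (h zero) (sum-mono (f ∘ suc) (g ∘ suc) (h ∘ suc))

sum-≥ : ∀ {n} (f : Fin n → ℕ) i → f i ≤ sum f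
sum-≥ f zero = m≤m+n _ _
sum-≥ f (suc i) = ≤-trans (sum-≥ (f ∘ suc) i) (m≤n+m _ _)

sum-zero : ∀ {n} (f : Fin n → ℕ) → (∀ i → f i ≡ 0) → sum f ≡ 0
sum-zero {zero} f h = refl
sum-zero {suc n} f h = cong₂ _+_ (h zero) (sum-zero (f ∘ suc) (h ∘ suc))

sum-one : ∀ {n} (f : Fin n → ℕ) i → (∀ j → j ≢ i → f j ≡ 0) → sum f ≡ f i
sum-one f zero h = trans (cong (f zero +_) (sum-zero (f ∘ suc) (λ j → h (suc j) λ ()))) (+-identityʳ _)
sum-one f (suc i) h = cong₂ _+_ (h zero λ ()) (sum-one (f ∘ suc) i (λ j j≢ → h (suc j) (j≢ ∘ suc-injective)))

module _ {n : ℕ} {P : Fin n → Set} (P? : Decidable P) where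

  #-empty : (∀ i → ¬ P i) → # P? ≡ 0
  #-empty h = sum-zero _ (λ i → 𝟙-no (P? i) (h i))

  #-pos : ∀ {i} → P i → 1 ≤ # P?
  #-pos {i} p = ≤-trans (≤-reflexive (sym (𝟙-yes (P? i) p))) (sum-≥ _ i)

  #-unique : ∀ i → P i → (∀ j → P j → j ≡ i) → # P? ≡ 1
  #-unique i p h = trans (sum-one _ i (λ j j≢ → 𝟙-no (P? j) (j≢ ∘ h j))) (𝟙-yes (P? i) p)

  #-≤1 : (∀ i j → P i → P j → i ≡ j) → # P? ≤ 1
  #-≤1 h with any? P?
  ... | yes (i , p) = ≤-reflexive (#-unique i p (λ j q → h j i q p))
  ... | no ¬∃ = ≤-trans (≤-reflexive (#-empty (λ i p → ¬∃ (i , p)))) z≤n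

module _ {n : ℕ} {P Q : Fin n → Set} (P? : Decidable P) (Q? : Decidable Q) where

  #-mono : (∀ i → P i → Q i) → # P? ≤ # Q?
  #-mono h = sum-mono _ _ (λ i → 𝟙-mono (P? i) (Q? i) (h i))

  #-split : # P? ≡ # (λ i → P? i ×-dec Q? i) + # (λ i → P? i ×-dec ¬? (Q? i))
  #-split = trans (sum-cong-≗ pointwise)
    (∑-distrib-+ (λ i → 𝟙 (P? i ×-dec Q? i)) (λ i → 𝟙 (P? i ×-dec ¬? (Q? i))))
    where
    pointwise : ∀ i → 𝟙 (P? i) ≡ 𝟙 (P? i ×-dec Q? i) + 𝟙 (P? i ×-dec ¬? (Q? i))
    pointwise i with P? i | Q? i
    ... | no _ | _ = refl
    ... | yes _ | no _ = refl
    ... | yes _ | yes _ = refl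

module _ {n : ℕ} {P Q : Fin n → Set} (P? : Decidable P) (Q? : Decidable Q) where

  #-cong : (∀ i → P i → Q i) → (∀ i → Q i → P i) → # P? ≡ # Q?
  #-cong f g = ≤-antisym (#-mono P? Q? f) (#-mono Q? P? g)

  #-⊂ : (∀ i → P i → Q i) → ∀ {i} → Q i → ¬ P i → # P? < # Q?
  #-⊂ h {i} q ¬p = begin-strict
    # P?                                                           ≡⟨ #-cong′ ⟩
    # (λ i → Q? i ×-dec P? i)                                      <⟨ m<m+n _ (#-pos (λ i → Q? i ×-dec ¬? (P? i)) (q , ¬p)) ⟩
    # (λ i → Q? i ×-dec P? i) + # (λ i → Q? i ×-dec ¬? (P? i))     ≡⟨ sym (#-split Q? P?) ⟩
    # Q? ∎
    where
    open ≤-Reasoning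
    #-cong′ : # P? ≡ # (λ i → Q? i ×-dec P? i)
    #-cong′ = ≤-antisym (#-mono P? (λ i → Q? i ×-dec P? i) (λ i p → h i p , p)) (#-mono (λ i → Q? i ×-dec P? i) P? (λ i → proj₂))

#-full : ∀ {n} {P : Fin n → Set} (P? : Decidable P) → (∀ i → P i) → # P? ≡ n
#-full {zero} P? h = refl
#-full {suc n} P? h = cong₂ _+_ (𝟙-yes (P? zero) (h zero)) (#-full (P? ∘ suc) (h ∘ suc))

#-≤n : ∀ {n} {P : Fin n → Set} (P? : Decidable P) → # P? ≤ n
#-≤n {n} P? = ≤-trans (#-mono {Q = λ _ → ⊤} P? (λ _ → yes tt) (λ _ _ → tt)) (≤-reflexive (#-full {n} (λ _ → yes tt) (λ _ → tt)))

-- Double counting and comparison of cardinalities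

module DoubleCount {m n : ℕ} {P : Fin m → Set} {Q : Fin n → Set} {R : Fin m → Fin n → Set}
  (P? : Decidable P) (Q? : Decidable Q) (R? : ∀ a b → Dec (R a b)) where

  row : Fin m → ℕ
  row a = # (λ b → Q? b ×-dec R? a b)

  col : Fin n → ℕ
  col b = # (λ a → P? a ×-dec R? a b)

  ∑rows≡∑cols : sum (λ a → 𝟙 (P? a) * row a) ≡ sum (λ b → 𝟙 (Q? b) * col b)
  ∑rows≡∑cols = begin
    sum (λ a → 𝟙 (P? a) * row a)                                          ≡⟨ sum-cong-≗ (λ a → *-distribˡ-sum (𝟙 (P? a)) (λ b → 𝟙 (Q? b ×-dec R? a b))) ⟩
    sum (λ a → sum (λ b → 𝟙 (P? a) * 𝟙 (Q? b ×-dec R? a b)))              ≡⟨ ∑-comm (λ a b → 𝟙 (P? a) * 𝟙 (Q? b ×-dec R? a b)) ⟩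
    sum (λ b → sum (λ a → 𝟙 (P? a) * 𝟙 (Q? b ×-dec R? a b)))              ≡⟨ sum-cong-≗ (λ b → sum-cong-≗ (λ a → swap (P? a) (Q? b) (R? a b))) ⟩
    sum (λ b → sum (λ a → 𝟙 (Q? b) * 𝟙 (P? a ×-dec R? a b)))              ≡⟨ sum-cong-≗ (λ b → sym (*-distribˡ-sum (𝟙 (Q? b)) (λ a → 𝟙 (P? a ×-dec R? a b)))) ⟩
    sum (λ b → 𝟙 (Q? b) * col b) ∎
    where
    open ≡-Reasoning
    swap : {A B C : Set} (d : Dec A) (e : Dec B) (f : Dec C) → 𝟙 d * 𝟙 (e ×-dec f) ≡ 𝟙 e * 𝟙 (d ×-dec f)
    swap (no _) (no _) f = refl
    swap (no _) (yes _) f = refl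
    swap (yes _) (no _) f = refl
    swap (yes _) (yes _) f = refl

𝟙*-mono : {A : Set} (d : Dec A) {x y : ℕ} → (A → x ≤ y) → 𝟙 d * x ≤ 𝟙 d * y
𝟙*-mono (no _) h = z≤n
𝟙*-mono (yes a) h = +-monoˡ-≤ 0 (h a)

module _ {m n : ℕ} {P : Fin m → Set} {Q : Fin n → Set} {R : Fin m → Fin n → Set}
  (P? : Decidable P) (Q? : Decidable Q) (R? : ∀ a b → Dec (R a b)) where

  private module D = DoubleCount P? Q? R?

  double-count-≤ : ∀ {p q} → (∀ a → P a → p ≤ D.row a) → (∀ b → Q b → D.col b ≤ q) → # P? * p ≤ # Q? * q
  double-count-≤ {p} {q} f g = begin
    # P? * p                       ≡⟨ *-distribʳ-sum p (λ a → 𝟙 (P? a)) ⟩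
    sum (λ a → 𝟙 (P? a) * p)       ≤⟨ sum-mono _ _ (λ a → 𝟙*-mono (P? a) (f a)) ⟩
    sum (λ a → 𝟙 (P? a) * D.row a) ≡⟨ D.∑rows≡∑cols ⟩
    sum (λ b → 𝟙 (Q? b) * D.col b) ≤⟨ sum-mono _ _ (λ b → 𝟙*-mono (Q? b) (g b)) ⟩
    sum (λ b → 𝟙 (Q? b) * q)       ≡⟨ sym (*-distribʳ-sum q (λ b → 𝟙 (Q? b))) ⟩
    # Q? * q ∎
    where open ≤-Reasoning

module _ {m n : ℕ} {P : Fin m → Set} {Q : Fin n → Set} {R : Fin m → Fin n → Set}
  (P? : Decidable P) (Q? : Decidable Q) (R? : ∀ a b → Dec (R a b)) where

  private module D = DoubleCount P? Q? R?

  double-count : ∀ {p q} → (∀ a → P a → D.row a ≡ p) → (∀ b → Q b → D.col b ≡ q) → # P? * p ≡ # Q? * q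
  double-count f g = ≤-antisym
    (double-count-≤ P? Q? R? (λ a x → ≤-reflexive (sym (f a x))) (λ b x → ≤-reflexive (g b x)))
    (double-count-≤ Q? P? (λ b a → R? a b) (λ b x → ≤-reflexive (sym (g b x))) (λ a x → ≤-reflexive (f a x)))

-- The value `f a p` may depend on the proof `p`. The graph uses the proof supplied by `P?`, which
-- makes it a decidable single-valued relation.
module Graph {m n : ℕ} {P : Fin m → Set} (P? : Decidable P) (f : ∀ a → P a → Fin n) where

  private
    Graph′ : ∀ a → Dec (P a) → Fin n → Set
    Graph′ a (yes p) b = f a p ≡ b
    Graph′ a (no _) b = ⊥

    graph′? : ∀ a (d : Dec (P a)) b → Dec (Graph′ a d b)
    graph′? a (yes p) b = f a p ≟F b
    graph′? a (no _) b = no id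

  Graph : Fin m → Fin n → Set
  Graph a = Graph′ a (P? a)

  graph? : ∀ a b → Dec (Graph a b)
  graph? a = graph′? a (P? a)

  graph-fun : ∀ {a b} → Graph a b → Σ (P a) λ p → f a p ≡ b
  graph-fun {a} {b} with P? a
  ... | yes p = p ,_
  ... | no _ = λ ()

  graph-total : ∀ a → P a → ∃ (Graph a)
  graph-total a p with P? a
  ... | yes p′ = f a p′ , refl
  ... | no ¬p = ⊥-elim (¬p p)

module _ {m n : ℕ} {P : Fin m → Set} {Q : Fin n → Set} (P? : Decidable P) (Q? : Decidable Q)
  (f : ∀ a → P a → Fin n) (f∈Q : ∀ a p → Q (f a p))
  (f-inj : ∀ {a a′} (p : P a) (p′ : P a′) → f a p ≡ f a′ p′ → a ≡ a′) where

  open Graph P? f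

  injection-≤ : # P? ≤ # Q?
  injection-≤ = subst₂ _≤_ (*-identityʳ _) (*-identityʳ _)
    (double-count-≤ P? Q? graph? row≥ col≤)
    where
    row≥ : ∀ a → P a → 1 ≤ # (λ b → Q? b ×-dec graph? a b)
    row≥ a p = let b , g = graph-total a p
                   p′ , e = graph-fun g
               in #-pos (λ b → Q? b ×-dec graph? a b) (subst Q e (f∈Q a p′) , g)
    col≤ : ∀ b → Q b → # (λ a → P? a ×-dec graph? a b) ≤ 1
    col≤ b _ = #-≤1 (λ a → P? a ×-dec graph? a b) λ a a′ (_ , g) (_ , g′) →
      let p , e = graph-fun g
          p′ , e′ = graph-fun g′
      in f-inj p p′ (trans e (sym e′))

module _ {m n : ℕ} {P : Fin m → Set} {Q : Fin n → Set} (P? : Decidable P) (Q? : Decidable Q)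
  (f : ∀ a → P a → Fin n) (f∈Q : ∀ a p → Q (f a p))
  (f-inj : ∀ {a a′} (p : P a) (p′ : P a′) → f a p ≡ f a′ p′ → a ≡ a′) where

  open Graph P? f

  injection-hits : # Q? ≤ # P? → ∀ b → Q b → ∃ λ a → Σ (P a) λ p → f a p ≡ b
  injection-hits le b q with any? (λ a → graph? a b)
  ... | yes (a , g) = a , graph-fun g
  ... | no missed = ⊥-elim (<⇒≱ (<-≤-trans smaller le) restricted)
    where
    Q′? : Decidable (λ c → Q c × c ≢ b)
    Q′? c = Q? c ×-dec ¬? (c ≟F b)
    smaller : # Q′? < # Q?
    smaller = #-⊂ Q′? Q? (λ _ → proj₁) q (λ z → proj₂ z refl)
    f′ : ∀ a → P a → Fin n
    f′ a p = proj₁ (graph-total a p)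
    restricted : # P? ≤ # Q′?
    restricted = injection-≤ P? Q′? f′
      (λ a p → let g = proj₂ (graph-total a p) in
        subst Q (proj₂ (graph-fun g)) (f∈Q a (proj₁ (graph-fun g))) ,
        λ e → missed (a , subst (Graph a) e g))
      (λ {a} {a′} p p′ e → let g = proj₂ (graph-total a p); g′ = proj₂ (graph-total a′ p′) in
        f-inj (proj₁ (graph-fun g)) (proj₁ (graph-fun g′))
          (trans (proj₂ (graph-fun g)) (trans e (sym (proj₂ (graph-fun g′))))))

module _ {m n : ℕ} {P : Fin m → Set} {Q : Fin n → Set} (P? : Decidable P) (Q? : Decidable Q)
  (f : Fin m → Fin n) (g : Fin n → Fin m)
  (f∈Q : ∀ a → P a → Q (f a)) (g∈P : ∀ b → Q b → P (g b))
  (gf : ∀ a → P a → g (f a) ≡ a) (fg : ∀ b → Q b → f (g b) ≡ b) where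

  bijection-≡ : # P? ≡ # Q?
  bijection-≡ = ≤-antisym
    (injection-≤ P? Q? (λ a _ → f a) f∈Q (λ p p′ e → trans (sym (gf _ p)) (trans (cong g e) (gf _ p′))))
    (injection-≤ Q? P? (λ b _ → g b) g∈P (λ q q′ e → trans (sym (fg _ q)) (trans (cong f e) (fg _ q′))))

-- One class is split off at a time; the rest is again a union of classes. The laws of an
-- equivalence relation are required on `P` only, so that they pass to the rest.
classes-∣ : ∀ {n} d {P : Fin n → Set} (P? : Decidable P) {R : Fin n → Fin n → Set} (R? : ∀ x y → Dec (R x y)) →
  (∀ {x} → P x → R x x) → (∀ {x y} → P x → R x y → P y) →
  (∀ {x y} → P x → R x y → R y x) → (∀ {x y z} → P x → R x y → R y z → R x z) →
  (∀ x → P x → d ∣ # (R? x)) → d ∣ # P?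
classes-∣ {n} d {P} P? {R} R? R-refl R-closed R-sym R-trans R-div = go (# P?) P? ≤-refl R-refl R-closed R-sym R-trans R-div
  where
  go : ∀ k {P : Fin n → Set} (P? : Decidable P) → # P? ≤ k →
    (∀ {x} → P x → R x x) → (∀ {x y} → P x → R x y → P y) →
    (∀ {x y} → P x → R x y → R y x) → (∀ {x y z} → P x → R x y → R y z → R x z) →
    (∀ x → P x → d ∣ # (R? x)) → d ∣ # P?
  go k {P} P? le rf cl sy tr dv with any? P?
  go k {P} P? le rf cl sy tr dv | no ¬∃ = subst (d ∣_) (sym (#-empty P? λ i p → ¬∃ (i , p))) (d ∣0)
  go zero {P} P? le rf cl sy tr dv | yes (x , p) = ⊥-elim (<⇒≱ (#-pos P? p) le)
  go (suc k) {P} P? le rf cl sy tr dv | yes (x , p) =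
    subst (d ∣_) (sym (#-split P? (R? x)))
      (∣m∣n⇒∣m+n
        (subst (d ∣_) (#-cong (R? x) (λ y → P? y ×-dec R? x y) (λ y r → cl p r , r) (λ y → proj₂)) (dv x p))
        (go k P′? (≤-pred (≤-trans (#-⊂ P′? P? (λ _ → proj₁) p (λ z → proj₂ z (rf p))) le))
          (λ z → rf (proj₁ z))
          (λ z r → cl (proj₁ z) r , λ r′ → proj₂ z (tr p r′ (sy (proj₁ z) r)))
          (λ z → sy (proj₁ z)) (λ z → tr (proj₁ z)) (λ y z → dv y (proj₁ z))))
    where
    P′? : Decidable (λ y → P y × ¬ R x y)
    P′? y = P? y ×-dec ¬? (R? x y)

-- Fixed points of permutations of prime power order

iter : {A : Set} → ℕ → (A → A) → A → A
iter zero f x = x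
iter (suc n) f x = f (iter n f x)

module _ {A : Set} (f : A → A) where

  iter-+ : ∀ m n x → iter (m + n) f x ≡ iter m f (iter n f x)
  iter-+ zero n x = refl
  iter-+ (suc m) n x = cong f (iter-+ m n x)

  iter-* : ∀ m n x → iter (m * n) f x ≡ iter m (iter n f) x
  iter-* zero n x = refl
  iter-* (suc m) n x = trans (iter-+ n (m * n) x) (cong (iter n f) (iter-* m n x))

  iter-fixed : ∀ n {x} → f x ≡ x → iter n f x ≡ x
  iter-fixed zero e = refl
  iter-fixed (suc n) e = trans (cong f (iter-fixed n e)) e

  iter-suc : ∀ n x → iter (suc n) f x ≡ iter n f (f x)
  iter-suc zero x = refl
  iter-suc (suc n) x = cong f (iter-suc n x)

  iter-*-fixed : ∀ m n {x} → iter n f x ≡ x → iter (m * n) f x ≡ x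
  iter-*-fixed m n {x} e = trans (iter-* m n x) (go m)
    where
    go : ∀ m → iter m (iter n f) x ≡ x
    go zero = refl
    go (suc m) = trans (cong (iter n f) (go m)) e

  iter-closed : ∀ (P : A → Set) → (∀ {x} → P x → P (f x)) → ∀ n {x} → P x → P (iter n f x)
  iter-closed P h zero p = p
  iter-closed P h (suc n) p = h (iter-closed P h n p)

  -- A substitute for injectivity: it shows that points moved by a map of finite order have images
  -- that are moved again.
  fixed-image : ∀ n .{{_ : NonZero n}} {x} → iter n f x ≡ x → f (f x) ≡ f x → f x ≡ x
  fixed-image (suc n) {x} e e′ = trans (sym (trans (iter-suc n x) (iter-fixed n e′))) e

module _ {n r : ℕ} (r-prime : Prime r) where

  private instance
    r≢0 : NonZero r
    r≢0 = prime⇒nonZero r-prime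

  module _ {P : Fin n → Set} (P? : Decidable P) (ρ : Fin n → Fin n) (ρ-closed : ∀ {x} → P x → P (ρ x))
    (ρ^r : ∀ {x} → P x → iter r ρ x ≡ x) (ρ-free : ∀ {x} → P x → ρ x ≢ x) where

    private
      R : Fin n → Fin n → Set
      R x y = ∃ λ (i : Fin r) → iter (toℕ i) ρ x ≡ y

      R? : ∀ x y → Dec (R x y)
      R? x y = any? λ i → iter (toℕ i) ρ x ≟F y

      reach : ∀ {x} → P x → ∀ m → R x (iter m ρ x)
      reach {x} p m = fromℕ< (m%n<n m r) , trans (cong (λ k → iter k ρ x) (toℕ-fromℕ< (m%n<n m r))) (sym (begin
        iter m ρ x                              ≡⟨ cong (λ k → iter k ρ x) (m≡m%n+[m/n]*n m r) ⟩
        iter (m % r + m / r * r) ρ x            ≡⟨ iter-+ ρ (m % r) _ x ⟩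
        iter (m % r) ρ (iter (m / r * r) ρ x)   ≡⟨ cong (iter (m % r) ρ) (iter-*-fixed ρ (m / r) r (ρ^r p)) ⟩
        iter (m % r) ρ x ∎))
        where open ≡-Reasoning

      -- `d` and `r` are coprime. By Bézout a multiple of one is the successor of a multiple of the
      -- other, and as both iterates fix `x`, so would `ρ`.
      no-shift : ∀ {x} → P x → ∀ {d} → .{{NonZero d}} → d < r → iter d ρ x ≢ x
      no-shift {x} p {d} d<r e with coprime-Bézout (prime⇒coprime r-prime d<r)
      ... | Bézout.+- u v eq = ρ-free p (trans (sym (cong ρ (iter-*-fixed ρ v d e))) (trans (cong (λ k → iter k ρ x) eq) (iter-*-fixed ρ u r (ρ^r p))))
      ... | Bézout.-+ u v eq = ρ-free p (trans (sym (cong ρ (iter-*-fixed ρ u r (ρ^r p)))) (trans (cong (λ k → iter k ρ x) eq) (iter-*-fixed ρ v d e)))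

      no-collision : ∀ {x} → P x → ∀ {i j} → i < j → j < r → iter i ρ x ≢ iter j ρ x
      no-collision {x} p {i} {j} i<j j<r e = no-shift (iter-closed ρ P ρ-closed i p) {{>-nonZero (m<n⇒0<n∸m i<j)}} (≤-<-trans (m∸n≤m j i) j<r)
        (sym (trans e (trans (cong (λ k → iter k ρ x) (sym (m∸n+n≡m (<⇒≤ i<j)))) (iter-+ ρ (j ∸ i) i x))))

      class-size : ∀ x → P x → # (R? x) ≡ r
      class-size x p = ≤-antisym
        (≤-trans (injection-≤ {Q = λ (_ : Fin r) → ⊤} (R? x) (λ _ → yes tt) (λ y → proj₁) (λ _ _ → tt)
          (λ z z′ e → trans (sym (proj₂ z)) (trans (cong (λ i → iter (toℕ i) ρ x) e) (proj₂ z′)))) (#-≤n {r} {λ _ → ⊤} (λ _ → yes tt)))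
        (≤-trans (≤-reflexive (sym (#-full {r} (λ _ → yes tt) (λ _ → tt))))
          (injection-≤ {P = λ (_ : Fin r) → ⊤} (λ _ → yes tt) (R? x) (λ i _ → iter (toℕ i) ρ x) (λ i _ → i , refl)
            (λ {i} {j} _ _ e → toℕ-injective (inj i j e))))
        where
        inj : ∀ i j → iter (toℕ i) ρ x ≡ iter (toℕ j) ρ x → toℕ i ≡ toℕ j
        inj i j e with <-cmp (toℕ i) (toℕ j)
        ... | tri< lt _ _ = ⊥-elim (no-collision p lt (toℕ<n j) e)
        ... | tri≈ _ eq _ = eq
        ... | tri> _ _ gt = ⊥-elim (no-collision p gt (toℕ<n i) (sym e))

    free-prime-order : r ∣ # P?
    free-prime-order = classes-∣ r P? R?
      (λ p → reach p 0)
      (λ { p (i , refl) → iter-closed ρ P ρ-closed (toℕ i) p })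
      (λ { {x} p (i , refl) → subst (R _) (back x p i) (reach (iter-closed ρ P ρ-closed (toℕ i) p) (r ∸ toℕ i)) })
      (λ { {x} p (i , refl) (j , refl) → subst (R x) (iter-+ ρ (toℕ j) (toℕ i) x) (reach p (toℕ j + toℕ i)) })
      (λ x p → subst (r ∣_) (sym (class-size x p)) ∣-refl)
      where
      back : ∀ x → P x → (i : Fin r) → iter (r ∸ toℕ i) ρ (iter (toℕ i) ρ x) ≡ x
      back x p i = trans (sym (iter-+ ρ (r ∸ toℕ i) (toℕ i) x)) (trans (cong (λ k → iter k ρ x) (m∸n+n≡m (<⇒≤ (toℕ<n i)))) (ρ^r p))

  -- Put `ρ = iter (r ^ k) π`. On the fixed points of `ρ` the induction hypothesis applies to `π`;
  -- on the other points `ρ` itself is free of order `r`.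
  free-prime-power-order : ∀ k {P : Fin n → Set} (P? : Decidable P) (π : Fin n → Fin n) → (∀ {x} → P x → P (π x)) →
    (∀ {x} → P x → iter (r ^ k) π x ≡ x) → (∀ {x} → P x → π x ≢ x) → r ∣ # P?
  free-prime-power-order zero P? π cl π^e free = subst (r ∣_) (sym (#-empty P? λ x p → free p (π^e p))) (r ∣0)
  free-prime-power-order (suc k) {P} P? π cl π^e free = subst (r ∣_) (sym (#-split P? fixed?)) (∣m∣n⇒∣m+n
    (free-prime-power-order k (λ x → P? x ×-dec fixed? x) π
      (λ (p , e) → cl p , trans (sym (iter-suc π (r ^ k) _)) (cong π e)) proj₂ (λ z → free (proj₁ z)))
    (free-prime-order (λ x → P? x ×-dec ¬? (fixed? x)) ρ
      (λ (p , ne) → iter-closed π P cl (r ^ k) p , λ e → ne (fixed-image ρ r (ρ^r p) e))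
      (λ z → ρ^r (proj₁ z)) proj₂))
    where
    ρ : Fin n → Fin n
    ρ = iter (r ^ k) π
    fixed? : Decidable (λ x → ρ x ≡ x)
    fixed? x = ρ x ≟F x
    ρ^r : ∀ {x} → P x → iter r ρ x ≡ x
    ρ^r p = trans (sym (iter-* π r (r ^ k) _)) (π^e p)

  -- The moved points carry a free action, so their number is divisible by `r`. Non-divisibility,
  -- rather than a congruence, is what gets passed along a sequence of commuting permutations.
  fixed-points-∤ : ∀ k {P : Fin n → Set} (P? : Decidable P) (π : Fin n → Fin n) → (∀ {x} → P x → P (π x)) →
    (∀ {x} → P x → iter (r ^ k) π x ≡ x) → ¬ r ∣ # P? → ¬ r ∣ # (λ x → P? x ×-dec (π x ≟F x))
  fixed-points-∤ k P? π cl π^e r∤ r∣ = r∤ (subst (r ∣_) (sym (#-split P? (λ x → π x ≟F x))) (∣m∣n⇒∣m+n r∣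
    (free-prime-power-order k (λ x → P? x ×-dec ¬? (π x ≟F x)) π
      (λ (p , ne) → cl p , λ e → ne (fixed-image π (r ^ k) {{m^n≢0 r k}} (π^e p) e))
      (λ z → π^e (proj₁ z)) proj₂)))

-- Deciding group identities by free reduction

module GroupSolver {c ℓ} (𝔾 : Group c ℓ) where
  private
    module G = Group 𝔾
  open GroupProperties 𝔾 using (⁻¹-anti-homo-∙; ⁻¹-involutive; ε⁻¹≈ε)

  infixl 6 _⊗_
  infix 8 _⊖

  data Expr (n : ℕ) : Set where
    var : Fin n → Expr n
    ∙ε : Expr n
    _⊗_ : Expr n → Expr n → Expr n
    _⊖ : Expr n → Expr n

  private
    Env : ℕ → Set c
    Env n = Vec G.Carrier n

    Word : ℕ → Set
    Word n = List (Bool × Fin n)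

    ⟦_⟧ : ∀ {n} → Expr n → Env n → G.Carrier
    ⟦ var i ⟧ ρ = lookup ρ i
    ⟦ ∙ε ⟧ ρ = G.ε
    ⟦ e ⊗ f ⟧ ρ = ⟦ e ⟧ ρ G.∙ ⟦ f ⟧ ρ
    ⟦ e ⊖ ⟧ ρ = ⟦ e ⟧ ρ G.⁻¹

    sign : Bool → G.Carrier → G.Carrier
    sign true x = x
    sign false x = x G.⁻¹

    ⟦_⟧ʷ : ∀ {n} → Word n → Env n → G.Carrier
    ⟦ [] ⟧ʷ ρ = G.ε
    ⟦ (b , i) ∷ w ⟧ʷ ρ = sign b (lookup ρ i) G.∙ ⟦ w ⟧ʷ ρ

    push : ∀ {n} → Bool → Fin n → Word n → Word n
    push b i [] = (b , i) ∷ []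
    push b i ((b′ , j) ∷ w) with i ≟F j | b ≟B b′
    ... | yes _ | no _ = w
    ... | yes _ | yes _ = (b , i) ∷ (b′ , j) ∷ w
    ... | no _ | _ = (b , i) ∷ (b′ , j) ∷ w

    -- The reduced word of `e`, or of its inverse if `b` is `false`, put in front of the word `w`;
    -- cancellation happens at the junction while letters are pushed.
    reduce : ∀ {n} → Expr n → Bool → Word n → Word n
    reduce (var i) b w = push b i w
    reduce ∙ε b w = w
    reduce (e ⊗ f) true w = reduce e true (reduce f true w)
    reduce (e ⊗ f) false w = reduce f false (reduce e false w)
    reduce (e ⊖) b w = reduce e (not b) w

    cancel : ∀ b b′ x y → b ≢ b′ → y G.≈ sign b x G.∙ (sign b′ x G.∙ y)
    cancel true true x y ne = ⊥-elim (ne refl)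
    cancel false false x y ne = ⊥-elim (ne refl)
    cancel true false x y ne = G.trans (G.sym (G.identityˡ y)) (G.trans (G.∙-congʳ (G.sym (G.inverseʳ x))) (G.assoc _ _ _))
    cancel false true x y ne = G.trans (G.sym (G.identityˡ y)) (G.trans (G.∙-congʳ (G.sym (G.inverseˡ x))) (G.assoc _ _ _))

    push-correct : ∀ {n} b (i : Fin n) w ρ → ⟦ push b i w ⟧ʷ ρ G.≈ sign b (lookup ρ i) G.∙ ⟦ w ⟧ʷ ρ
    push-correct b i [] ρ = G.refl
    push-correct b i ((b′ , j) ∷ w) ρ with i ≟F j | b ≟B b′
    ... | yes refl | no ne = cancel b b′ (lookup ρ i) _ ne
    ... | yes _ | yes _ = G.refl
    ... | no _ | _ = G.refl

    sign-not : ∀ b x → sign (not b) x G.≈ sign b (x G.⁻¹)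
    sign-not true x = G.refl
    sign-not false x = G.sym (⁻¹-involutive x)

    reduce-correct : ∀ {n} (e : Expr n) b w ρ → ⟦ reduce e b w ⟧ʷ ρ G.≈ sign b (⟦ e ⟧ ρ) G.∙ ⟦ w ⟧ʷ ρ
    reduce-correct (var i) b w ρ = push-correct b i w ρ
    reduce-correct ∙ε true w ρ = G.sym (G.identityˡ _)
    reduce-correct ∙ε false w ρ = G.sym (G.trans (G.∙-congʳ ε⁻¹≈ε) (G.identityˡ _))
    reduce-correct (e ⊗ f) true w ρ = G.trans (reduce-correct e true _ ρ)
      (G.trans (G.∙-congˡ (reduce-correct f true w ρ)) (G.sym (G.assoc _ _ _)))
    reduce-correct (e ⊗ f) false w ρ = G.trans (reduce-correct f false _ ρ)
      (G.trans (G.∙-congˡ (reduce-correct e false w ρ)) (G.trans (G.sym (G.assoc _ _ _)) (G.∙-congʳ (G.sym (⁻¹-anti-homo-∙ _ _)))))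
    reduce-correct (e ⊖) b w ρ = G.trans (reduce-correct e (not b) w ρ) (G.∙-congʳ (sign-not b _))

    ⟦_⇓⟧ : ∀ {n} → Expr n → Env n → G.Carrier
    ⟦ e ⇓⟧ ρ = ⟦ reduce e true [] ⟧ʷ ρ

    correct : ∀ {n} (e : Expr n) ρ → ⟦ e ⇓⟧ ρ G.≈ ⟦ e ⟧ ρ
    correct e ρ = G.trans (reduce-correct e true [] ρ) (G.identityʳ _)

  open Reflection G.setoid var ⟦_⟧ ⟦_⇓⟧ correct public using (solve; _⊜_)

-- Finite groups, cosets and Lagrange's theorem

record FinGroup (N : ℕ) : Set where
  infixl 7 _∙_
  infix 8 _⁻¹
  field
    _∙_ : Fin N → Fin N → Fin N
    ε : Fin N
    _⁻¹ : Fin N → Fin N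
    isGroup : IsGroup _≡_ _∙_ ε _⁻¹

  group : Group _ _
  group = record { isGroup = isGroup }

  open IsGroup isGroup public using (assoc; identityˡ; identityʳ; inverseˡ; inverseʳ)
  open GroupSolver group public

  record IsSubgroupOf (M : Fin N → Set) : Set where
    field
      ε∈ : M ε
      ∙∈ : ∀ {g h} → M g → M h → M (g ∙ h)
      ⁻¹∈ : ∀ {g} → M g → M (g ⁻¹)

    ∙⁻¹∈ : ∀ {g h} → M g → M h → M (g ∙ h ⁻¹)
    ∙⁻¹∈ a b = ∙∈ a (⁻¹∈ b)

    ⁻¹∙∈ : ∀ {g h} → M g → M h → M (g ⁻¹ ∙ h)
    ⁻¹∙∈ a b = ∙∈ (⁻¹∈ a) b

    cancelˡ : ∀ {g h} → M g → M (g ∙ h) → M h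
    cancelˡ {g} {h} a b = subst M (solve 2 (λ g h → g ⊖ ⊗ (g ⊗ h) ⊜ h) refl g h) (∙∈ (⁻¹∈ a) b)

    cancelʳ : ∀ {g h} → M h → M (g ∙ h) → M g
    cancelʳ {g} {h} a b = subst M (solve 2 (λ g h → g ⊗ h ⊗ h ⊖ ⊜ g) refl g h) (∙∈ b (⁻¹∈ a))

    transʳ : ∀ {g h k} → M (g ⁻¹ ∙ h) → M (h ⁻¹ ∙ k) → M (g ⁻¹ ∙ k)
    transʳ {g} {h} {k} a b = subst M (solve 3 (λ g h k → g ⊖ ⊗ h ⊗ (h ⊖ ⊗ k) ⊜ g ⊖ ⊗ k) refl g h k) (∙∈ a b)

    symʳ : ∀ {g h} → M (g ⁻¹ ∙ h) → M (h ⁻¹ ∙ g)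
    symʳ {g} {h} a = subst M (solve 2 (λ g h → (g ⊖ ⊗ h) ⊖ ⊜ h ⊖ ⊗ g) refl g h) (⁻¹∈ a)

    reflʳ : ∀ g → M (g ⁻¹ ∙ g)
    reflʳ g = subst M (sym (inverseˡ g)) ε∈

  open IsSubgroupOf

  ∩-subgroup : ∀ {M K} → IsSubgroupOf M → IsSubgroupOf K → IsSubgroupOf (λ g → M g × K g)
  ∩-subgroup m k = record
    { ε∈ = ε∈ m , ε∈ k
    ; ∙∈ = λ (a , b) (c , d) → ∙∈ m a c , ∙∈ k b d
    ; ⁻¹∈ = λ (a , b) → ⁻¹∈ m a , ⁻¹∈ k b }

  ∙-cancelˡ : ∀ {a b c} → a ∙ b ≡ a ∙ c → b ≡ c
  ∙-cancelˡ {a} {b} {c} = GroupProperties.∙-cancelˡ group a b c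

  ∙-cancelʳ : ∀ {a b c} → b ∙ a ≡ c ∙ a → b ≡ c
  ∙-cancelʳ {a} {b} {c} = GroupProperties.∙-cancelʳ group a b c

  pow : ℕ → Fin N → Fin N
  pow n a = iter n (a ∙_) ε

  iter-pow : ∀ n a x → iter n (a ∙_) x ≡ pow n a ∙ x
  iter-pow zero a x = sym (identityˡ x)
  iter-pow (suc n) a x = trans (cong (a ∙_) (iter-pow n a x)) (sym (assoc _ _ _))

  pow-+ : ∀ m n a → pow (m + n) a ≡ pow m a ∙ pow n a
  pow-+ m n a = trans (iter-+ (a ∙_) m n ε) (iter-pow m a _)

  pow-* : ∀ m n a → pow (m * n) a ≡ pow m (pow n a)
  pow-* zero n a = refl
  pow-* (suc m) n a = trans (pow-+ n (m * n) a) (cong (pow n a ∙_) (pow-* m n a))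

  pow-ε : ∀ n → pow n ε ≡ ε
  pow-ε zero = refl
  pow-ε (suc n) = trans (identityˡ _) (pow-ε n)

  module _ {M : Fin N → Set} (M-sub : IsSubgroupOf M) where

    pow-∈ : ∀ n {a} → M a → M (pow n a)
    pow-∈ zero m = ε∈ M-sub
    pow-∈ (suc n) m = ∙∈ M-sub m (pow-∈ n m)

  module Cosets {M : Fin N → Set} (M? : Decidable M) (M-sub : IsSubgroupOf M) where

    private
      -- The smallest element of the left coset of `g`, so that equal cosets receive equal
      -- representatives. The double negation comes from searching for a counterexample to
      -- non-membership; `rep-∈` removes it by decidability.
      least : ∀ g → ∃ λ i → ¬ ¬ M (g ⁻¹ ∙ i) × (∀ j → j <F i → ¬ M (g ⁻¹ ∙ j))
      least g with ¬∀⟶∃¬-smallest N (λ i → ¬ M (g ⁻¹ ∙ i)) (λ i → ¬? (M? (g ⁻¹ ∙ i))) (λ h → h g (reflʳ M-sub g))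
      ... | i , ¬¬m , min = i , ¬¬m , λ j j<i → subst (λ k → ¬ M (g ⁻¹ ∙ k)) (inject-<  i j j<i) (min (lower i j j<i))
        where
        open import Data.Fin using (Fin′; inject; fromℕ<)
        open import Data.Fin.Properties using (toℕ-injective; toℕ-inject; toℕ-fromℕ<)
        lower : (i j : Fin N) → j <F i → Fin′ i
        lower i j lt = fromℕ< lt
        inject-< : (i j : Fin N) (lt : j <F i) → inject (lower i j lt) ≡ j
        inject-< i j lt = toℕ-injective (trans (toℕ-inject {i = i} (fromℕ< lt)) (toℕ-fromℕ< lt))

    rep : Fin N → Fin N
    rep g = proj₁ (least g)

    rep-∈ : ∀ g → M (g ⁻¹ ∙ rep g)
    rep-∈ g = decidable-stable (M? _) (proj₁ (proj₂ (least g)))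

    private
      rep-min : ∀ g {h} → M (g ⁻¹ ∙ h) → ¬ h <F rep g
      rep-min g m lt = proj₂ (proj₂ (least g)) _ lt m

    rep-cong : ∀ {g h} → M (g ⁻¹ ∙ h) → rep g ≡ rep h
    rep-cong {g} {h} m with <F-cmp (rep g) (rep h)
    ... | tri≈ _ e _ = e
    ... | tri< lt _ _ = ⊥-elim (rep-min h (transʳ M-sub (symʳ M-sub m) (rep-∈ g)) lt)
    ... | tri> _ _ gt = ⊥-elim (rep-min g (transʳ M-sub m (rep-∈ h)) gt)

    rep-≡ : ∀ {g h} → rep g ≡ rep h → M (g ⁻¹ ∙ h)
    rep-≡ {g} {h} e = transʳ M-sub (rep-∈ g) (symʳ M-sub (subst (λ k → M (h ⁻¹ ∙ k)) (sym e) (rep-∈ h)))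

    -- These representatives stand for the points of the coset space, on which `act` is left
    -- translation.
    X : Fin N → Set
    X x = rep x ≡ x

    X? : Decidable X
    X? x = rep x ≟F x

    rep-X : ∀ g → X (rep g)
    rep-X g = sym (rep-cong (rep-∈ g))

    index : ℕ
    index = # X?

    coset-size : ∀ x → # (λ g → M? (x ⁻¹ ∙ g)) ≡ # M?
    coset-size x = bijection-≡ (λ g → M? (x ⁻¹ ∙ g)) M? (x ⁻¹ ∙_) (x ∙_) (λ _ → id)
      (λ b → subst M (solve 2 (λ x b → b ⊜ x ⊖ ⊗ (x ⊗ b)) refl x b))
      (λ a _ → solve 2 (λ x b → x ⊗ (x ⊖ ⊗ b) ⊜ b) refl x a)
      (λ b _ → solve 2 (λ x b → x ⊖ ⊗ (x ⊗ b) ⊜ b) refl x b)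

    transversal : ∀ {P : Fin N → Set} (P? : Decidable P) q → (∀ x → # (λ g → P? g ×-dec M? (x ⁻¹ ∙ g)) ≡ q) → # P? ≡ index * q
    transversal P? q h = trans (sym (*-identityʳ _)) (double-count P? X? (λ g x → rep g ≟F x)
      (λ g p → #-unique (λ x → X? x ×-dec (rep g ≟F x)) (rep g) (rep-X g , refl) (λ x (_ , e) → sym e))
      (λ x x∈ → trans (#-cong (λ g → P? g ×-dec (rep g ≟F x)) (λ g → P? g ×-dec M? (x ⁻¹ ∙ g))
        (λ g (p , e) → p , symʳ M-sub (rep-≡ (trans e (sym x∈))))
        (λ g (p , m) → p , trans (sym (rep-cong m)) x∈)) (h x)))

    lagrange : N ≡ index * # M?
    lagrange = trans (sym (#-full {N} (λ _ → yes tt) (λ _ → tt))) (transversal (λ _ → yes tt) (# M?) λ x →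
      trans (#-cong (λ g → yes tt ×-dec M? (x ⁻¹ ∙ g)) (λ g → M? (x ⁻¹ ∙ g)) (λ _ → proj₂) (λ _ m → tt , m)) (coset-size x))

    act : Fin N → Fin N → Fin N
    act g x = rep (g ∙ x)

    rep-∙ : ∀ g y → rep (g ∙ rep y) ≡ rep (g ∙ y)
    rep-∙ g y = sym (rep-cong (subst M (solve 3 (λ g y z → y ⊖ ⊗ z ⊜ (g ⊗ y) ⊖ ⊗ (g ⊗ z)) refl g y (rep y)) (rep-∈ y)))

    iter-act : ∀ n g {x} → X x → iter n (act g) x ≡ rep (pow n g ∙ x)
    iter-act zero g {x} x∈ = trans (sym x∈) (cong rep (sym (identityˡ x)))
    iter-act (suc n) g {x} x∈ = trans (cong (act g) (iter-act n g x∈)) (trans (rep-∙ g _) (cong rep (sym (assoc _ _ _))))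

  subgroup-∣ : ∀ {M P} (M? : Decidable M) (P? : Decidable P) → IsSubgroupOf M → IsSubgroupOf P → (∀ g → M g → P g) → # M? ∣ # P?
  subgroup-∣ {M} {P} M? P? m p M⊆P = classes-∣ (# M?) P? (λ x y → M? (x ⁻¹ ∙ y))
    (λ {x} _ → reflʳ m x)
    (λ {x} {y} px r → subst P (solve 2 (λ x y → x ⊗ (x ⊖ ⊗ y) ⊜ y) refl x y) (∙∈ p px (M⊆P _ r)))
    (λ _ → symʳ m) (λ _ → transʳ m)
    (λ x _ → subst (# M? ∣_) (sym (Cosets.coset-size M? m x)) ∣-refl)

  module Quotient {M : Fin N → Set} (M-sub : IsSubgroupOf M) (conj : ∀ g {σ} → M σ → M (g ∙ σ ∙ g ⁻¹)) where

    infix 4 _∼_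
    _∼_ : Fin N → Fin N → Set
    g ∼ h = M (g ⁻¹ ∙ h)

    conj⁻¹ : ∀ g {σ} → M σ → M (g ⁻¹ ∙ σ ∙ g)
    conj⁻¹ g {σ} s = subst M (solve 2 (λ g σ → g ⊖ ⊗ σ ⊗ g ⊖ ⊖ ⊜ g ⊖ ⊗ σ ⊗ g) refl g σ) (conj (g ⁻¹) s)

    ∼-refl : ∀ {g} → g ∼ g
    ∼-refl {g} = reflʳ M-sub g

    ∼-reflexive : ∀ {g h} → g ≡ h → g ∼ h
    ∼-reflexive refl = ∼-refl

    ∼-sym : ∀ {g h} → g ∼ h → h ∼ g
    ∼-sym = symʳ M-sub

    ∼-trans : ∀ {g h k} → g ∼ h → h ∼ k → g ∼ k
    ∼-trans = transʳ M-sub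

    ∼-∙ : ∀ {g g′ h h′} → g ∼ g′ → h ∼ h′ → g ∙ h ∼ g′ ∙ h′
    ∼-∙ {g} {g′} {h} {h′} p q = subst M
      (solve 4 (λ g g′ h h′ → (h ⊖ ⊗ (g ⊖ ⊗ g′) ⊗ h) ⊗ (h ⊖ ⊗ h′) ⊜ (g ⊗ h) ⊖ ⊗ (g′ ⊗ h′)) refl g g′ h h′)
      (∙∈ M-sub (conj⁻¹ h p) q)

    ∼-⁻¹ : ∀ {g h} → g ∼ h → g ⁻¹ ∼ h ⁻¹
    ∼-⁻¹ {g} {h} p = subst M
      (solve 2 (λ g h → g ⊗ (h ⊖ ⊗ g) ⊗ g ⊖ ⊜ g ⊖ ⊖ ⊗ h ⊖) refl g h)
      (conj g (∼-sym p))

    -- The quotient keeps the carrier and coarsens the equality, so no representatives have to be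
    -- chosen.
    Γ/M : Group _ _
    Γ/M = record
      { Carrier = Fin N ; _≈_ = _∼_ ; _∙_ = _∙_ ; ε = ε ; _⁻¹ = _⁻¹
      ; isGroup = record
        { isMonoid = record
          { isSemigroup = record
            { isMagma = record
              { isEquivalence = record { refl = ∼-refl ; sym = ∼-sym ; trans = ∼-trans }
              ; ∙-cong = ∼-∙ }
            ; assoc = λ x y z → ∼-reflexive (assoc x y z) }
          ; identity = (λ x → ∼-reflexive (identityˡ x)) , (λ x → ∼-reflexive (identityʳ x)) }
        ; inverse = (λ x → ∼-reflexive (inverseˡ x)) , (λ x → ∼-reflexive (inverseʳ x))
        ; ⁻¹-cong = ∼-⁻¹ } }

    module ∼-Reasoning = SetoidReasoning (Group.setoid Γ/M)

    ∼-∙ˡ : ∀ g {h h′} → h ∼ h′ → g ∙ h ∼ g ∙ h′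
    ∼-∙ˡ g = ∼-∙ ∼-refl

    ∼-∙ʳ : ∀ h {g g′} → g ∼ g′ → g ∙ h ∼ g′ ∙ h
    ∼-∙ʳ h p = ∼-∙ p ∼-refl

-- Skew translation Kantor families

-- `F i S` plays the part of the tangent space of `F i`. `K2` says that it meets every other member
-- trivially, and `decompose` that the group is `F i F j S`. The orders of the group and of the
-- `F i` are left out: `decompose` and `cover` hold what is needed of them in a form that passes to
-- torsion subgroups.
record Family {N : ℕ} (Γ : FinGroup N) (t : ℕ) : Set₁ where
  open FinGroup Γ
  field
    2≤t : 2 ≤ t
    S : Fin N → Set
    S? : Decidable S
    S-sub : IsSubgroupOf S
    S-normal : ∀ g {σ} → S σ → S (g ∙ σ ∙ g ⁻¹)
    #S : # S? ≡ t
    F : Fin (suc t) → Fin N → Set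
    F? : ∀ i → Decidable (F i)
    F-sub : ∀ i → IsSubgroupOf (F i)
    F-nontrivial : ∀ i → ∃ λ a → F i a × a ≢ ε

  infix 4 _∼_
  _∼_ : Fin N → Fin N → Set
  g ∼ h = S (g ⁻¹ ∙ h)

  field
    K1 : ∀ {i j k a b c} → i ≢ j → i ≢ k → j ≢ k → F i a → F j b → F k c → a ∙ b ≡ c → c ≡ ε
    K2 : ∀ {i j a b} → i ≢ j → F i a → F j b → a ∼ b → a ≡ ε
    decompose : ∀ {i j} → i ≢ j → ∀ g → ∃ λ a → ∃ λ b → F i a × F j b × (a ∙ b) ∼ g
    cover : ∀ i g → (∃ λ a → F i a × a ∼ g) ⊎ (∃ λ j → ∃ λ a → ∃ λ b → j ≢ i × F i a × F j b × g ≡ a ∙ b)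

∃-third : ∀ {t} → 2 ≤ t → (i j : Fin (suc t)) → ∃ λ k → i ≢ k × j ≢ k
∃-third (s≤s (s≤s _)) zero zero = suc zero , (λ ()) , (λ ())
∃-third (s≤s (s≤s _)) zero (suc zero) = suc (suc zero) , (λ ()) , (λ ())
∃-third (s≤s (s≤s _)) zero (suc (suc j)) = suc zero , (λ ()) , (λ ())
∃-third (s≤s (s≤s _)) (suc zero) zero = suc (suc zero) , (λ ()) , (λ ())
∃-third (s≤s (s≤s _)) (suc (suc i)) zero = suc zero , (λ ()) , (λ ())
∃-third (s≤s (s≤s _)) (suc i) (suc j) = zero , (λ ()) , (λ ())

∃-other : ∀ {t} → 2 ≤ t → (i : Fin (suc t)) → ∃ λ j → i ≢ j
∃-other 2≤t i = let j , i≢j , _ = ∃-third 2≤t i i in j , i≢j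

module FamilyProperties {N t : ℕ} {Γ : FinGroup N} (𝓕 : Family Γ t) where
  open FinGroup Γ
  open Family 𝓕
  open IsSubgroupOf

  open Quotient S-sub S-normal public hiding (_∼_) renaming (conj⁻¹ to S-conj)

  ∼ε : ∀ {σ} → S σ → σ ∼ ε
  ∼ε {σ} s = subst S (sym (identityʳ _)) (⁻¹∈ S-sub s)

  S-from-∼ε : ∀ {g} → g ∼ ε → S g
  S-from-∼ε {g} p = subst S (solve 1 (λ g → (g ⊖ ⊗ ∙ε) ⊖ ⊜ g) refl g) (⁻¹∈ S-sub p)

  ∼ε⇒≡ε : ∀ {i a} → F i a → a ∼ ε → a ≡ ε
  ∼ε⇒≡ε {i} p q = K2 (proj₂ (∃-other 2≤t i)) p (ε∈ (F-sub _)) q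

  F-S-≡ : ∀ {i a b} → F i a → F i b → a ∼ b → a ≡ b
  F-S-≡ {i} {a} {b} p q r = sym (trans (solve 2 (λ a b → b ⊜ a ⊗ (a ⊖ ⊗ b)) refl a b)
    (trans (cong (a ∙_) (∼ε⇒≡ε (⁻¹∙∈ (F-sub i) p q) (∼ε r))) (identityʳ a)))

  F-unique : ∀ {i j a a′ b b′} → i ≢ j → F i a → F i a′ → F j b → F j b′ → a ∙ b ∼ a′ ∙ b′ → a ≡ a′ × b ≡ b′
  F-unique {i} {j} {a} {a′} {b} {b′} i≢j p p′ q q′ r = a≡a′ , b≡b′
    where
    a≡a′ : a ≡ a′
    a≡a′ = F-S-≡ p p′ (∼-sym (∼-trans (∼-reflexive (solve 2 (λ a x → x ⊜ a ⊗ (a ⊖ ⊗ x)) refl a a′))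
      (∼-trans (∼-∙ˡ a (∼-reflexive (K2 i≢j (⁻¹∙∈ (F-sub i) p p′) (∙⁻¹∈ (F-sub j) q q′) (begin
        a ⁻¹ ∙ a′                          ≡⟨ solve 3 (λ a x d → a ⊖ ⊗ x ⊜ a ⊖ ⊗ (x ⊗ d) ⊗ d ⊖) refl a a′ b′ ⟩
        a ⁻¹ ∙ (a′ ∙ b′) ∙ b′ ⁻¹           ≈⟨ ∼-∙ʳ _ (∼-∙ˡ _ (∼-sym r)) ⟩
        a ⁻¹ ∙ (a ∙ b) ∙ b′ ⁻¹             ≡⟨ solve 3 (λ a b d → a ⊖ ⊗ (a ⊗ b) ⊗ d ⊖ ⊜ b ⊗ d ⊖) refl a b b′ ⟩
        b ∙ b′ ⁻¹                          ∎)))) (∼-reflexive (identityʳ a)))))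
      where open ∼-Reasoning
    b≡b′ : b ≡ b′
    b≡b′ = F-S-≡ q q′ (subst₂ _∼_ (solve 2 (λ a b → a ⊖ ⊗ (a ⊗ b) ⊜ b) refl a b)
      (trans (cong (λ x → a ⁻¹ ∙ (x ∙ b′)) (sym a≡a′)) (solve 2 (λ a b → a ⊖ ⊗ (a ⊗ b) ⊜ b) refl a b′)) (∼-∙ˡ (a ⁻¹) r))

  InFS : Fin (suc t) → Fin N → Set
  InFS i g = ∃ λ a → F i a × a ∼ g

  InFS? : ∀ i g → Dec (InFS i g)
  InFS? i g = any? λ a → F? i a ×-dec S? _

  -- Modulo `S`, write `g` as an element of `F j` times one of `F i`, for each of the `t` indices
  -- `j` other than `i`. If two of the components in `F i` agreed, the remaining factor would lie in
  -- two members modulo `S`, hence be trivial by `K2`, and `g` would lie in `F i S`.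
  module Spread {i : Fin (suc t)} {g : Fin N} (g∉ : ¬ InFS i g) where

    private
      dec : ∀ k → _
      dec k = decompose (punchInᵢ≢i i k) g

    component : Fin t → Fin N
    component k = proj₁ (proj₂ (dec k))

    component-∈ : ∀ k → F i (component k)
    component-∈ k = proj₁ (proj₂ (proj₂ (proj₂ (dec k))))

    component-inj : ∀ {k l} → component k ≡ component l → k ≡ l
    component-inj {k} {l} e with k ≟F l
    ... | yes k≡l = k≡l
    ... | no k≢l = ⊥-elim (g∉ (component k , component-∈ k ,
      ∼-trans (∼-reflexive (sym (trans (cong (_∙ component k) b≡ε) (identityˡ _)))) (proj₂ (proj₂ (proj₂ (proj₂ (dec k)))))))
      where
      b : ∀ k → Fin N
      b k = proj₁ (dec k)
      b∼ : b k ∼ b l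
      b∼ = subst₂ _∼_ (solve 2 (λ x y → x ⊗ y ⊗ y ⊖ ⊜ x) refl (b k) (component k))
        (trans (cong (λ z → b l ∙ component l ∙ z ⁻¹) e) (solve 2 (λ x y → x ⊗ y ⊗ y ⊖ ⊜ x) refl (b l) (component l)))
        (∼-∙ʳ _ (∼-trans (proj₂ (proj₂ (proj₂ (proj₂ (dec k))))) (∼-sym (proj₂ (proj₂ (proj₂ (proj₂ (dec l))))))))
      b≡ε : b k ≡ ε
      b≡ε = K2 (λ e → k≢l (punchIn-injective i k l e)) (proj₁ (proj₂ (proj₂ (dec k)))) (proj₁ (proj₂ (proj₂ (dec l)))) b∼

  ∃-∉FS : ∀ i → ∃ λ g → ¬ InFS i g
  ∃-∉FS i with ∃-other 2≤t i
  ... | j , i≢j with F-nontrivial j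
  ... | b , b∈ , b≢ε = b , λ (a , a∈ , a∼b) → b≢ε (K2 (i≢j ∘ sym) b∈ a∈ (∼-sym a∼b))

  t≤#F : ∀ i → t ≤ # (F? i)
  t≤#F i = ≤-trans (≤-reflexive (sym (#-full {t} (λ _ → yes tt) (λ _ → tt))))
    (injection-≤ {P = λ (_ : Fin t) → ⊤} (λ _ → yes tt) (F? i) (λ k _ → component k) (λ k _ → component-∈ k) (λ _ _ → component-inj))
    where open Spread (proj₂ (∃-∉FS i))

  module _ (s≡t : ∀ i → # (F? i) ≡ t) where

    -- For `g` outside `F zero S` the `t` distinct components fill all of `F zero`. One of them is
    -- `ε`, which leaves `g` in the corresponding `F k S`.
    in-some-FS : ∀ g → ∃ λ k → InFS k g
    in-some-FS g with InFS? zero g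
    ... | yes p = zero , p
    ... | no g∉ with injection-hits {P = λ (_ : Fin t) → ⊤} (λ _ → yes tt) (F? zero) (λ k _ → component k) (λ k _ → component-∈ k) (λ _ _ → component-inj)
          (≤-reflexive (trans (s≡t zero) (sym (#-full {t} (λ _ → yes tt) (λ _ → tt))))) ε (ε∈ (F-sub zero))
      where open Spread g∉
    ... | k , _ , e = let b , a , b∈ , a∈ , r = decompose (punchInᵢ≢i zero k) g in
      punchIn zero k , b , b∈ , ∼-trans (∼-reflexive (sym (trans (cong (b ∙_) e) (identityʳ b)))) r

    -- Suppose the conjugate of `h` lies in `F k S` with `k` different from `i`. With `g` equal to
    -- `c ∙ a` modulo `S`, conjugating back by `c` puts `a ∙ h ∙ a ⁻¹`, an element of `F i`, into
    -- `F k S`, so `h` is trivial by `K2`.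
    FS-normal : ∀ i g {a} → F i a → InFS i (g ∙ a ∙ g ⁻¹)
    FS-normal i g {h} h∈ with in-some-FS (g ∙ h ∙ g ⁻¹)
    ... | k , b , b∈ , b∼ with k ≟F i
    ... | yes refl = b , b∈ , b∼
    ... | no k≢i with decompose k≢i g
    ... | c , a , c∈ , a∈ , ca∼g = ε , ε∈ (F-sub i) , ∼-reflexive (sym (trans (cong (λ x → g ∙ x ∙ g ⁻¹) h≡ε) (solve 1 (λ g → g ⊗ ∙ε ⊗ g ⊖ ⊜ ∙ε) refl g)))
      where
      open ∼-Reasoning
      aha⁻¹≡ε : a ∙ h ∙ a ⁻¹ ≡ ε
      aha⁻¹≡ε = K2 (k≢i ∘ sym) (∙⁻¹∈ (F-sub i) (∙∈ (F-sub i) a∈ h∈) a∈) (∙∈ (F-sub k) (∙∈ (F-sub k) (⁻¹∈ (F-sub k) c∈) b∈) c∈) (begin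
        a ∙ h ∙ a ⁻¹                                 ≡⟨ solve 3 (λ a h c → a ⊗ h ⊗ a ⊖ ⊜ c ⊖ ⊗ ((c ⊗ a) ⊗ h ⊗ (c ⊗ a) ⊖) ⊗ c) refl a h c ⟩
        c ⁻¹ ∙ ((c ∙ a) ∙ h ∙ (c ∙ a) ⁻¹) ∙ c        ≈⟨ ∼-∙ʳ c (∼-∙ˡ (c ⁻¹) (∼-∙ (∼-∙ʳ h ca∼g) (∼-⁻¹ ca∼g))) ⟩
        c ⁻¹ ∙ (g ∙ h ∙ g ⁻¹) ∙ c                    ≈⟨ ∼-∙ʳ c (∼-∙ˡ (c ⁻¹) (∼-sym b∼)) ⟩
        c ⁻¹ ∙ b ∙ c                                 ∎)
      h≡ε : h ≡ ε
      h≡ε = trans (solve 2 (λ a h → h ⊜ a ⊖ ⊗ (a ⊗ h ⊗ a ⊖) ⊗ a) refl a h)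
        (trans (cong (λ x → a ⁻¹ ∙ x ∙ a) aha⁻¹≡ε) (solve 1 (λ a → a ⊖ ⊗ ∙ε ⊗ a ⊜ ∙ε) refl a))

  module _ (FS-normal : ∀ i g {a} → F i a → InFS i (g ∙ a ∙ g ⁻¹)) where

    private
      -- The commutator lies in both `F i S` and `F j S`, whose intersection is `S` by `K2`.
      comm-distinct : ∀ {i j a b} → i ≢ j → F i a → F j b → a ∙ b ∼ b ∙ a
      comm-distinct {i} {j} {a} {b} i≢j a∈ b∈ = begin
          a ∙ b                                     ≡⟨ solve 2 (λ a b → a ⊗ b ⊜ (a ⊗ (b ⊗ a ⊖ ⊗ b ⊖)) ⊗ (b ⊗ a)) refl a b ⟩
          (a ∙ (b ∙ a ⁻¹ ∙ b ⁻¹)) ∙ (b ∙ a)         ≈⟨ ∼-∙ʳ _ (∼-∙ˡ a (∼-sym a′∼)) ⟩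
          (a ∙ a′) ∙ (b ∙ a)                        ≡⟨ cong (_∙ (b ∙ a)) aa′≡ε ⟩
          ε ∙ (b ∙ a)                               ≡⟨ identityˡ _ ⟩
          b ∙ a ∎
        where
        open ∼-Reasoning
        conj-a = FS-normal i b (⁻¹∈ (F-sub i) a∈)
        conj-b = FS-normal j a b∈
        a′ = proj₁ conj-a
        b′ = proj₁ conj-b
        a′∼ : a′ ∼ b ∙ a ⁻¹ ∙ b ⁻¹
        a′∼ = proj₂ (proj₂ conj-a)
        b′∼ : b′ ∼ a ∙ b ∙ a ⁻¹
        b′∼ = proj₂ (proj₂ conj-b)
        aa′≡ε : a ∙ a′ ≡ ε
        aa′≡ε = K2 i≢j (∙∈ (F-sub i) a∈ (proj₁ (proj₂ conj-a))) (∙⁻¹∈ (F-sub j) (proj₁ (proj₂ conj-b)) b∈) (begin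
          a ∙ a′                     ≈⟨ ∼-∙ˡ a a′∼ ⟩
          a ∙ (b ∙ a ⁻¹ ∙ b ⁻¹)      ≡⟨ solve 2 (λ a b → a ⊗ (b ⊗ a ⊖ ⊗ b ⊖) ⊜ (a ⊗ b ⊗ a ⊖) ⊗ b ⊖) refl a b ⟩
          (a ∙ b ∙ a ⁻¹) ∙ b ⁻¹      ≈⟨ ∼-∙ʳ _ (∼-sym b′∼) ⟩
          b′ ∙ b ⁻¹ ∎)

    private
      comm-product : ∀ {a b c g} → b ∙ c ∼ g → b ∙ a ∼ a ∙ b → c ∙ a ∼ a ∙ c → g ∙ a ∼ a ∙ g
      comm-product {a} {b} {c} {g} bc∼g p q = begin
        g ∙ a           ≈⟨ ∼-∙ʳ a (∼-sym bc∼g) ⟩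
        b ∙ c ∙ a       ≡⟨ assoc b c a ⟩
        b ∙ (c ∙ a)     ≈⟨ ∼-∙ˡ b q ⟩
        b ∙ (a ∙ c)     ≡⟨ sym (assoc b a c) ⟩
        b ∙ a ∙ c       ≈⟨ ∼-∙ʳ c p ⟩
        a ∙ b ∙ c       ≡⟨ assoc a b c ⟩
        a ∙ (b ∙ c)     ≈⟨ ∼-∙ˡ a bc∼g ⟩
        a ∙ g ∎
        where open ∼-Reasoning

      -- As `2 ≤ t`, there are two members other than `F i`; `a` is a product of their elements
      -- modulo `S`, and each factor commutes with `a′` by the case of distinct members.
      comm-same : ∀ {i a a′} → F i a → F i a′ → a ∙ a′ ∼ a′ ∙ a
      comm-same {i} {a} {a′} p p′ =
        let j , i≢j , _ = ∃-third 2≤t i i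
            k , i≢k , j≢k = ∃-third 2≤t i j
            b , c , b∈ , c∈ , bc∼a = decompose j≢k a
        in comm-product bc∼a (comm-distinct (i≢j ∘ sym) b∈ p′) (comm-distinct (i≢k ∘ sym) c∈ p′)

      comm-F : ∀ {i j a b} → F i a → F j b → a ∙ b ∼ b ∙ a
      comm-F {i} {j} p q with i ≟F j
      ... | yes refl = comm-same p q
      ... | no i≢j = comm-distinct i≢j p q

    commutative : ∀ g h → g ∙ h ∼ h ∙ g
    commutative g h =
      let j , i≢j = ∃-other 2≤t zero
          a , b , a∈ , b∈ , ab∼g = decompose i≢j g
          c , d , c∈ , d∈ , cd∼h = decompose i≢j h
      in comm-product ab∼g
           (∼-sym (comm-product cd∼h (comm-F c∈ a∈) (comm-F d∈ a∈)))
           (∼-sym (comm-product cd∼h (comm-F c∈ b∈) (comm-F d∈ b∈)))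

  module CommutativeQuotient (comm : ∀ g h → g ∙ h ∼ h ∙ g) where

    -- `F i` meets `S` trivially and so embeds in the commutative quotient.
    F-comm : ∀ {i a b} → F i a → F i b → a ∙ b ≡ b ∙ a
    F-comm {i} p q = F-S-≡ (∙∈ (F-sub i) p q) (∙∈ (F-sub i) q p) (comm _ _)

    pow-∼ : ∀ n {g h} → g ∼ h → pow n g ∼ pow n h
    pow-∼ zero p = ∼-refl
    pow-∼ (suc n) p = ∼-∙ p (pow-∼ n p)

    pow-∙ : ∀ n g h → pow n (g ∙ h) ∼ pow n g ∙ pow n h
    pow-∙ zero g h = ∼-reflexive (sym (identityˡ ε))
    pow-∙ (suc n) g h = begin
      g ∙ h ∙ pow n (g ∙ h)            ≈⟨ ∼-∙ˡ _ (pow-∙ n g h) ⟩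
      g ∙ h ∙ (pow n g ∙ pow n h)      ≡⟨ solve 4 (λ g h a b → g ⊗ h ⊗ (a ⊗ b) ⊜ g ⊗ (h ⊗ a) ⊗ b) refl g h (pow n g) (pow n h) ⟩
      g ∙ (h ∙ pow n g) ∙ pow n h      ≈⟨ ∼-∙ʳ _ (∼-∙ˡ g (comm h (pow n g))) ⟩
      g ∙ (pow n g ∙ h) ∙ pow n h      ≡⟨ solve 4 (λ g h a b → g ⊗ (a ⊗ h) ⊗ b ⊜ g ⊗ a ⊗ (h ⊗ b)) refl g h (pow n g) (pow n h) ⟩
      g ∙ pow n g ∙ (h ∙ pow n h) ∎
      where open ∼-Reasoning

-- Subgroups supplementing the group of symmetries

module Supplements {N t : ℕ} {Γ : FinGroup N} (𝓕 : Family Γ t) where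
  open FinGroup Γ
  open Family 𝓕
  open FamilyProperties 𝓕
  open IsSubgroupOf

  Supplement : (Fin N → Set) → Set
  Supplement M = ∀ g → ∃ λ m → M m × m ∼ g

  module _ {M : Fin N → Set} (M? : Decidable M) (M-sub : IsSubgroupOf M) (suppl : Supplement M) where

    S⊆M⇒full : (∀ σ → S σ → M σ) → ∀ g → M g
    S⊆M⇒full S⊆M g with suppl g
    ... | m , m∈ , m∼g = subst M (solve 2 (λ m g → m ⊗ (m ⊖ ⊗ g) ⊜ g) refl m g) (∙∈ M-sub m∈ (S⊆M _ m∼g))

    M∩S? : Decidable (λ g → M g × S g)
    M∩S? g = M? g ×-dec S? g

    M∩S-sub : IsSubgroupOf (λ g → M g × S g)
    M∩S-sub = ∩-subgroup M-sub S-sub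

    1≤#M∩S : 1 ≤ # M∩S?
    1≤#M∩S = #-pos M∩S? (ε∈ M∩S-sub)

    coset-meets-S : ∀ x → ∃ λ m → M m × S (x ∙ m ⁻¹)
    coset-meets-S x with suppl x
    ... | m , m∈ , m∼x = m , m∈ , subst S (solve 2 (λ m x → m ⊗ (m ⊖ ⊗ x) ⊗ m ⊖ ⊜ x ⊗ m ⊖) refl m x) (S-normal m m∼x)

    -- Every coset of `M` meets `S`, because `M` supplements `S`, and does so in a coset of `M ∩ S`.
    index-M∩S : t ≡ Cosets.index M? M-sub * # M∩S?
    index-M∩S = trans (sym #S) (Cosets.transversal M? M-sub S? (# M∩S?) meet)
      where
      meet : ∀ x → # (λ g → S? g ×-dec M? (x ⁻¹ ∙ g)) ≡ # M∩S?
      meet x with coset-meets-S x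
      ... | m , m∈ , σ∈ = bijection-≡ (λ g → S? g ×-dec M? (x ⁻¹ ∙ g)) M∩S? (σ ⁻¹ ∙_) (σ ∙_)
        (λ g (s , p) → subst M (solve 3 (λ x m g → m ⊗ (x ⊖ ⊗ g) ⊜ (x ⊗ m ⊖) ⊖ ⊗ g) refl x m g) (∙∈ M-sub m∈ p) , ⁻¹∙∈ S-sub σ∈ s)
        (λ ν (p , s) → ∙∈ S-sub σ∈ s , subst M (solve 3 (λ x m g → m ⊖ ⊗ g ⊜ x ⊖ ⊗ ((x ⊗ m ⊖) ⊗ g)) refl x m ν) (⁻¹∙∈ M-sub m∈ p))
        (λ g _ → solve 2 (λ x b → x ⊗ (x ⊖ ⊗ b) ⊜ b) refl σ g)
        (λ g _ → solve 2 (λ x b → x ⊖ ⊗ (x ⊗ b) ⊜ b) refl σ g)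
        where
        σ : Fin N
        σ = x ∙ m ⁻¹

    Contains : Fin (suc t) → Set
    Contains i = ∀ a → F i a → M a

    contains? : Decidable Contains
    contains? i = all? (λ a → F? i a →-dec M? a)

    -- For a nontrivial `b` in `F j` the element `b ∙ σ` is outside `F zero S`. By `cover` it is a
    -- product of elements of two members, hence in `M`, and so is `σ`.
    contains-all⇒S⊆M : (∀ i → Contains i) → ∀ σ → S σ → M σ
    contains-all⇒S⊆M all σ σ∈ with ∃-other 2≤t zero
    ... | j , 0≢j with F-nontrivial j
    ... | b , b∈ , b≢ε with cover zero (b ∙ σ)
    ... | inj₁ (a , a∈ , a∼) = ⊥-elim (b≢ε (K2 (0≢j ∘ sym) b∈ a∈
      (∼-sym (∼-trans a∼ (∼-trans (∼-∙ˡ b (∼ε σ∈)) (∼-reflexive (identityʳ b)))))))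
    ... | inj₂ (l , a , c , _ , a∈ , c∈ , e) = cancelˡ M-sub (all j b b∈) (subst M (sym e) (∙∈ M-sub (all zero a a∈) (all l c c∈)))

    -- If too many members F i lie in M, they cover M, so that M meets the other members trivially.
    many⇒trivial : # M∩S? < # contains? → ∀ {j} → ¬ Contains j → ∀ {c} → F j c → M c → c ≡ ε
    many⇒trivial many {j} j∉ {c} c∈F c∈M with c ≟F ε
    ... | yes e = e
    ... | no c≢ε with any? contains?
    ... | no none = ⊥-elim (<⇒≱ many (subst (_≤ # M∩S?) (sym (#-empty contains? (λ i p → none (i , p)))) z≤n))
    ... | yes (i , i∈) = ⊥-elim (<⇒≱ many (injection-≤ contains? M∩S? (λ l _ → ν l) ν-∈ (λ p q → ν-inj p q)))
      where
      j≢i : ∀ {l} → Contains l → j ≢ l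
      j≢i l∈ refl = j∉ l∈
      parts : ∀ l → i ≢ l → _
      parts l i≢l = decompose i≢l c
      a b : ∀ l → i ≢ l → Fin N
      a l ne = proj₁ (parts l ne)
      b l ne = proj₁ (proj₂ (parts l ne))
      a∈ : ∀ l ne → F i (a l ne)
      a∈ l ne = proj₁ (proj₂ (proj₂ (parts l ne)))
      b∈ : ∀ l ne → F l (b l ne)
      b∈ l ne = proj₁ (proj₂ (proj₂ (proj₂ (parts l ne))))
      -- Here `c` equals `a ∙ b ∙ ν l`. The index `i` is counted as well and gets `ε`, a value which
      -- `K1` denies to every other index.
      ν′ : ∀ l → Dec (i ≡ l) → Fin N
      ν′ l (yes _) = ε
      ν′ l (no ne) = (a l ne ∙ b l ne) ⁻¹ ∙ c
      ν : Fin (suc t) → Fin N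
      ν l = ν′ l (i ≟F l)
      ν-∈ : ∀ l → Contains l → M (ν l) × S (ν l)
      ν-∈ l l∈ with i ≟F l
      ... | yes _ = ε∈ M∩S-sub
      ... | no ne = ⁻¹∙∈ M-sub (∙∈ M-sub (i∈ _ (a∈ l ne)) (l∈ _ (b∈ l ne))) c∈M , proj₂ (proj₂ (proj₂ (proj₂ (parts l ne))))
      ν≢ε : ∀ l ne → Contains l → (a l ne ∙ b l ne) ⁻¹ ∙ c ≢ ε
      ν≢ε l ne l∈ e = c≢ε (K1 ne (j≢i i∈ ∘ sym) (j≢i l∈ ∘ sym) (a∈ l ne) (b∈ l ne) c∈F
        (sym (trans (solve 3 (λ a b c → c ⊜ (a ⊗ b) ⊗ ((a ⊗ b) ⊖ ⊗ c)) refl _ _ c) (trans (cong (_ ∙_) e) (identityʳ _)))))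
      ν-inj : ∀ {l l′} → Contains l → Contains l′ → ν l ≡ ν l′ → l ≡ l′
      ν-inj {l} {l′} l∈ l′∈ e with i ≟F l | i ≟F l′ | l ≟F l′
      ... | _ | _ | yes l≡l′ = l≡l′
      ... | yes refl | yes refl | no l≢l′ = ⊥-elim (l≢l′ refl)
      ... | yes _ | no ne | no _ = ⊥-elim (ν≢ε l′ ne l′∈ (sym e))
      ... | no ne | yes _ | no _ = ⊥-elim (ν≢ε l ne l∈ e)
      ... | no ne | no ne′ | no l≢l′ = ⊥-elim (c≢ε (K2 (j≢i i∈) c∈F (a∈ l′ ne′) c∼a))
        where
        open ∼-Reasoning
        products : a l ne ∙ b l ne ≡ a l′ ne′ ∙ b l′ ne′
        products = trans (solve 3 (λ a b c → a ⊗ b ⊜ c ⊗ ((a ⊗ b) ⊖ ⊗ c) ⊖) refl (a l ne) (b l ne) c)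
          (trans (cong (λ x → c ∙ x ⁻¹) e) (solve 3 (λ a b c → c ⊗ ((a ⊗ b) ⊖ ⊗ c) ⊖ ⊜ a ⊗ b) refl (a l′ ne′) (b l′ ne′) c))
        b′≡ε : b l′ ne′ ≡ ε
        b′≡ε = K1 ne ne′ l≢l′ (⁻¹∙∈ (F-sub i) (a∈ l′ ne′) (a∈ l ne)) (b∈ l ne) (b∈ l′ ne′)
          (trans (assoc _ _ _) (trans (cong (a l′ ne′ ⁻¹ ∙_) products) (solve 2 (λ a b → a ⊖ ⊗ (a ⊗ b) ⊜ b) refl (a l′ ne′) (b l′ ne′))))
        c∼a : c ∼ a l′ ne′
        c∼a = begin
          c                          ≈⟨ ∼-sym (proj₂ (proj₂ (proj₂ (proj₂ (parts l′ ne′))))) ⟩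
          a l′ ne′ ∙ b l′ ne′        ≡⟨ cong (a l′ ne′ ∙_) b′≡ε ⟩
          a l′ ne′ ∙ ε               ≡⟨ identityʳ _ ⟩
          a l′ ne′ ∎

    -- Compare F j with the elements of S moving it into M.
    trivial⇒product-≤ : ∀ j → (∀ {c} → F j c → M c → c ≡ ε) → # (F? j) * # M∩S? ≤ t
    trivial⇒product-≤ j trivial = subst (# (F? j) * # M∩S? ≤_) (trans (*-identityʳ _) #S)
      (double-count-≤ (F? j) S? (λ c σ → M? (c ∙ σ)) rows cols)
      where
      rows : ∀ c → F j c → # M∩S? ≤ # (λ σ → S? σ ×-dec M? (c ∙ σ))
      rows c _ with suppl c
      ... | m , m∈ , m∼c = injection-≤ M∩S? (λ σ → S? σ ×-dec M? (c ∙ σ)) (λ ν _ → c ⁻¹ ∙ m ∙ ν)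
        (λ ν (ν∈ , s) → ∙∈ S-sub (∼-sym m∼c) s , subst M (solve 3 (λ c m ν → m ⊗ ν ⊜ c ⊗ (c ⊖ ⊗ m ⊗ ν)) refl c m ν) (∙∈ M-sub m∈ ν∈))
        (λ _ _ → ∙-cancelˡ)
      cols : ∀ σ → S σ → # (λ c → F? j c ×-dec M? (c ∙ σ)) ≤ 1
      cols σ _ = #-≤1 (λ c → F? j c ×-dec M? (c ∙ σ)) λ c c′ (p , q) (p′ , q′) →
        trans (solve 2 (λ c d → c ⊜ (c ⊗ d ⊖) ⊗ d) refl c c′)
          (trans (cong (_∙ c′) (trivial (∙⁻¹∈ (F-sub j) p p′)
            (subst M (solve 3 (λ c d s → (c ⊗ s) ⊗ (d ⊗ s) ⊖ ⊜ c ⊗ d ⊖) refl c c′ σ) (∙⁻¹∈ M-sub q q′)))) (identityˡ c′))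

    many⇒ : # M∩S? < # contains? → (∀ g → M g) ⊎ (∃ λ j → # (F? j) * # M∩S? ≤ t)
    many⇒ many with all? contains?
    ... | yes all = inj₁ (S⊆M⇒full (contains-all⇒S⊆M all))
    ... | no ¬all = let j , j∉ = ¬∀⟶∃¬ (suc t) Contains contains? ¬all in
      inj₂ (j , trivial⇒product-≤ j (many⇒trivial many j∉))

-- Indices of proper subgroups

module PrimePowerFamily {N t : ℕ} {Γ : FinGroup N} (𝓕 : Family Γ t)
  (comm : ∀ g h → Family._∼_ 𝓕 (FinGroup._∙_ Γ g h) (FinGroup._∙_ Γ h g))
  {r : ℕ} (r-prime : Prime r) (k : ℕ)
  (F-exponent : ∀ i {a} → Family.F 𝓕 i a → FinGroup.pow Γ (r ^ k) a ≡ FinGroup.ε Γ) where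

  open FinGroup Γ
  open Family 𝓕
  open FamilyProperties 𝓕
  open Supplements 𝓕
  open IsSubgroupOf

  open CommutativeQuotient comm

  exponent : ∀ g → S (pow (r ^ k) g)
  exponent g with ∃-other 2≤t zero
  ... | j , 0≢j with decompose 0≢j g
  ... | a , b , a∈ , b∈ , ab∼g = S-from-∼ε (begin
    pow (r ^ k) g                      ≈⟨ pow-∼ (r ^ k) (∼-sym ab∼g) ⟩
    pow (r ^ k) (a ∙ b)                ≈⟨ pow-∙ (r ^ k) a b ⟩
    pow (r ^ k) a ∙ pow (r ^ k) b      ≡⟨ cong₂ _∙_ (F-exponent _ a∈) (F-exponent _ b∈) ⟩
    ε ∙ ε                              ≡⟨ identityˡ ε ⟩
    ε ∎)
    where open ∼-Reasoning

  r∣#F : ∀ i → r ∣ # (F? i)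
  r∣#F i with F-nontrivial i
  ... | a , a∈ , a≢ε = free-prime-power-order r-prime k (F? i) (a ∙_) (∙∈ (F-sub i) a∈)
    (λ {x} _ → trans (iter-pow (r ^ k) a x) (trans (cong (_∙ x) (F-exponent i a∈)) (identityˡ x)))
    (λ {x} _ e → a≢ε (∙-cancelʳ {x} (trans e (sym (identityˡ x)))))

  module _ {M : Fin N → Set} (M? : Decidable M) (M-sub : IsSubgroupOf M) where

    open Cosets M? M-sub

    MS : Fin N → Set
    MS g = ∃ λ m → M m × m ∼ g

    MS? : Decidable MS
    MS? g = any? λ m → M? m ×-dec S? _

    MS-sub : IsSubgroupOf MS
    MS-sub = record
      { ε∈ = ε , ε∈ M-sub , ∼-refl
      ; ∙∈ = λ (m , p , q) (m′ , p′ , q′) → m ∙ m′ , ∙∈ M-sub p p′ , ∼-∙ q q′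
      ; ⁻¹∈ = λ (m , p , q) → m ⁻¹ , ⁻¹∈ M-sub p , ∼-⁻¹ q }

    index-MS-∣ : Cosets.index MS? MS-sub ∣ index
    index-MS-∣ with subgroup-∣ M? MS? M-sub MS-sub (λ g m → g , m , ∼-refl)
    ... | divides q e = divides q (*-cancelʳ-≡ index (q * index₁) (# M?) {{>-nonZero (#-pos M? (ε∈ M-sub))}} (begin
      index * # M?            ≡⟨ sym lagrange ⟩
      N                       ≡⟨ Cosets.lagrange MS? MS-sub ⟩
      index₁ * # MS?          ≡⟨ cong (index₁ *_) e ⟩
      index₁ * (q * # M?)     ≡⟨ sym (*-assoc index₁ q _) ⟩
      index₁ * q * # M?       ≡⟨ cong (_* # M?) (*-comm index₁ q) ⟩
      q * index₁ * # M? ∎))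
      where
      open ≡-Reasoning
      index₁ : ℕ
      index₁ = Cosets.index MS? MS-sub

    -- Since `MS` contains `S` and the quotient by `S` is commutative, a coset of `MS` fixed by `g`
    -- would put `g` into `MS`. The power `r ^ k` of `g` lies in `S` and acts trivially.
    r∣index-MS : ∀ {g} → ¬ MS g → r ∣ Cosets.index MS? MS-sub
    r∣index-MS {g} g∉ = free-prime-power-order r-prime k C.X? (C.act g) (λ _ → C.rep-X _)
      (λ {x} x∈ → trans (C.iter-act (r ^ k) g x∈) (trans (sym (C.rep-cong
        (S⊆MS (subst S (solve 2 (λ x p → x ⊖ ⊗ p ⊗ x ⊜ x ⊖ ⊗ (p ⊗ x)) refl x (pow (r ^ k) g)) (S-conj x (exponent g)))))) x∈))
      (λ {x} x∈ e → g∉ (let m , m∈ , m∼ = C.rep-≡ (trans x∈ (sym e)) in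
        m , m∈ , ∼-trans m∼ (∼-trans (∼-∙ˡ (x ⁻¹) (comm g x)) (∼-reflexive (solve 2 (λ x g → x ⊖ ⊗ (x ⊗ g) ⊜ g) refl x g)))))
      where
      module C = Cosets MS? MS-sub
      S⊆MS : ∀ {σ} → S σ → MS σ
      S⊆MS s = ε , ε∈ M-sub , ∼-sym (∼ε s)

    module _ (suppl : Supplement M) (r∤index : ¬ r ∣ index) where

      private
        -- Vacuous for `a` outside `F i`, so that fixed points of `F i` can be found by running
        -- through the list of all elements.
        Fixed : Fin (suc t) → Fin N → Fin N → Set
        Fixed i x a = F i a → act a x ≡ x

        fixed? : ∀ i x → Decidable (Fixed i x)
        fixed? i x a = F? i a →-dec (act a x ≟F x)

        XFixed? : ∀ i l x → Dec (X x × All (Fixed i x) l)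
        XFixed? i l x = X? x ×-dec All.all? (fixed? i x) l

        -- `F i` is commutative, so `a` permutes the common fixed points of the elements treated
        -- before. Its action has `r`-power order, so the number of points that remain is again
        -- prime to `r`.
        many-fixed : ∀ i l → ¬ r ∣ # (XFixed? i l)
        many-fixed i [] d = r∤index (subst (r ∣_) (#-cong (XFixed? i []) X? (λ _ → proj₁) (λ _ x∈ → x∈ , [])) d)
        many-fixed i (a ∷ l) d = step (F? i a)
          where
          open ≡-Reasoning
          step : ¬ Dec (F i a)
          step (no a∉) = many-fixed i l (subst (r ∣_) (#-cong (XFixed? i (a ∷ l)) (XFixed? i l)
            (λ { _ (x∈ , _ ∷ h) → x∈ , h }) (λ _ (x∈ , h) → x∈ , (⊥-elim ∘ a∉) ∷ h)) d)
          step (yes a∈) = fixed-points-∤ r-prime k (XFixed? i l) (act a)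
            (λ {x} (_ , h) → rep-X _ , All.map (λ {b} hb b∈ → begin
              act b (act a x)         ≡⟨ rep-∙ b (a ∙ x) ⟩
              rep (b ∙ (a ∙ x))       ≡⟨ cong rep (trans (sym (assoc b a x)) (trans (cong (_∙ x) (F-comm b∈ a∈)) (assoc a b x))) ⟩
              rep (a ∙ (b ∙ x))       ≡⟨ sym (rep-∙ a (b ∙ x)) ⟩
              act a (act b x)         ≡⟨ cong (act a) (hb b∈) ⟩
              act a x ∎) h)
            (λ {x} (x∈ , _) → trans (iter-act (r ^ k) a x∈) (trans (cong (λ y → rep (y ∙ x)) (F-exponent i a∈)) (trans (cong rep (identityˡ x)) x∈)))
            (many-fixed i l)
            (subst (r ∣_) (#-cong (XFixed? i (a ∷ l)) (λ x → XFixed? i l x ×-dec (act a x ≟F x))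
              (λ { _ (x∈ , e ∷ h) → (x∈ , h) , e a∈ }) (λ { _ ((x∈ , h) , e) → x∈ , (λ _ → e) ∷ h })) d)

        Conj : Fin (suc t) → Fin N → Set
        Conj i σ = ∀ a → F i a → M (σ ⁻¹ ∙ a ∙ σ)

        conj? : ∀ i σ → Dec (Conj i σ)
        conj? i σ = all? λ a → F? i a →-dec M? _

        -- A coset of `x` fixed by `F i` means that `F i` lies in the conjugate of `M` by `x`. As
        -- `M` supplements `S`, the element `x` can be replaced by a symmetry of the same coset.
        some-conj : ∀ i → ∃ λ σ → S σ × Conj i σ
        some-conj i with any? (XFixed? i (allFin N))
        ... | no none = ⊥-elim (many-fixed i (allFin N) (subst (r ∣_) (sym (#-empty (XFixed? i (allFin N)) λ x p → none (x , p))) (r ∣0)))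
        ... | yes (x , x∈ , h) with coset-meets-S M? M-sub suppl x
        ... | m , m∈ , σ∈ = x ∙ m ⁻¹ , σ∈ , λ a a∈ →
          subst M (solve 3 (λ x m a → m ⊗ ((a ⊗ x) ⊖ ⊗ x) ⊖ ⊗ m ⊖ ⊜ (x ⊗ m ⊖) ⊖ ⊗ a ⊗ (x ⊗ m ⊖)) refl x m a)
            (∙⁻¹∈ M-sub (∙∈ M-sub m∈ (⁻¹∈ M-sub (rep-≡ (trans (All.lookup h (∈-allFin a) a∈) (sym x∈))))) m∈)

        N? : Decidable (λ g → M g × S g)
        N? = M∩S? M? M-sub suppl

        conj-rows : ∀ i → # N? ≤ # (λ σ → S? σ ×-dec conj? i σ)
        conj-rows i with some-conj i
        ... | σ , σ∈ , h = injection-≤ N? (λ σ → S? σ ×-dec conj? i σ) (λ ν _ → σ ∙ ν)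
          (λ ν (ν∈ , s) → ∙∈ S-sub σ∈ s , λ a a∈ → subst M (solve 3 (λ s n a → n ⊖ ⊗ (s ⊖ ⊗ a ⊗ s) ⊗ n ⊜ (s ⊗ n) ⊖ ⊗ a ⊗ (s ⊗ n)) refl σ ν a)
            (∙∈ M-sub (⁻¹∙∈ M-sub ν∈ (h a a∈)) ν∈))
          (λ _ _ → ∙-cancelˡ)

        ConjIn? : ∀ σ → Decidable (λ i → ⊤ × Conj i σ)
        ConjIn? σ i = yes tt ×-dec conj? i σ

        -- Each of the `suc t` indices has at least `# N?` suitable symmetries, and there are only
        -- `t` symmetries; some symmetry must serve more than `# N?` indices.
        crowded : ∃ λ σ → S σ × # N? < # (ConjIn? σ)
        crowded with any? (λ σ → S? σ ×-dec (suc (# N?) ≤? # (ConjIn? σ)))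
        ... | yes p = p
        ... | no none = ⊥-elim (<⇒≱ (m<n+m (t * # N?) (1≤#M∩S M? M-sub suppl)) (subst₂ (λ x y → x * # N? ≤ y * # N?) (#-full {suc t} (λ _ → yes tt) (λ _ → tt)) #S
          (double-count-≤ {P = λ (_ : Fin (suc t)) → ⊤} (λ _ → yes tt) S? conj? (λ i _ → conj-rows i) (λ σ σ∈ → ≮⇒≥ (λ lt → none (σ , σ∈ , lt))))))

      index-prime-to-r⇒full : ∀ g → M g
      index-prime-to-r⇒full with crowded
      ... | σ , σ∈ , lt = conclude (many⇒ M′? M′-sub M′-suppl (subst₂ _<_ #N≡#N′ (#-cong (ConjIn? σ) (contains? M′? M′-sub M′-suppl) (λ i → proj₂) (λ i c → tt , c)) lt))
        where
        M′ : Fin N → Set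
        M′ g = M (σ ⁻¹ ∙ g ∙ σ)
        M′? : Decidable M′
        M′? g = M? _
        M′-sub : IsSubgroupOf M′
        M′-sub = record
          { ε∈ = subst M (solve 1 (λ s → ∙ε ⊜ s ⊖ ⊗ ∙ε ⊗ s) refl σ) (ε∈ M-sub)
          ; ∙∈ = λ {g} {h} p q → subst M (solve 3 (λ s g h → (s ⊖ ⊗ g ⊗ s) ⊗ (s ⊖ ⊗ h ⊗ s) ⊜ s ⊖ ⊗ (g ⊗ h) ⊗ s) refl σ g h) (∙∈ M-sub p q)
          ; ⁻¹∈ = λ {g} p → subst M (solve 2 (λ s g → (s ⊖ ⊗ g ⊗ s) ⊖ ⊜ s ⊖ ⊗ g ⊖ ⊗ s) refl σ g) (⁻¹∈ M-sub p) }
        unconj : ∀ g → σ ⁻¹ ∙ (σ ∙ g ∙ σ ⁻¹) ∙ σ ≡ g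
        unconj g = solve 2 (λ s g → s ⊖ ⊗ (s ⊗ g ⊗ s ⊖) ⊗ s ⊜ g) refl σ g
        reconj : ∀ g → σ ∙ (σ ⁻¹ ∙ g ∙ σ) ∙ σ ⁻¹ ≡ g
        reconj g = solve 2 (λ s g → s ⊗ (s ⊖ ⊗ g ⊗ s) ⊗ s ⊖ ⊜ g) refl σ g
        M′-suppl : Supplement M′
        M′-suppl g with suppl (σ ⁻¹ ∙ g ∙ σ)
        ... | m , m∈ , m∼ = σ ∙ m ∙ σ ⁻¹ , subst M (sym (unconj m)) m∈ , subst (_ ∼_) (reconj g) (∼-∙ʳ _ (∼-∙ˡ σ m∼))
        #N≡#N′ : # N? ≡ # (M∩S? M′? M′-sub M′-suppl)
        #N≡#N′ = bijection-≡ N? (M∩S? M′? M′-sub M′-suppl) (λ g → σ ∙ g ∙ σ ⁻¹) (λ g → σ ⁻¹ ∙ g ∙ σ)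
          (λ g (p , s) → subst M (sym (unconj g)) p , S-normal σ s) (λ g (p , s) → p , S-conj σ s)
          (λ g _ → unconj g) (λ g _ → reconj g)
        conclude : (∀ g → M′ g) ⊎ (∃ λ j → # (F? j) * # (M∩S? M′? M′-sub M′-suppl) ≤ t) → ∀ g → M g
        conclude (inj₁ full) g = subst M (unconj g) (full (σ ∙ g ∙ σ ⁻¹))
        conclude (inj₂ (j , le)) = ⊥-elim (r∤index (subst (r ∣_) (trans #F≡t t≡index) (r∣#F j)))
          where
          0<t : 0 < t
          0<t = ≤-trans (s≤s z≤n) 2≤t
          le′ : # (F? j) * # N? ≤ t
          le′ = subst (λ x → # (F? j) * x ≤ t) (sym #N≡#N′) le
          #N≡1 : # N? ≡ 1
          #N≡1 = ≤-antisym (*-cancelˡ-≤ t {{>-nonZero 0<t}} (≤-trans (*-monoˡ-≤ (# N?) (t≤#F j)) (≤-trans le′ (≤-reflexive (sym (*-identityʳ t)))))) (1≤#M∩S M? M-sub suppl)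
          #F≡t : # (F? j) ≡ t
          #F≡t = ≤-antisym (subst (_≤ t) (trans (cong (# (F? j) *_) #N≡1) (*-identityʳ _)) le′) (t≤#F j)
          t≡index : t ≡ index
          t≡index = trans (index-M∩S M? M-sub suppl) (trans (cong (index *_) #N≡1) (*-identityʳ index))

    proper⇒r∣index : ∀ {g} → ¬ M g → r ∣ index
    proper⇒r∣index {g} g∉ with r ∣? index
    ... | yes d = d
    ... | no r∤ with all? MS?
    ... | yes suppl = ⊥-elim (g∉ (index-prime-to-r⇒full suppl r∤ g))
    ... | no ¬suppl = ∣-trans (r∣index-MS (proj₂ (¬∀⟶∃¬ N MS MS? ¬suppl))) index-MS-∣

-- Every symmetry is a product of commutators

module CommutatorSubgroup {N t : ℕ} {Γ : FinGroup N} (𝓕 : Family Γ t) where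
  open FinGroup Γ
  open Family 𝓕
  open FamilyProperties 𝓕
  open IsSubgroupOf

  module _ {K : Fin N → Set} (K? : Decidable K) (K-sub : IsSubgroupOf K) (K⊆S : ∀ κ → K κ → S κ)
    (commutator∈K : ∀ g h → K ((h ∙ g) ⁻¹ ∙ (g ∙ h))) {τ : Fin N} (τ∈S : S τ) (τ∉K : ¬ K τ) where

    private
      module K where
        open Quotient K-sub (λ g {κ} k → subst K (solve 2 (λ g κ → κ ⊗ ((g ⊖ ⊗ κ) ⊖ ⊗ (κ ⊗ g ⊖)) ⊜ g ⊗ κ ⊗ g ⊖) refl g κ)
          (∙∈ K-sub k (commutator∈K κ (g ⁻¹)))) public renaming (_∼_ to _≈_)

        comm : ∀ g h → g ∙ h ≈ h ∙ g
        comm g h = commutator∈K h g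

      open K using (_≈_)

      ≈⇒∼ : ∀ {g h} → g ≈ h → g ∼ h
      ≈⇒∼ = K⊆S _

      module _ (o : Fin t) where

        F₀ F₁ : Fin N → Set
        F₀ = F zero
        F₁ = F (suc o)

        F₁? : Decidable F₁
        F₁? = F? (suc o)

        s #K u : ℕ
        s = # F₁?
        #K = # K?
        u = t ∸ #K

        #K<t : #K < t
        #K<t = subst (#K <_) #S (#-⊂ K? S? K⊆S τ∈S τ∉K)

        #K+u≡t : #K + u ≡ t
        #K+u≡t = m+[n∸m]≡n (<⇒≤ #K<t)

        -- For fixed `j`, sending `b` to the coset of `σ` with `b` in `F₀ (F (suc j)) σ K` is a
        -- homomorphism from `F₁` to `S / K`. `Rel` is its graph and `Ker` its kernel.
        Rel : Fin t → Fin N → Fin N → Set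
        Rel j b σ = ∃ λ a → ∃ λ c → F₀ a × F (suc j) c × a ∙ c ≈ b ∙ σ ⁻¹

        rel? : ∀ j b σ → Dec (Rel j b σ)
        rel? j b σ = any? λ a → any? λ c → F? zero a ×-dec F? (suc j) c ×-dec K? _

        Ker : Fin N → Fin t → Set
        Ker b j = ∃ λ a → ∃ λ c → F₀ a × F (suc j) c × a ∙ c ≈ b

        ker? : ∀ b j → Dec (Ker b j)
        ker? b j = any? λ a → any? λ c → F? zero a ×-dec F? (suc j) c ×-dec K? _

        module D = DoubleCount {Q = λ (_ : Fin t) → ⊤} F₁? (λ _ → yes tt) ker?

        -- The index of the kernel in `F₁` is at most the order `t / #K` of `S / K`. Each `b` is
        -- related to at least `#K` symmetries, and the elements related to one symmetry are
        -- translated into the kernel.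
        s*#K≤t*col : ∀ j → s * #K ≤ t * D.col j
        s*#K≤t*col j = subst (λ x → s * #K ≤ x * D.col j) #S (double-count-≤ F₁? S? (rel? j) rows cols)
          where
          rows : ∀ b → F₁ b → #K ≤ # (λ σ → S? σ ×-dec rel? j b σ)
          rows b _ = let a , c , a∈ , c∈ , σ∈ = decompose (λ ()) b in
            injection-≤ K? (λ σ → S? σ ×-dec rel? j b σ) (λ κ _ → κ ∙ ((a ∙ c) ⁻¹ ∙ b))
              (λ κ κ∈ → ∙∈ S-sub (K⊆S κ κ∈) σ∈ , a , c , a∈ , c∈ ,
                subst K (solve 3 (λ κ x b → κ ⊖ ⊜ x ⊖ ⊗ (b ⊗ (κ ⊗ (x ⊖ ⊗ b)) ⊖)) refl κ (a ∙ c) b) (⁻¹∈ K-sub κ∈))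
              (λ _ _ → ∙-cancelʳ)
          cols : ∀ σ → S σ → # (λ b → F₁? b ×-dec rel? j b σ) ≤ D.col j
          cols σ _ with any? (λ b → F₁? b ×-dec rel? j b σ)
          ... | no none = ≤-trans (≤-reflexive (#-empty (λ b → F₁? b ×-dec rel? j b σ) (λ b p → none (b , p)))) z≤n
          ... | yes (b₀ , b₀∈ , a₀ , c₀ , a₀∈ , c₀∈ , r₀) = injection-≤ (λ b → F₁? b ×-dec rel? j b σ) (λ b → F₁? b ×-dec ker? b j)
            (λ b _ → b ∙ b₀ ⁻¹)
            (λ b (b∈ , a , c , a∈ , c∈ , r) → ∙⁻¹∈ (F-sub _) b∈ b₀∈ , a ∙ a₀ ⁻¹ , c ∙ c₀ ⁻¹ , ∙⁻¹∈ (F-sub _) a∈ a₀∈ , ∙⁻¹∈ (F-sub _) c∈ c₀∈ , (begin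
              a ∙ a₀ ⁻¹ ∙ (c ∙ c₀ ⁻¹)               ≡⟨ solve 4 (λ a x c y → a ⊗ x ⊖ ⊗ (c ⊗ y ⊖) ⊜ a ⊗ (x ⊖ ⊗ (c ⊗ y ⊖))) refl a a₀ c c₀ ⟩
              a ∙ (a₀ ⁻¹ ∙ (c ∙ c₀ ⁻¹))             ≈⟨ K.∼-∙ˡ a (K.comm _ _) ⟩
              a ∙ (c ∙ c₀ ⁻¹ ∙ a₀ ⁻¹)               ≡⟨ solve 4 (λ a x c y → a ⊗ (c ⊗ y ⊖ ⊗ x ⊖) ⊜ a ⊗ c ⊗ (x ⊗ y) ⊖) refl a a₀ c c₀ ⟩
              a ∙ c ∙ (a₀ ∙ c₀) ⁻¹                  ≈⟨ K.∼-∙ r (K.∼-⁻¹ r₀) ⟩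
              b ∙ σ ⁻¹ ∙ (b₀ ∙ σ ⁻¹) ⁻¹             ≡⟨ solve 3 (λ b σ x → b ⊗ σ ⊖ ⊗ (x ⊗ σ ⊖) ⊖ ⊜ b ⊗ x ⊖) refl b σ b₀ ⟩
              b ∙ b₀ ⁻¹ ∎))
            (λ _ _ → ∙-cancelʳ)
            where open K.∼-Reasoning

        s≤col : s ≤ D.col o
        s≤col = #-mono F₁? (λ b → F₁? b ×-dec ker? b o) λ b b∈ → b∈ , ε , b , ε∈ (F-sub _) , b∈ , K.∼-reflexive (identityˡ b)

        -- The offsets `(a ∙ c) ⁻¹ ∙ b` in `K` differ for different `j`: equal offsets give equal
        -- products, `K1` makes `c′` trivial, and then `b` agrees with an element of `F₀` modulo
        -- `S`, so it is `ε`.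
        row≤#K : ∀ {b} → F₁ b → b ≢ ε → D.row b ≤ #K
        row≤#K {b} b∈ b≢ε = injection-≤ (λ j → yes tt ×-dec ker? b j) K?
          (λ j (_ , a , c , _) → (a ∙ c) ⁻¹ ∙ b) (λ j (_ , _ , _ , _ , _ , r) → r)
          (λ {j} {j′} (_ , a , c , a∈ , c∈ , r) (_ , a′ , c′ , a′∈ , c′∈ , r′) e → case j ≟F j′ of λ
            { (yes j≡j′) → j≡j′
            ; (no j≢j′) → ⊥-elim (b≢ε (K2 (λ ()) b∈ a′∈ (∼-sym (subst (_∼ b)
                (trans (cong (a′ ∙_) (K1 (λ ()) (λ ()) (λ { refl → j≢j′ refl }) (⁻¹∙∈ (F-sub _) a′∈ a∈) c∈ c′∈ (begin
                  a′ ⁻¹ ∙ a ∙ c                              ≡⟨ solve 4 (λ x a c b → x ⊖ ⊗ a ⊗ c ⊜ x ⊖ ⊗ (b ⊗ ((a ⊗ c) ⊖ ⊗ b) ⊖)) refl a′ a c b ⟩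
                  a′ ⁻¹ ∙ (b ∙ ((a ∙ c) ⁻¹ ∙ b) ⁻¹)          ≡⟨ cong (λ x → a′ ⁻¹ ∙ (b ∙ x ⁻¹)) e ⟩
                  a′ ⁻¹ ∙ (b ∙ ((a′ ∙ c′) ⁻¹ ∙ b) ⁻¹)        ≡⟨ solve 3 (λ x c b → x ⊖ ⊗ (b ⊗ ((x ⊗ c) ⊖ ⊗ b) ⊖) ⊜ c) refl a′ c′ b ⟩
                  c′ ∎))) (identityʳ a′))
                (≈⇒∼ r′))))) })
          where open ≡-Reasoning

        -- Only the row of `ε` can exceed `#K`. Its length is at most `t`, whence the single excess
        -- `u`.
        upper : sum (λ b → 𝟙 (F₁? b) * D.row b) ≤ s * #K + u
        upper = begin
          sum (λ b → 𝟙 (F₁? b) * D.row b)                              ≤⟨ sum-mono _ _ pointwise ⟩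
          sum (λ b → 𝟙 (F₁? b) * #K + 𝟙 (b ≟F ε) * u)                   ≡⟨ ∑-distrib-+ (λ b → 𝟙 (F₁? b) * #K) (λ b → 𝟙 (b ≟F ε) * u) ⟩
          sum (λ b → 𝟙 (F₁? b) * #K) + sum (λ b → 𝟙 (b ≟F ε) * u)       ≡⟨ cong₂ _+_ (sym (*-distribʳ-sum #K (λ b → 𝟙 (F₁? b)))) (sym (*-distribʳ-sum u (λ b → 𝟙 (b ≟F ε)))) ⟩
          s * #K + # (λ b → b ≟F ε) * u                                ≡⟨ cong (λ x → s * #K + x * u) (#-unique (λ b → b ≟F ε) ε refl (λ _ → id)) ⟩
          s * #K + 1 * u                                               ≡⟨ cong (s * #K +_) (*-identityˡ u) ⟩
          s * #K + u ∎
          where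
          open ≤-Reasoning
          pointwise : ∀ b → 𝟙 (F₁? b) * D.row b ≤ 𝟙 (F₁? b) * #K + 𝟙 (b ≟F ε) * u
          pointwise b with F₁? b | b ≟F ε
          ... | no _ | _ = z≤n
          ... | yes b∈ | no b≢ε = subst₂ _≤_ (sym (+-identityʳ _)) (sym (trans (+-identityʳ _) (+-identityʳ _))) (row≤#K b∈ b≢ε)
          ... | yes _ | yes _ = subst₂ _≤_ (sym (+-identityʳ _)) (trans (sym #K+u≡t) (cong₂ _+_ (sym (+-identityʳ #K)) (sym (+-identityʳ u))))
            (#-≤n (λ j → yes tt ×-dec ker? b j))

        -- The column of `o` belongs to `F₁` itself and contains all `s` elements. After
        -- multiplication by `t`, which avoids division, it contributes `s * t`, which is
        -- `s * #K + s * u`; every other column contributes at least `s * #K`.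
        lower : t * (s * #K) + s * u ≤ t * sum (λ j → 1 * D.col j)
        lower = begin
          t * (s * #K) + s * u                                          ≡⟨ cong₂ (λ x y → x * (s * #K) + y) (sym (#-full {t} (λ _ → yes tt) (λ _ → tt))) (sym (*-identityˡ (s * u))) ⟩
          # {t} (λ _ → yes tt) * (s * #K) + 1 * (s * u)                 ≡⟨ cong (λ x → # {t} (λ _ → yes tt) * (s * #K) + x * (s * u)) (sym (#-unique (λ j → j ≟F o) o refl (λ _ → id))) ⟩
          # {t} (λ _ → yes tt) * (s * #K) + # (λ j → j ≟F o) * (s * u)  ≡⟨ cong₂ _+_ (*-distribʳ-sum (s * #K) (λ (_ : Fin t) → 1)) (*-distribʳ-sum (s * u) (λ j → 𝟙 (j ≟F o))) ⟩
          sum {t} (λ j → 1 * (s * #K)) + sum (λ j → 𝟙 (j ≟F o) * (s * u)) ≡⟨ sym (∑-distrib-+ {t} (λ _ → 1 * (s * #K)) (λ j → 𝟙 (j ≟F o) * (s * u))) ⟩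
          sum (λ j → 1 * (s * #K) + 𝟙 (j ≟F o) * (s * u))               ≤⟨ sum-mono _ _ pointwise ⟩
          sum (λ j → t * (1 * D.col j))                                 ≡⟨ sym (*-distribˡ-sum t (λ j → 1 * D.col j)) ⟩
          t * sum (λ j → 1 * D.col j) ∎
          where
          open ≤-Reasoning
          pointwise : ∀ j → 1 * (s * #K) + 𝟙 (j ≟F o) * (s * u) ≤ t * (1 * D.col j)
          pointwise j with j ≟F o
          ... | no _ = subst₂ _≤_ (sym (trans (+-identityʳ _) (+-identityʳ _))) (cong (t *_) (sym (+-identityʳ _))) (s*#K≤t*col j)
          ... | yes refl = begin
            1 * (s * #K) + 1 * (s * u)    ≡⟨ cong₂ _+_ (+-identityʳ (s * #K)) (+-identityʳ (s * u)) ⟩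
            s * #K + s * u                ≡⟨ sym (*-distribˡ-+ s #K u) ⟩
            s * (#K + u)                  ≡⟨ cong (s *_) #K+u≡t ⟩
            s * t                         ≡⟨ *-comm s t ⟩
            t * s                         ≤⟨ *-monoʳ-≤ t s≤col ⟩
            t * D.col j                   ≡⟨ cong (t *_) (sym (+-identityʳ (D.col j))) ⟩
            t * (1 * D.col j) ∎

        s≤t : s ≤ t
        -- The two bounds leave `s * u ≤ t * u`; `u` is positive because `τ` lies in `S` but not in
        -- `K`.
        s≤t = *-cancelʳ-≤ s t u {{>-nonZero (m<n⇒0<n∸m #K<t)}} (+-cancelˡ-≤ (t * (s * #K)) _ _ (begin
          t * (s * #K) + s * u                                ≤⟨ lower ⟩
          t * sum (λ j → 1 * D.col j)                         ≡⟨ cong (t *_) (sym D.∑rows≡∑cols) ⟩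
          t * sum (λ b → 𝟙 (F₁? b) * D.row b)                 ≤⟨ *-monoʳ-≤ t upper ⟩
          t * (s * #K + u)                                    ≡⟨ *-distribˡ-+ t (s * #K) u ⟩
          t * (s * #K) + t * u ∎))
          where open ≤-Reasoning

    #F≡t : ∀ o → # (F? (suc o)) ≡ t
    #F≡t o = ≤-antisym (s≤t o) (t≤#F (suc o))

    -- The pairs (a , b) ∈ F i × F j with i, j, 0 distinct and a b ∈ g τ K, where g ∈ F 0, are counted by t * # K;
    -- exchanging a and b is a free involution on them because G / K is commutative.
    private
      module _ {g : Fin N} (g∈ : F zero g) (g≢ε : g ≢ ε) where

        Partner : Fin N → Fin N → Set
        Partner a b = ∃ λ i → ∃ λ j → zero ≢ i × zero ≢ j × i ≢ j × F i a × F j b × g ∙ τ ≈ a ∙ b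

        partner? : ∀ a b → Dec (Partner a b)
        partner? a b = any? λ i → any? λ j → ¬? (zero ≟F i) ×-dec ¬? (zero ≟F j) ×-dec ¬? (i ≟F j) ×-dec F? i a ×-dec F? j b ×-dec K? _

        W : Fin N → Set
        W a = ∃ (Partner a)

        W? : Decidable W
        W? a = any? (partner? a)

        gτ∼g : g ∙ τ ∼ g
        gτ∼g = ∼-trans (∼-∙ˡ g (∼ε τ∈S)) (∼-reflexive (identityʳ g))

        ≁g : ∀ {i a} → zero ≢ i → F i a → ¬ a ∼ g
        ≁g 0≢i a∈ a∼g = g≢ε (K2 0≢i g∈ a∈ (∼-sym a∼g))

        partner-sym : ∀ {a b} → Partner a b → Partner b a
        partner-sym (i , j , 0≢i , 0≢j , i≢j , a∈ , b∈ , e) = j , i , 0≢j , 0≢i , (i≢j ∘ sym) , b∈ , a∈ , K.∼-trans e (K.comm _ _)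

        product∼g : ∀ {a b} → Partner a b → a ∙ b ∼ g
        product∼g (_ , _ , _ , _ , _ , _ , _ , e) = ∼-trans (∼-sym (≈⇒∼ e)) gτ∼g

        left≢ε : ∀ {a b} → Partner a b → a ≢ ε
        left≢ε {a} {b} p@(_ , _ , _ , 0≢j , _ , _ , b∈ , _) refl = ≁g 0≢j b∈ (∼-trans (∼-reflexive (sym (identityˡ b))) (product∼g p))

        partner-unique : ∀ {a b c} → Partner a b → Partner a c → b ≡ c
        partner-unique {a} {b} {c} p@(_ , j , _ , _ , _ , _ , b∈ , _) q@(_ , l , _ , _ , _ , _ , c∈ , _) = case j ≟F l of λ
          { (yes refl) → F-S-≡ b∈ c∈ b∼c
          ; (no j≢l) → ⊥-elim (left≢ε (partner-sym p) (K2 j≢l b∈ c∈ b∼c)) }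
          where
          b∼c : b ∼ c
          b∼c = subst₂ _∼_ (solve 2 (λ a b → a ⊖ ⊗ (a ⊗ b) ⊜ b) refl a b) (solve 2 (λ a b → a ⊖ ⊗ (a ⊗ b) ⊜ b) refl a c)
            (∼-∙ˡ (a ⁻¹) (∼-trans (product∼g p) (∼-sym (product∼g q))))

        partner≢ : ∀ {a b} → Partner a b → b ≢ a
        partner≢ p@(i , j , _ , _ , i≢j , a∈ , b∈ , _) refl = left≢ε p (K2 i≢j a∈ b∈ ∼-refl)

        abstract
          exchange : Fin N → Fin N
          exchange a with W? a
          ... | yes (b , _) = b
          ... | no _ = a

          exchange-partner : ∀ a → W a → Partner a (exchange a)
          exchange-partner a w with W? a
          ... | yes (_ , p) = p
          ... | no ¬w = ⊥-elim (¬w w)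

        exchange-W : ∀ a → W a → W (exchange a)
        exchange-W a w = a , partner-sym (exchange-partner a w)

        exchange-involutive : ∀ a → W a → exchange (exchange a) ≡ a
        exchange-involutive a w = partner-unique (exchange-partner (exchange a) (exchange-W a w)) (partner-sym (exchange-partner a w))

        exchange-free : ∀ a → W a → exchange a ≢ a
        exchange-free a w = partner≢ (exchange-partner a w)

        2∣#W : 2 ∣ # W?
        2∣#W = free-prime-order prime[2] W? exchange (λ {a} → exchange-W a) (λ {a} → exchange-involutive a) (λ {a} → exchange-free a)

        Offset : Fin N → Fin N → Set
        Offset a κ = ∃ λ b → Partner a b × (g ∙ τ) ⁻¹ ∙ (a ∙ b) ≡ κ

        offset? : ∀ a κ → Dec (Offset a κ)
        offset? a κ = any? λ b → partner? a b ×-dec (_ ≟F κ)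

        offset-product : ∀ {a b κ} → (g ∙ τ) ⁻¹ ∙ (a ∙ b) ≡ κ → a ∙ b ≡ g ∙ τ ∙ κ
        offset-product {a} {b} refl = solve 2 (λ x y → y ⊜ x ⊗ (x ⊖ ⊗ y)) refl (g ∙ τ) (a ∙ b)

        -- Count the `a` in `W` by their offsets `κ` in `K`. An `a` has only one partner, hence one
        -- offset. For given `κ`, each of the `t` members other than `F zero` contains exactly one
        -- `a` with `a ∙ b = g ∙ τ ∙ κ`.
        #W≡#K*t : # W? ≡ # K? * t
        #W≡#K*t = trans (sym (*-identityʳ _)) (double-count W? K? offset?
          (λ a (b , p@(_ , _ , _ , _ , _ , _ , _ , κ∈)) → #-unique (λ κ → K? κ ×-dec offset? a κ) ((g ∙ τ) ⁻¹ ∙ (a ∙ b)) (κ∈ , b , p , refl)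
            (λ { κ (_ , c , q , refl) → cong (λ x → (g ∙ τ) ⁻¹ ∙ (a ∙ x)) (partner-unique q p) }))
          (λ κ κ∈ → ≤-antisym (cols≤ κ) (cols≥ κ κ∈)))
          where
          cols≤ : ∀ κ → # (λ a → W? a ×-dec offset? a κ) ≤ t
          cols≤ κ = ≤-trans (injection-≤ {Q = λ (_ : Fin t) → ⊤} (λ a → W? a ×-dec offset? a κ) (λ _ → yes tt)
            (λ a (_ , b , (i , _ , 0≢i , _) , _) → punchOut 0≢i) (λ _ _ → tt)
            (λ { {a} {a′} (_ , b , p@(i , j , 0≢i , 0≢j , i≢j , a∈ , b∈ , _) , e) (_ , b′ , p′@(i′ , j′ , 0≢i′ , 0≢j′ , i′≢j′ , a′∈ , b′∈ , _) , e′) q →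
              same (punchOut-injective 0≢i 0≢i′ q) i≢j i′≢j′ a∈ a′∈ b∈ b′∈ p′ (trans (offset-product e) (sym (offset-product e′))) }))
            (#-≤n {t} {λ _ → ⊤} (λ _ → yes tt))
            where
            open import Data.Fin.Properties using (punchOut-injective)
            same : ∀ {i i′ j j′ a a′ b b′} → i ≡ i′ → i ≢ j → i′ ≢ j′ → F i a → F i′ a′ → F j b → F j′ b′ → Partner a′ b′ → a ∙ b ≡ a′ ∙ b′ → a ≡ a′
            same {i} {j = j} {j′} {a} {a′} {b} {b′} refl i≢j i≢j′ a∈ a′∈ b∈ b′∈ p′ e = case j ≟F j′ of λ
              { (yes refl) → proj₁ (F-unique i≢j a∈ a′∈ b∈ b′∈ (∼-reflexive e))
              ; (no j≢j′) → ⊥-elim (left≢ε (partner-sym p′) (K1 i≢j i≢j′ j≢j′ (⁻¹∙∈ (F-sub _) a′∈ a∈) b∈ b′∈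
                  (trans (assoc _ _ _) (trans (cong (a′ ⁻¹ ∙_) e) (solve 2 (λ a b → a ⊖ ⊗ (a ⊗ b) ⊜ b) refl a′ b′))))) }
          cols≥ : ∀ κ → K κ → t ≤ # (λ a → W? a ×-dec offset? a κ)
          cols≥ κ κ∈ = ≤-trans (≤-reflexive (sym (#-full {t} (λ _ → yes tt) (λ _ → tt))))
            (injection-≤ {P = λ (_ : Fin t) → ⊤} (λ _ → yes tt) (λ a → W? a ×-dec offset? a κ) (λ i _ → proj₁ (pair i))
              (λ i _ → let a , a∈ , b , p , e = pair i in (b , p) , b , p , e)
              (λ {i} {i′} _ _ e → let a , a∈ , b , p , _ = pair i; a′ , a′∈ , _ = pair i′ in case i ≟F i′ of λ
                { (yes i≡i′) → i≡i′
                ; (no i≢i′) → ⊥-elim (left≢ε p (K2 (λ { refl → i≢i′ refl }) a∈ a′∈ (∼-reflexive e))) }))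
            where
            x∼g : g ∙ τ ∙ κ ∼ g
            x∼g = ∼-trans (∼-∙ˡ _ (∼ε (K⊆S κ κ∈))) (∼-trans (∼-reflexive (identityʳ _)) gτ∼g)
            pair : ∀ i → ∃ λ a → F (suc i) a × ∃ λ b → Partner a b × (g ∙ τ) ⁻¹ ∙ (a ∙ b) ≡ κ
            pair i with cover (suc i) (g ∙ τ ∙ κ)
            ... | inj₁ (a , a∈ , a∼x) = ⊥-elim (≁g (λ ()) a∈ (∼-trans a∼x x∼g))
            ... | inj₂ (j , a , b , j≢ , a∈ , b∈ , e) = a , a∈ , b , (suc i , j , (λ ()) , 0≢j , (j≢ ∘ sym) , a∈ , b∈ , subst K (sym offset) κ∈) , offset
              where
              offset : (g ∙ τ) ⁻¹ ∙ (a ∙ b) ≡ κ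
              offset = trans (cong ((g ∙ τ) ⁻¹ ∙_) (sym e)) (solve 2 (λ x y → x ⊖ ⊗ (x ⊗ y) ⊜ y) refl (g ∙ τ) κ)
              -- If `j` were `zero`, then `a` would lie in `F zero` modulo `S` and be trivial. So
              -- `g ∙ τ ∙ κ` would be in `F zero`, equal to `g`, and `τ` would be the inverse of
              -- `κ`.
              0≢j : zero ≢ j
              0≢j refl = τ∉K (subst K τ≡ (⁻¹∈ K-sub κ∈))
                where
                a≡ε : a ≡ ε
                a≡ε = K2 (λ ()) a∈ (∙⁻¹∈ (F-sub zero) g∈ b∈) (∼-trans (∼-reflexive (solve 2 (λ a b → a ⊜ a ⊗ b ⊗ b ⊖) refl a b))
                  (∼-∙ʳ (b ⁻¹) (∼-trans (∼-reflexive (sym e)) x∼g)))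
                x≡b : g ∙ τ ∙ κ ≡ b
                x≡b = trans e (trans (cong (_∙ b) a≡ε) (identityˡ b))
                b≡g : b ≡ g
                b≡g = F-S-≡ b∈ g∈ (subst (_∼ g) x≡b x∼g)
                τ≡ : κ ⁻¹ ≡ τ
                τ≡ = sym (trans (solve 3 (λ g τ κ → τ ⊜ g ⊖ ⊗ (g ⊗ τ ⊗ κ) ⊗ κ ⊖) refl g τ κ)
                  (trans (cong (λ x → g ⁻¹ ∙ x ∙ κ ⁻¹) (trans x≡b b≡g)) (solve 2 (λ g κ → g ⊖ ⊗ g ⊗ κ ⊖ ⊜ κ ⊖) refl g κ)))

    2∣t : 2 ∣ t
    2∣t = let g , g∈ , g≢ε = F-nontrivial zero in
      case euclidsLemma (# K?) t prime[2] (subst (2 ∣_) (#W≡#K*t g∈ g≢ε) (2∣#W g∈ g≢ε)) of λ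
        { (inj₁ d) → ∣-trans d (subst (# K? ∣_) #S (subgroup-∣ K? S? K-sub S-sub K⊆S))
        ; (inj₂ d) → d }

-- Supplements of the group of symmetries in a family of prime power exponent

module Frattini {N t : ℕ} {Γ : FinGroup N} (𝓕 : Family Γ t)
  (comm : ∀ g h → Family._∼_ 𝓕 (FinGroup._∙_ Γ g h) (FinGroup._∙_ Γ h g))
  {r : ℕ} (r-prime : Prime r) (k : ℕ)
  (F-exponent : ∀ i {a} → Family.F 𝓕 i a → FinGroup.pow Γ (r ^ k) a ≡ FinGroup.ε Γ)
  (odd-or-≢ : ∀ i → # (Family.F? 𝓕 i) ≢ t ⊎ ¬ 2 ∣ # (Family.F? 𝓕 i)) where

  open FinGroup Γ
  open Family 𝓕
  open FamilyProperties 𝓕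
  open Supplements 𝓕
  open PrimePowerFamily 𝓕 comm r-prime k F-exponent
  open IsSubgroupOf

  -- Otherwise `M ∩ S` is a proper subgroup of `S` containing all commutators, so `F (suc o)` has
  -- order `t` and `t` is even, against `odd-or-≢`.
  noncommutative : ∀ {M} (M? : Decidable M) → IsSubgroupOf M → (∀ g h → M (g ∙ h ∙ g ⁻¹ ∙ h ⁻¹)) → ∀ {σ} → S σ → ¬ ¬ M σ
  noncommutative {M} M? M-sub comm∈M {σ} σ∈ σ∉ = contra 2≤t odd-or-≢ #F≡t′
    where
    open CommutatorSubgroup 𝓕
    K? : Decidable (λ g → M g × S g)
    K? g = M? g ×-dec S? g
    comm∈K : ∀ g h → M ((h ∙ g) ⁻¹ ∙ (g ∙ h)) × S ((h ∙ g) ⁻¹ ∙ (g ∙ h))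
    comm∈K g h = subst M (solve 2 (λ g h → g ⊖ ⊗ h ⊖ ⊗ g ⊖ ⊖ ⊗ h ⊖ ⊖ ⊜ (h ⊗ g) ⊖ ⊗ (g ⊗ h)) refl g h) (comm∈M (g ⁻¹) (h ⁻¹)) , comm h g
    #F≡t′ : ∀ o → # (F? (suc o)) ≡ t
    #F≡t′ = #F≡t K? (∩-subgroup M-sub S-sub) (λ _ → proj₂) comm∈K σ∈ (σ∉ ∘ proj₁)
    even : 2 ∣ t
    even = 2∣t K? (∩-subgroup M-sub S-sub) (λ _ → proj₂) comm∈K σ∈ (σ∉ ∘ proj₁)
    contra : 2 ≤ t → (∀ i → # (F? i) ≢ t ⊎ ¬ 2 ∣ # (F? i)) → (∀ o → # (F? (suc o)) ≡ t) → ⊥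
    contra 2≤t h e with ∃-other 2≤t zero
    ... | zero , 0≢ = 0≢ refl
    ... | suc o , _ with h (suc o)
    ... | inj₁ ne = ne (e o)
    ... | inj₂ odd = odd (subst (2 ∣_) (sym (e o)) even)

  module Core {M : Fin N → Set} (M? : Decidable M) (M-sub : IsSubgroupOf M) (suppl : Supplement M) {τ : Fin N} (τ∉ : ¬ M τ) where

    K : Fin N → Set
    K κ = S κ × (∀ g → M (g ∙ κ ∙ g ⁻¹))

    K? : Decidable K
    K? κ = S? κ ×-dec all? λ g → M? _

    K⊆M : ∀ {κ} → K κ → M κ
    K⊆M {κ} (_ , h) = subst M (solve 1 (λ κ → ∙ε ⊗ κ ⊗ ∙ε ⊖ ⊜ κ) refl κ) (h ε)

    K-sub : IsSubgroupOf K
    K-sub = record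
      { ε∈ = ε∈ S-sub , λ g → subst M (solve 1 (λ g → ∙ε ⊜ g ⊗ ∙ε ⊗ g ⊖) refl g) (ε∈ M-sub)
      ; ∙∈ = λ {a} {b} (s , p) (s′ , q) → ∙∈ S-sub s s′ , λ g →
          subst M (solve 3 (λ g a b → g ⊗ a ⊗ g ⊖ ⊗ (g ⊗ b ⊗ g ⊖) ⊜ g ⊗ (a ⊗ b) ⊗ g ⊖) refl g a b) (∙∈ M-sub (p g) (q g))
      ; ⁻¹∈ = λ {a} (s , p) → ⁻¹∈ S-sub s , λ g →
          subst M (solve 2 (λ g a → (g ⊗ a ⊗ g ⊖) ⊖ ⊜ g ⊗ a ⊖ ⊗ g ⊖) refl g a) (⁻¹∈ M-sub (p g)) }

    K-normal : ∀ g {κ} → K κ → K (g ∙ κ ∙ g ⁻¹)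
    K-normal g {κ} (s , p) = S-normal g s , λ h → subst M (solve 3 (λ h g κ → (h ⊗ g) ⊗ κ ⊗ (h ⊗ g) ⊖ ⊜ h ⊗ (g ⊗ κ ⊗ g ⊖) ⊗ h ⊖) refl h g κ) (p (h ∙ g))

    module K = Quotient K-sub K-normal
    open K using () renaming (_∼_ to _≈_)

    1≤#K : 1 ≤ # K?
    1≤#K = #-pos K? (ε∈ K-sub)

    -- `t` is the index of `M` times the order of `M ∩ S`; `r` divides the first factor and `# K?`
    -- the second.
    r*#K∣t : r * # K? ∣ t
    r*#K∣t = subst (r * # K? ∣_) (sym (index-M∩S M? M-sub suppl)) (*-pres-∣ (proper⇒r∣index M? M-sub τ∉)
      (subgroup-∣ K? (M∩S? M? M-sub suppl) K-sub (M∩S-sub M? M-sub suppl) (λ _ κ → K⊆M κ , proj₁ κ)))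

    conj-≈ : ∀ g {y z} → y ≈ z → g ∙ y ∙ g ⁻¹ ≈ g ∙ z ∙ g ⁻¹
    conj-≈ g e = K.∼-∙ʳ _ (K.∼-∙ˡ g e)

    Stab : Fin N → Fin N → Set
    Stab y g = g ∙ y ∙ g ⁻¹ ≈ y

    stab? : ∀ y → Decidable (Stab y)
    stab? y g = K? _

    Stab-sub : ∀ y → IsSubgroupOf (Stab y)
    Stab-sub y = record
      { ε∈ = K.∼-reflexive (solve 1 (λ y → ∙ε ⊗ y ⊗ ∙ε ⊖ ⊜ y) refl y)
      ; ∙∈ = λ {g} {h} p q → K.∼-trans (K.∼-reflexive (solve 3 (λ g h y → g ⊗ h ⊗ y ⊗ (g ⊗ h) ⊖ ⊜ g ⊗ (h ⊗ y ⊗ h ⊖) ⊗ g ⊖) refl g h y)) (K.∼-trans (conj-≈ g q) p)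
      ; ⁻¹∈ = λ {g} p → K.∼-trans (conj-≈ (g ⁻¹) (K.∼-sym p)) (K.∼-reflexive (solve 2 (λ g y → g ⊖ ⊗ (g ⊗ y ⊗ g ⊖) ⊗ g ⊖ ⊖ ⊜ y) refl g y)) }

    -- A conjugacy class of the quotient by `K`, taken as a union of cosets of `K`; this is why
    -- `class-size` has a factor `# K?`.
    Class : Fin N → Fin N → Set
    Class y z = ∃ λ g → g ∙ y ∙ g ⁻¹ ≈ z

    class? : ∀ y → Decidable (Class y)
    class? y z = any? λ g → K? _

    class-size : ∀ y → # (class? y) ≡ Cosets.index (stab? y) (Stab-sub y) * # K?
    class-size y = *-cancelʳ-≡ _ _ (# (stab? y)) {{>-nonZero (#-pos (stab? y) (ε∈ (Stab-sub y)))}} (begin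
      # (class? y) * # (stab? y)                        ≡⟨ sym (double-count {P = λ (_ : Fin N) → ⊤} (λ _ → yes tt) (class? y) (λ g z → K? ((g ∙ y ∙ g ⁻¹) ⁻¹ ∙ z)) rows cols) ⟩
      # {N} (λ _ → yes tt) * # K?                       ≡⟨ cong (_* # K?) (trans (#-full {N} (λ _ → yes tt) (λ _ → tt)) (Cosets.lagrange (stab? y) (Stab-sub y))) ⟩
      index * # (stab? y) * # K?                        ≡⟨ *-assoc index _ _ ⟩
      index * (# (stab? y) * # K?)                      ≡⟨ cong (index *_) (*-comm (# (stab? y)) _) ⟩
      index * (# K? * # (stab? y))                      ≡⟨ sym (*-assoc index _ _) ⟩
      index * # K? * # (stab? y) ∎)
      where
      open ≡-Reasoning
      index : ℕ
      index = Cosets.index (stab? y) (Stab-sub y)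
      rows : ∀ g → ⊤ → # (λ z → class? y z ×-dec K? ((g ∙ y ∙ g ⁻¹) ⁻¹ ∙ z)) ≡ # K?
      rows g _ = trans (#-cong (λ z → class? y z ×-dec K? ((g ∙ y ∙ g ⁻¹) ⁻¹ ∙ z)) (λ z → K? ((g ∙ y ∙ g ⁻¹) ⁻¹ ∙ z)) (λ _ → proj₂) (λ z e → (g , e) , e))
        (Cosets.coset-size K? K-sub (g ∙ y ∙ g ⁻¹))
      cols : ∀ z → Class y z → # (λ g → yes tt ×-dec K? ((g ∙ y ∙ g ⁻¹) ⁻¹ ∙ z)) ≡ # (stab? y)
      cols z (g₀ , e₀) = trans
        (#-cong (λ g → yes tt ×-dec K? ((g ∙ y ∙ g ⁻¹) ⁻¹ ∙ z)) (λ g → stab? y (g₀ ⁻¹ ∙ g))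
          (λ g (_ , e) → K.∼-trans (K.∼-reflexive (conj-∙ g))
            (K.∼-trans (conj-≈ (g₀ ⁻¹) (K.∼-trans e (K.∼-sym e₀))) (K.∼-reflexive (solve 2 (λ g y → g ⊖ ⊗ (g ⊗ y ⊗ g ⊖) ⊗ g ⊖ ⊖ ⊜ y) refl g₀ y))))
          (λ g p → tt , K.∼-trans (K.∼-reflexive (solve 3 (λ g₀ g y → g ⊗ y ⊗ g ⊖ ⊜ g₀ ⊗ (g₀ ⊖ ⊗ g ⊗ y ⊗ (g₀ ⊖ ⊗ g) ⊖) ⊗ g₀ ⊖) refl g₀ g y))
            (K.∼-trans (conj-≈ g₀ p) e₀)))
        (Cosets.coset-size (stab? y) (Stab-sub y) g₀)
        where
        conj-∙ : ∀ g → g₀ ⁻¹ ∙ g ∙ y ∙ (g₀ ⁻¹ ∙ g) ⁻¹ ≡ g₀ ⁻¹ ∙ (g ∙ y ∙ g ⁻¹) ∙ g₀ ⁻¹ ⁻¹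
        conj-∙ g = solve 3 (λ g₀ g y → g₀ ⊖ ⊗ g ⊗ y ⊗ (g₀ ⊖ ⊗ g) ⊖ ⊜ g₀ ⊖ ⊗ (g ⊗ y ⊗ g ⊖) ⊗ g₀ ⊖ ⊖) refl g₀ g y

    S∖K? : Decidable (λ y → S y × ¬ K y)
    S∖K? y = S? y ×-dec ¬? (K? y)

    Central : Fin N → Set
    Central z = ∀ g → Stab z g

    -- Without such an element, all classes in the part of `S` outside `K` belong to proper
    -- centralizers and have sizes divisible by `r * # K?`. That number also divides `t`, so it
    -- would divide `# K?`.
    ∃-central : ∃ λ z → (S z × ¬ K z) × Central z
    ∃-central with any? (λ z → S∖K? z ×-dec all? (stab? z))
    ... | yes p = p
    ... | no none = ⊥-elim (<⇒≱ (m<n*m′) (∣⇒≤ {{>-nonZero 1≤#K}} r*#K∣#K))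
      where
      m<n*m′ : # K? < r * # K?
      m<n*m′ = subst (_< r * # K?) (*-identityˡ (# K?)) (*-monoˡ-< (# K?) {{>-nonZero 1≤#K}} (nonTrivial⇒n>1 r {{prime⇒nonTrivial r-prime}}))
      r*#K∣#S∖K : r * # K? ∣ # S∖K?
      r*#K∣#S∖K = classes-∣ (r * # K?) S∖K? class?
        (λ {y} _ → ε , K.∼-reflexive (solve 1 (λ y → ∙ε ⊗ y ⊗ ∙ε ⊖ ⊜ y) refl y))
        (λ {y} {z} (s , k∉) (g , e) →
          subst S (solve 2 (λ x z → x ⊗ (x ⊖ ⊗ z) ⊜ z) refl (g ∙ y ∙ g ⁻¹) z) (∙∈ S-sub (S-normal g s) (proj₁ e)) ,
          λ z∈ → k∉ (subst K (solve 2 (λ g y → g ⊖ ⊗ (g ⊗ y ⊗ g ⊖) ⊗ g ⊜ y) refl g y)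
            (K.conj⁻¹ g (subst K (solve 2 (λ x z → z ⊗ (x ⊖ ⊗ z) ⊖ ⊜ x) refl (g ∙ y ∙ g ⁻¹) z) (∙⁻¹∈ K-sub z∈ e)))))
        (λ {y} _ (g , e) → g ⁻¹ , K.∼-trans (conj-≈ (g ⁻¹) (K.∼-sym e)) (K.∼-reflexive (solve 2 (λ g y → g ⊖ ⊗ (g ⊗ y ⊗ g ⊖) ⊗ g ⊖ ⊖ ⊜ y) refl g y)))
        (λ {y} _ (g , e) (h , e′) → h ∙ g , K.∼-trans (K.∼-reflexive (solve 3 (λ h g y → h ⊗ g ⊗ y ⊗ (h ⊗ g) ⊖ ⊜ h ⊗ (g ⊗ y ⊗ g ⊖) ⊗ h ⊖) refl h g y)) (K.∼-trans (conj-≈ h e) e′))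
        (λ y y∈ → subst (r * # K? ∣_) (sym (class-size y)) (*-monoˡ-∣ (# K?)
          (proper⇒r∣index (stab? y) (Stab-sub y) (proj₂ (¬∀⟶∃¬ N (Stab y) (stab? y) (λ h → none (y , y∈ , h)))))))
      r*#K∣#K : r * # K? ∣ # K?
      r*#K∣#K = ∣m+n∣m⇒∣n (subst (r * # K? ∣_) (trans (sym #S) (trans (#-split S? K?)
        (trans (+-comm _ (# S∖K?)) (cong (# S∖K? +_) (#-cong (λ y → S? y ×-dec K? y) K? (λ _ → proj₂) (λ _ κ → proj₁ κ , κ)))))) r*#K∣t) r*#K∣#S∖K

    z : Fin N
    z = proj₁ ∃-central

    z∉K : ¬ K z
    z∉K = proj₂ (proj₁ (proj₂ ∃-central))

    z-central : ∀ g → K (z ⁻¹ ∙ (g ∙ z ∙ g ⁻¹))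
    z-central g = K.∼-sym (proj₂ (proj₂ ∃-central) g)

    -- All conjugates of `z` lie in the coset of `z` modulo `K`. With `z` they would all lie in `M`,
    -- which is the condition for membership in `K`.
    z∉M : ¬ M z
    z∉M z∈ = z∉K (proj₁ (proj₁ (proj₂ ∃-central)) , λ g →
      subst M (solve 2 (λ z x → z ⊗ (z ⊖ ⊗ x) ⊜ x) refl z (g ∙ z ∙ g ⁻¹)) (∙∈ M-sub z∈ (K⊆M (z-central g))))

    z-commutator : ∀ g → M (z ∙ g ∙ z ⁻¹ ∙ g ⁻¹)
    z-commutator g = K⊆M (subst K (solve 2 (λ z g → z ⊗ (z ⊖ ⊗ (g ⊗ z ⊗ g ⊖)) ⊖ ⊗ z ⊖ ⊜ z ⊗ g ⊗ z ⊖ ⊗ g ⊖) refl z g)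
      (K-normal z (⁻¹∈ K-sub (z-central g))))

    z-commutator⁻¹ : ∀ g → M (z ⁻¹ ∙ g ∙ z ∙ g ⁻¹)
    z-commutator⁻¹ g = K⊆M (subst K (solve 2 (λ z g → z ⊖ ⊗ (g ⊗ z ⊗ g ⊖) ⊜ z ⊖ ⊗ g ⊗ z ⊗ g ⊖) refl z g) (z-central g))

    -- Both conjugations are demanded, so that closure under inverses is immediate.
    Normalizer : Fin N → Set
    Normalizer g = ∀ m → M m → M (g ∙ m ∙ g ⁻¹) × M (g ⁻¹ ∙ m ∙ g)

    normalizer? : Decidable Normalizer
    normalizer? g = all? λ m → M? m →-dec (M? _ ×-dec M? _)

    Normalizer-sub : IsSubgroupOf Normalizer
    Normalizer-sub = record
      { ε∈ = λ m p → subst M (solve 1 (λ m → m ⊜ ∙ε ⊗ m ⊗ ∙ε ⊖) refl m) p , subst M (solve 1 (λ m → m ⊜ ∙ε ⊖ ⊗ m ⊗ ∙ε) refl m) p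
      ; ∙∈ = λ {g} {h} p q m m∈ →
          subst M (solve 3 (λ g h m → g ⊗ (h ⊗ m ⊗ h ⊖) ⊗ g ⊖ ⊜ g ⊗ h ⊗ m ⊗ (g ⊗ h) ⊖) refl g h m) (proj₁ (p _ (proj₁ (q m m∈)))) ,
          subst M (solve 3 (λ g h m → h ⊖ ⊗ (g ⊖ ⊗ m ⊗ g) ⊗ h ⊜ (g ⊗ h) ⊖ ⊗ m ⊗ (g ⊗ h)) refl g h m) (proj₂ (q _ (proj₂ (p m m∈))))
      ; ⁻¹∈ = λ {g} p m m∈ → subst M (solve 2 (λ g m → g ⊖ ⊗ m ⊗ g ⊜ g ⊖ ⊗ m ⊗ g ⊖ ⊖) refl g m) (proj₂ (p m m∈)) ,
          subst M (solve 2 (λ g m → g ⊗ m ⊗ g ⊖ ⊜ g ⊖ ⊖ ⊗ m ⊗ g ⊖) refl g m) (proj₁ (p m m∈)) }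

    M⊆Normalizer : ∀ m → M m → Normalizer m
    M⊆Normalizer m m∈ n n∈ = ∙⁻¹∈ M-sub (∙∈ M-sub m∈ n∈) m∈ , ∙∈ M-sub (⁻¹∙∈ M-sub m∈ n∈) m∈

    z∈Normalizer : Normalizer z
    z∈Normalizer m m∈ = cancelʳ M-sub (⁻¹∈ M-sub m∈) (z-commutator m) , cancelʳ M-sub (⁻¹∈ M-sub m∈) (z-commutator⁻¹ m)

    module _ (M-normal : ∀ g m → M m → M (g ∙ m ∙ g ⁻¹)) where

      CentralMod : Fin N → Set
      CentralMod g = ∀ h → M (g ∙ h ∙ g ⁻¹ ∙ h ⁻¹)

      centralMod? : Decidable CentralMod
      centralMod? g = all? λ h → M? _

      CentralMod-sub : IsSubgroupOf CentralMod
      CentralMod-sub = record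
        { ε∈ = λ h → subst M (solve 1 (λ h → ∙ε ⊜ ∙ε ⊗ h ⊗ ∙ε ⊖ ⊗ h ⊖) refl h) (ε∈ M-sub)
        ; ∙∈ = λ {g} {g′} p q h → subst M (solve 3 (λ g x h → g ⊗ (x ⊗ h ⊗ x ⊖ ⊗ h ⊖) ⊗ g ⊖ ⊗ (g ⊗ h ⊗ g ⊖ ⊗ h ⊖) ⊜ g ⊗ x ⊗ h ⊗ (g ⊗ x) ⊖ ⊗ h ⊖) refl g g′ h)
            (∙∈ M-sub (M-normal g _ (q h)) (p h))
        ; ⁻¹∈ = λ {g} p h → subst M (solve 2 (λ g h → g ⊖ ⊗ (g ⊗ h ⊗ g ⊖ ⊗ h ⊖) ⊖ ⊗ g ⊖ ⊖ ⊜ g ⊖ ⊗ h ⊗ g ⊖ ⊖ ⊗ h ⊖) refl g h)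
            (M-normal (g ⁻¹) _ (⁻¹∈ M-sub (p h))) }

      M⊆CentralMod : ∀ m → M m → CentralMod m
      M⊆CentralMod m m∈ h = subst M (solve 2 (λ m h → m ⊗ (h ⊗ m ⊖ ⊗ h ⊖) ⊜ m ⊗ h ⊗ m ⊖ ⊗ h ⊖) refl m h) (∙∈ M-sub m∈ (M-normal h _ (⁻¹∈ M-sub m∈)))

  private
    supplement-⊇ : ∀ {M M′ : Fin N → Set} → (∀ m → M m → M′ m) → Supplement M → Supplement M′
    supplement-⊇ M⊆M′ suppl g with suppl g
    ... | m , m∈ , m∼g = m , M⊆M′ m m∈ , m∼g

    -- If M were proper, its normalizer and then the preimage of the center of Γ / M would be strictly larger,
    -- hence everything, so that Γ / M would be commutative.
    full : ∀ n {M} (M? : Decidable M) → IsSubgroupOf M → Supplement M → N ≤ n + # M? → ∀ g → M g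
    full n {M} M? M-sub suppl le g with all? M?
    ... | yes h = h g
    full zero {M} M? M-sub suppl le g | no ¬all with ¬∀⟶∃¬ N M M? ¬all
    ... | τ , τ∉ = ⊥-elim (<⇒≱ (<-≤-trans (#-⊂ {Q = λ _ → ⊤} M? (λ _ → yes tt) (λ _ _ → tt) {τ} tt τ∉) (#-≤n {N} {λ _ → ⊤} (λ _ → yes tt))) le)
    full (suc n) {M} M? M-sub suppl le _ | no ¬all with ¬∀⟶∃¬ N M M? ¬all
    ... | τ , τ∉ with all? (λ σ → S? σ →-dec M? σ)
    ... | yes S⊆M = ⊥-elim (τ∉ (S⊆M⇒full M? M-sub suppl S⊆M τ))
    ... | no ¬S⊆M with ¬∀⟶∃¬ N (λ σ → S σ → M σ) (λ σ → S? σ →-dec M? σ) ¬S⊆M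
    ... | σ , ¬h = ⊥-elim (¬h λ σ∈ → ⊥-elim (noncommutative M? M-sub commutators∈M σ∈ (λ σ∈M → ¬h λ _ → σ∈M)))
      where
      open Core M? M-sub suppl τ∉
      larger : ∀ {M′} (M′? : Decidable M′) → (∀ m → M m → M′ m) → M′ z → N ≤ n + # M′?
      larger M′? M⊆M′ z∈ = ≤-trans le (≤-trans (≤-reflexive (sym (+-suc n (# M?)))) (+-monoʳ-≤ n (#-⊂ M? M′? M⊆M′ z∈ z∉M)))
      M-normal : ∀ g m → M m → M (g ∙ m ∙ g ⁻¹)
      M-normal g m m∈ = proj₁ (full n normalizer? Normalizer-sub (supplement-⊇ M⊆Normalizer suppl) (larger normalizer? M⊆Normalizer z∈Normalizer) g m m∈)
      commutators∈M : ∀ g h → M (g ∙ h ∙ g ⁻¹ ∙ h ⁻¹)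
      commutators∈M = full n (centralMod? M-normal) (CentralMod-sub M-normal) (supplement-⊇ (M⊆CentralMod M-normal) suppl)
        (larger (centralMod? M-normal) (M⊆CentralMod M-normal) z-commutator)

  supplement-full : ∀ {M} (M? : Decidable M) → IsSubgroupOf M → Supplement M → ∀ g → M g
  supplement-full M? M-sub suppl = full N M? M-sub suppl (m≤m+n N _)

-- Restricting a family to a subgroup

record Enumeration {n : ℕ} (P : Fin n → Set) (size : ℕ) : Set where
  field
    enum : Fin size → Fin n
    enum-∈ : ∀ i → P (enum i)
    enum-inj : ∀ {i j} → enum i ≡ enum j → i ≡ j
    enum-onto : ∀ {x} → P x → ∃ λ i → enum i ≡ x

enumerate : ∀ {n} {P : Fin n → Set} (P? : Decidable P) → Enumeration P (# P?)
enumerate {zero} P? = record { enum = λ () ; enum-∈ = λ () ; enum-inj = λ { {()} } ; enum-onto = λ { {()} } }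
enumerate {suc n} {P} P? with P? zero | enumerate (P? ∘ suc)
... | no ¬p | E = record
  { enum = suc ∘ enum
  ; enum-∈ = enum-∈
  ; enum-inj = λ e → enum-inj (suc-injective e)
  ; enum-onto = λ { {zero} p → ⊥-elim (¬p p) ; {suc x} p → let i , e = enum-onto p in i , cong suc e } }
  where open Enumeration E
... | yes p | E = record
  { enum = λ { zero → zero ; (suc i) → suc (enum i) }
  ; enum-∈ = λ { zero → p ; (suc i) → enum-∈ i }
  ; enum-inj = λ { {zero} {zero} _ → refl ; {suc i} {suc j} e → cong suc (enum-inj (suc-injective e)) }
  ; enum-onto = λ { {zero} _ → zero , refl ; {suc x} q → let i , e = enum-onto q in suc i , cong suc e } }
  where open Enumeration E

-- The ambient group is an arbitrary setoid group: it is a `FinGroup` for torsion subgroups, and the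
-- automorphism group with pointwise equality for the elation group.
record Model {c ℓ p} (𝔾 : Group c ℓ) (G : Group.Carrier 𝔾 → Set p) (n : ℕ) : Set (c ⊔ˡ ℓ ⊔ˡ p) where
  private module 𝔾 = Group 𝔾
  open 𝔾 using (_≈_)
  field
    Γ : FinGroup n
    φ : Fin n → 𝔾.Carrier
    φ-∈ : ∀ i → G (φ i)
    φ-inj : ∀ {i j} → φ i ≈ φ j → i ≡ j
    φ-onto : ∀ {g} → G g → ∃ λ i → φ i ≈ g
    φ-∙ : ∀ i j → φ (FinGroup._∙_ Γ i j) ≈ φ i 𝔾.∙ φ j
    φ-ε : φ (FinGroup.ε Γ) ≈ 𝔾.ε
    φ-⁻¹ : ∀ i → φ (FinGroup._⁻¹ Γ i) ≈ φ i 𝔾.⁻¹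

module _ {c ℓ p} (𝔾 : Group c ℓ) {G : Group.Carrier 𝔾 → Set p} {n : ℕ} where

  private module 𝔾 = Group 𝔾
  open 𝔾 using (_≈_)

  model : (φ : Fin n → 𝔾.Carrier) → (∀ i → G (φ i)) → (∀ {i j} → φ i ≈ φ j → i ≡ j) → (∀ {g} → G g → ∃ λ i → φ i ≈ g) →
    (∀ {g h} → G g → G h → G (g 𝔾.∙ h)) → G 𝔾.ε → (∀ {g} → G g → G (g 𝔾.⁻¹)) → Model 𝔾 G n
  model φ φ-∈ φ-inj φ-onto ∙∈ ε∈ ⁻¹∈ = record
    { Γ = record { _∙_ = _∙_ ; ε = ε ; _⁻¹ = _⁻¹ ; isGroup = record
      { isMonoid = record
        { isSemigroup = record
          { isMagma = record { isEquivalence = isEquivalence ; ∙-cong = cong₂ _∙_ }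
          ; assoc = λ i j k → φ-inj (𝔾.trans (φ-∙ _ _) (𝔾.trans (𝔾.∙-congʳ (φ-∙ i j)) (𝔾.trans (𝔾.assoc _ _ _)
              (𝔾.sym (𝔾.trans (φ-∙ _ _) (𝔾.∙-congˡ (φ-∙ j k))))))) }
        ; identity = (λ i → φ-inj (𝔾.trans (φ-∙ _ _) (𝔾.trans (𝔾.∙-congʳ φ-ε) (𝔾.identityˡ _)))) ,
                     (λ i → φ-inj (𝔾.trans (φ-∙ _ _) (𝔾.trans (𝔾.∙-congˡ φ-ε) (𝔾.identityʳ _)))) }
      ; inverse = (λ i → φ-inj (𝔾.trans (φ-∙ _ _) (𝔾.trans (𝔾.∙-congʳ (φ-⁻¹ i)) (𝔾.trans (𝔾.inverseˡ _) (𝔾.sym φ-ε))))) ,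
                  (λ i → φ-inj (𝔾.trans (φ-∙ _ _) (𝔾.trans (𝔾.∙-congˡ (φ-⁻¹ i)) (𝔾.trans (𝔾.inverseʳ _) (𝔾.sym φ-ε)))))
      ; ⁻¹-cong = cong _⁻¹ } }
    ; φ = φ ; φ-∈ = φ-∈ ; φ-inj = φ-inj ; φ-onto = φ-onto ; φ-∙ = φ-∙ ; φ-ε = φ-ε ; φ-⁻¹ = φ-⁻¹ }
    where
    infixl 7 _∙_
    _∙_ : Fin n → Fin n → Fin n
    i ∙ j = proj₁ (φ-onto (∙∈ (φ-∈ i) (φ-∈ j)))

    ε : Fin n
    ε = proj₁ (φ-onto ε∈)

    _⁻¹ : Fin n → Fin n
    i ⁻¹ = proj₁ (φ-onto (⁻¹∈ (φ-∈ i)))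

    φ-∙ : ∀ i j → φ (i ∙ j) ≈ φ i 𝔾.∙ φ j
    φ-∙ i j = proj₂ (φ-onto (∙∈ (φ-∈ i) (φ-∈ j)))

    φ-ε : φ ε ≈ 𝔾.ε
    φ-ε = proj₂ (φ-onto ε∈)

    φ-⁻¹ : ∀ i → φ (i ⁻¹) ≈ φ i 𝔾.⁻¹
    φ-⁻¹ i = proj₂ (φ-onto (⁻¹∈ (φ-∈ i)))

module Restriction {N t : ℕ} {Γ : FinGroup N} (𝓕 : Family Γ t) where
  open FinGroup Γ
  open Family 𝓕
  open FamilyProperties 𝓕 using (∼-reflexive)
  open IsSubgroupOf

  -- `S⊆G` preserves the parameter `t`, and `G-factor` keeps the factors in `decompose` and `cover`
  -- inside `G`.
  module Restrict {G : Fin N → Set} (G? : Decidable G) (G-sub : IsSubgroupOf G) (S⊆G : ∀ {σ} → S σ → G σ)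
    (G-factor : ∀ {i j a b g} → i ≢ j → F i a → F j b → a ∙ b ∼ g → G g → G a × G b)
    (G-nontrivial : ∀ i → ∃ λ a → F i a × G a × a ≢ ε)
    {n : ℕ} (𝓜 : Model group G n) where

    open Model 𝓜 renaming (Γ to Γ′)
    private module Γ′ = FinGroup Γ′
    open Γ′ using () renaming (_∙_ to _∙′_; _⁻¹ to _⁻¹′)

    preimage-sub : ∀ {M : Fin N → Set} → IsSubgroupOf M → Γ′.IsSubgroupOf (M ∘ φ)
    preimage-sub {M} M-sub = record
      { ε∈ = subst M (sym φ-ε) (ε∈ M-sub)
      ; ∙∈ = λ {i} {j} p q → subst M (sym (φ-∙ i j)) (∙∈ M-sub p q)
      ; ⁻¹∈ = λ {i} p → subst M (sym (φ-⁻¹ i)) (⁻¹∈ M-sub p) }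

    #-preimage : ∀ {P : Fin N → Set} (P? : Decidable P) → # (P? ∘ φ) ≡ # (λ g → P? g ×-dec G? g)
    #-preimage {P} P? = ≤-antisym
      (injection-≤ (P? ∘ φ) (λ g → P? g ×-dec G? g) (λ i _ → φ i) (λ i p → p , φ-∈ i) (λ _ _ → φ-inj))
      (injection-≤ (λ g → P? g ×-dec G? g) (P? ∘ φ) (λ g p → proj₁ (φ-onto (proj₂ p))) (λ g p → subst P (sym (proj₂ (φ-onto (proj₂ p)))) (proj₁ p))
        (λ p q e → trans (sym (proj₂ (φ-onto (proj₂ p)))) (trans (cong φ e) (proj₂ (φ-onto (proj₂ q))))))

    φ-∼ : ∀ {i j} → S (φ (i ⁻¹′ ∙′ j)) → φ i ∼ φ j
    φ-∼ {i} {j} = subst S (trans (φ-∙ _ _) (cong (_∙ φ j) (φ-⁻¹ i)))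

    φ-∼⁻ : ∀ {i j} → φ i ∼ φ j → S (φ (i ⁻¹′ ∙′ j))
    φ-∼⁻ {i} {j} = subst S (sym (trans (φ-∙ _ _) (cong (_∙ φ j) (φ-⁻¹ i))))

    φ-pow : ∀ n i → φ (Γ′.pow n i) ≡ pow n (φ i)
    φ-pow zero i = φ-ε
    φ-pow (suc n) i = trans (φ-∙ _ _) (cong (φ i ∙_) (φ-pow n i))

    private
      lift : ∀ (P : Fin N → Set) {a} → G a → P a → ∃ λ i → φ i ≡ a × P (φ i)
      lift P g p = let i , e = φ-onto g in i , e , subst P (sym e) p

    restrict : Family Γ′ t
    restrict = record
      { 2≤t = 2≤t
      ; S = S ∘ φ ; S? = S? ∘ φ ; S-sub = preimage-sub S-sub
      ; S-normal = λ g {σ} s → subst S (sym (trans (φ-∙ _ _) (cong₂ _∙_ (φ-∙ g σ) (φ-⁻¹ g)))) (S-normal (φ g) s)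
      ; #S = trans (#-preimage S?) (trans (#-cong (λ g → S? g ×-dec G? g) S? (λ _ → proj₁) (λ _ s → s , S⊆G s)) #S)
      ; F = λ i → F i ∘ φ ; F? = λ i → F? i ∘ φ ; F-sub = λ i → preimage-sub (F-sub i)
      ; F-nontrivial = λ i → let a , a∈F , a∈G , a≢ε = G-nontrivial i; x , e , x∈ = lift (F i) a∈G a∈F in
          x , x∈ , λ x≡ε → a≢ε (trans (sym e) (trans (cong φ x≡ε) φ-ε))
      ; K1 = λ i≢j i≢k j≢k a∈ b∈ c∈ e → φ-inj (trans (K1 i≢j i≢k j≢k a∈ b∈ c∈ (trans (sym (φ-∙ _ _)) (cong φ e))) (sym φ-ε))
      ; K2 = λ i≢j a∈ b∈ e → φ-inj (trans (K2 i≢j a∈ b∈ (φ-∼ e)) (sym φ-ε))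
      ; decompose = decompose′
      ; cover = cover′ }
      where
      decompose′ : ∀ {i j} → i ≢ j → ∀ g → ∃ λ a → ∃ λ b → F i (φ a) × F j (φ b) × S (φ ((a ∙′ b) ⁻¹′ ∙′ g))
      decompose′ {i} {j} i≢j g with decompose i≢j (φ g)
      ... | a , b , a∈ , b∈ , e with G-factor i≢j a∈ b∈ e (φ-∈ g)
      ... | a∈G , b∈G with lift (F i) a∈G a∈ | lift (F j) b∈G b∈
      ... | x , refl , x∈ | y , refl , y∈ = x , y , x∈ , y∈ , φ-∼⁻ (subst (_∼ φ g) (sym (φ-∙ x y)) e)
      cover′ : ∀ i g → (∃ λ a → F i (φ a) × S (φ (a ⁻¹′ ∙′ g))) ⊎ (∃ λ j → ∃ λ a → ∃ λ b → j ≢ i × F i (φ a) × F j (φ b) × g ≡ a ∙′ b)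
      cover′ i g with cover i (φ g)
      ... | inj₁ (a , a∈ , a∼g) with lift (F i) (subst G (solve 2 (λ a g → g ⊗ (a ⊖ ⊗ g) ⊖ ⊜ a) refl a (φ g)) (∙⁻¹∈ G-sub (φ-∈ g) (S⊆G a∼g))) a∈
      ...   | x , refl , x∈ = inj₁ (x , x∈ , φ-∼⁻ a∼g)
      cover′ i g | inj₂ (j , a , b , j≢i , a∈ , b∈ , e) with G-factor (j≢i ∘ sym) a∈ b∈ (∼-reflexive (sym e)) (φ-∈ g)
      ... | a∈G , b∈G with lift (F i) a∈G a∈ | lift (F j) b∈G b∈
      ... | x , refl , x∈ | y , refl , y∈ = inj₂ (j , x , y , j≢i , x∈ , y∈ , φ-inj (trans e (sym (φ-∙ x y))))

-- Reduction to families of prime power exponent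

module Reduction {N t : ℕ} {Γ : FinGroup N} (𝓕 : Family Γ t)
  (comm : ∀ g h → Family._∼_ 𝓕 (FinGroup._∙_ Γ g h) (FinGroup._∙_ Γ h g)) where
  open FinGroup Γ
  open Family 𝓕
  open FamilyProperties 𝓕
  open Supplements 𝓕
  open CommutativeQuotient comm
  open IsSubgroupOf

  module Torsion (e : ℕ) {i₀ : Fin (suc t)} {a₀ : Fin N} (a₀∈ : F i₀ a₀) (a₀≢ε : a₀ ≢ ε) (a₀^e : pow e a₀ ≡ ε) where

    G : Fin N → Set
    G g = S (pow e g)

    G? : Decidable G
    G? g = S? (pow e g)

    S⊆G : ∀ {σ} → S σ → G σ
    S⊆G = pow-∈ S-sub e

    G-sub : IsSubgroupOf G
    G-sub = record
      { ε∈ = S⊆G (ε∈ S-sub)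
      ; ∙∈ = λ {g} {h} p q → S-from-∼ε (∼-trans (pow-∙ e g h) (∼ε (∙∈ S-sub p q)))
      ; ⁻¹∈ = λ {g} p → S-from-∼ε (begin
          pow e (g ⁻¹)                           ≡⟨ solve 2 (λ x y → y ⊜ x ⊖ ⊗ (x ⊗ y)) refl (pow e g) (pow e (g ⁻¹)) ⟩
          pow e g ⁻¹ ∙ (pow e g ∙ pow e (g ⁻¹))   ≈⟨ ∼-∙ (∼ε (⁻¹∈ S-sub p)) (∼-sym (pow-∙ e g (g ⁻¹))) ⟩
          ε ∙ pow e (g ∙ g ⁻¹)                   ≡⟨ trans (identityˡ _) (trans (cong (pow e) (inverseʳ g)) (pow-ε e)) ⟩
          ε ∎) }
      where open ∼-Reasoning

    -- The powers of `a` and `b` have product in `S`. So `pow e a`, an element of `F i`, agrees with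
    -- one of `F j` modulo `S`, and `K2` applies.
    G-factor : ∀ {i j a b g} → i ≢ j → F i a → F j b → a ∙ b ∼ g → G g → G a × G b
    G-factor {i} {j} {a} {b} {g} i≢j a∈ b∈ ab∼g g∈ = subst S (sym pow-a≡ε) (ε∈ S-sub) ,
      S-from-∼ε (∼-trans (∼-reflexive (trans (sym (identityˡ _)) (cong (_∙ pow e b) (sym pow-a≡ε)))) powers∼ε)
      where
      open ∼-Reasoning
      powers∼ε : pow e a ∙ pow e b ∼ ε
      powers∼ε = ∼-trans (∼-sym (pow-∙ e a b)) (∼-trans (pow-∼ e ab∼g) (∼ε g∈))
      pow-a≡ε : pow e a ≡ ε
      pow-a≡ε = K2 i≢j (pow-∈ (F-sub i) e a∈) (⁻¹∈ (F-sub j) (pow-∈ (F-sub j) e b∈)) (begin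
        pow e a                               ≡⟨ solve 2 (λ x y → x ⊜ (x ⊗ y) ⊗ y ⊖) refl (pow e a) (pow e b) ⟩
        (pow e a ∙ pow e b) ∙ pow e b ⁻¹      ≈⟨ ∼-∙ʳ _ powers∼ε ⟩
        ε ∙ pow e b ⁻¹                        ≡⟨ identityˡ _ ⟩
        pow e b ⁻¹ ∎)

    a₀∈G : G a₀
    a₀∈G = subst S (sym a₀^e) (ε∈ S-sub)

    -- The seed `a₀` is factored modulo `S` along `F i` and a third member. Its component in `F i`
    -- is again torsion, and if it were trivial, `a₀` would agree modulo `S` with an element of the
    -- third member.
    G-nontrivial : ∀ i → ∃ λ a → F i a × G a × a ≢ ε
    G-nontrivial i = case i₀ ≟F i of λ
      { (yes refl) → a₀ , a₀∈ , a₀∈G , a₀≢ε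
      ; (no i₀≢i) →
          let k , i₀≢k , i≢k = ∃-third 2≤t i₀ i
              b , c , b∈ , c∈ , bc∼a₀ = decompose i≢k a₀
          in b , b∈ , proj₁ (G-factor i≢k b∈ c∈ bc∼a₀ a₀∈G) , λ b≡ε →
               a₀≢ε (K2 i₀≢k a₀∈ c∈ (∼-sym (∼-trans (∼-reflexive (sym (trans (cong (_∙ c) b≡ε) (identityˡ c)))) bc∼a₀))) }

    F∩G-exponent : ∀ {i a} → F i a → G a → pow e a ≡ ε
    F∩G-exponent {i} a∈ g = ∼ε⇒≡ε (pow-∈ (F-sub i) e a∈) (∼ε g)

    model-G : Model group G (# G?)
    model-G = model group enum enum-∈ enum-inj enum-onto (∙∈ G-sub) (ε∈ G-sub) (⁻¹∈ G-sub)
      where open Enumeration (enumerate G?)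

    module _ {r k : ℕ} (r-prime : Prime r) (e≡ : e ≡ r ^ k)
      (odd-or-≢ : ∀ i → # (λ a → F? i a ×-dec G? a) ≢ t ⊎ ¬ 2 ∣ # (λ a → F? i a ×-dec G? a)) where

      -- As `S` lies in `G`, the modular law makes `M ∩ G` a supplement of `S` in `G`. Hence it is
      -- all of `G` and contains `S`.
      S⊆supplement-via : ∀ {n} → Model group G n → ∀ {M} (M? : Decidable M) → IsSubgroupOf M → Supplement M → ∀ σ → S σ → M σ
      S⊆supplement-via 𝓜 {M} M? M-sub suppl σ σ∈ = let i , e = φ-onto (S⊆G σ∈) in
        subst M e (Frattini.supplement-full restrict comm′ r-prime k exponent′ odd-or-≢′ (M? ∘ φ) (preimage-sub M-sub) suppl′ i)
        where
        open Model 𝓜 renaming (Γ to Γ′)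
        open Restriction.Restrict 𝓕 G? G-sub S⊆G G-factor G-nontrivial 𝓜
        module Γ′ = FinGroup Γ′
        module 𝓕′ = Family restrict
        comm′ : ∀ g h → g Γ′.∙ h 𝓕′.∼ h Γ′.∙ g
        comm′ g h = φ-∼⁻ (subst₂ _∼_ (sym (φ-∙ g h)) (sym (φ-∙ h g)) (comm _ _))
        exponent′ : ∀ j {a} → 𝓕′.F j a → Γ′.pow (r ^ k) a ≡ Γ′.ε
        exponent′ j {a} a∈ = φ-inj (trans (φ-pow (r ^ k) a) (trans (cong (λ n → pow n (φ a)) (sym e≡)) (trans (F∩G-exponent a∈ (φ-∈ a)) (sym φ-ε))))
        odd-or-≢′ : ∀ j → # (𝓕′.F? j) ≢ t ⊎ ¬ 2 ∣ # (𝓕′.F? j)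
        odd-or-≢′ j = subst (λ n → n ≢ t ⊎ ¬ 2 ∣ n) (sym (#-preimage (F? j))) (odd-or-≢ j)
        suppl′ : Supplements.Supplement restrict (M ∘ φ)
        suppl′ g with suppl (φ g)
        ... | m , m∈ , m∼g with φ-onto (subst G (solve 2 (λ m g → g ⊗ (m ⊖ ⊗ g) ⊖ ⊜ m) refl m (φ g)) (∙⁻¹∈ G-sub (φ-∈ g) (S⊆G m∼g)))
        ... | x , refl = x , m∈ , φ-∼⁻ m∼g

      S⊆supplement : ∀ {M} (M? : Decidable M) → IsSubgroupOf M → Supplement M → ∀ σ → S σ → M σ
      S⊆supplement = S⊆supplement-via model-G

  -- Since 2 and `r` are coprime, inversion fixes no element other than `ε`; it pairs off the rest.
  odd-torsion⇒odd : ∀ {r} → Prime r → r ≢ 2 → ∀ {P} (P? : Decidable P) → IsSubgroupOf P → (∀ {a} → P a → pow r a ≡ ε) → ¬ 2 ∣ # P?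
  odd-torsion⇒odd {r} r-prime r≢2 {P} P? P-sub P^r 2∣#P = case ∣1⇒≡1 (∣m+n∣m⇒∣n (subst (2 ∣_) split 2∣#P) 2∣rest) of λ ()
    where
    2<r : 2 < r
    2<r = ≤∧≢⇒< (nonTrivial⇒n>1 r {{prime⇒nonTrivial r-prime}}) (r≢2 ∘ sym)
    no-involution : ∀ {a} → P a → a ⁻¹ ≡ a → a ≡ ε
    no-involution {a} a∈ e with coprime-Bézout (prime⇒coprime r-prime 2<r)
    ... | Bézout.+- x y eq = begin
        a                          ≡⟨ sym (identityʳ a) ⟩
        a ∙ ε                      ≡⟨ cong (a ∙_) (sym (trans (pow-* y 2 a) (trans (cong (pow y) a²) (pow-ε y)))) ⟩
        pow (1 + y * 2) a          ≡⟨ cong (λ n → pow n a) eq ⟩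
        pow (x * r) a              ≡⟨ trans (pow-* x r a) (trans (cong (pow x) (P^r a∈)) (pow-ε x)) ⟩
        ε ∎
      where
      open ≡-Reasoning
      a² : pow 2 a ≡ ε
      a² = trans (cong (a ∙_) (trans (identityʳ a) (sym e))) (inverseʳ a)
    ... | Bézout.-+ x y eq = begin
        a                          ≡⟨ sym (identityʳ a) ⟩
        a ∙ ε                      ≡⟨ cong (a ∙_) (sym (trans (pow-* x r a) (trans (cong (pow x) (P^r a∈)) (pow-ε x)))) ⟩
        pow (1 + x * r) a          ≡⟨ cong (λ n → pow n a) eq ⟩
        pow (y * 2) a              ≡⟨ trans (pow-* y 2 a) (trans (cong (pow y) a²) (pow-ε y)) ⟩
        ε ∎
      where
      open ≡-Reasoning
      a² : pow 2 a ≡ ε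
      a² = trans (cong (a ∙_) (trans (identityʳ a) (sym e))) (inverseʳ a)
    P∖ε? : Decidable (λ a → P a × a ≢ ε)
    P∖ε? a = P? a ×-dec ¬? (a ≟F ε)
    ⁻¹-involutive : ∀ a → a ⁻¹ ⁻¹ ≡ a
    ⁻¹-involutive a = solve 1 (λ a → a ⊖ ⊖ ⊜ a) refl a
    2∣rest : 2 ∣ # P∖ε?
    2∣rest = free-prime-order prime[2] P∖ε? _⁻¹
      (λ {a} (a∈ , a≢ε) → ⁻¹∈ P-sub a∈ , λ e → a≢ε (trans (sym (⁻¹-involutive a)) (trans (cong _⁻¹ e) (solve 0 (∙ε ⊖ ⊜ ∙ε) refl))))
      (λ {a} _ → ⁻¹-involutive a)
      (λ (a∈ , a≢ε) e → a≢ε (no-involution a∈ e))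
    split : # P? ≡ # P∖ε? + 1
    split = trans (#-split P? (_≟F ε)) (trans (+-comm _ (# P∖ε?)) (cong (# P∖ε? +_)
      (#-unique (λ a → P? a ×-dec (a ≟F ε)) ε (ε∈ P-sub , refl) (λ _ → proj₂))))

  OddTorsion : Fin N → Set
  OddTorsion a = ∃ λ r → Prime r × r ≢ 2 × ∃ λ n → pow n a ≢ ε × pow r (pow n a) ≡ ε

  -- The prime factors of an exponent of `a` are removed one by one. A factor 2 is absorbed by
  -- squaring `a`. An odd `p` is dropped if the remaining exponent `q` already annihilates `a`;
  -- otherwise `pow q a` has order `p`.
  torsion-split : ∀ ps → All Prime ps → ∀ a → pow (product ps) a ≡ ε → OddTorsion a ⊎ (∃ λ k → pow (2 ^ k) a ≡ ε)
  torsion-split [] [] a e = inj₂ (0 , e)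
  torsion-split (p ∷ ps) (p-prime ∷ primes) a e = case p ≟ 2 of λ
    { (yes refl) → case torsion-split ps primes (pow 2 a) (trans (sym (pow-* q 2 a)) (trans (cong (λ n → pow n a) (*-comm q 2)) e)) of λ
        { (inj₁ (r , r-prime , r≢2 , n , ≢ε , ≡ε)) → inj₁ (r , r-prime , r≢2 , n * 2 , ≢ε ∘ trans (sym (pow-* n 2 a)) , trans (cong (pow r) (pow-* n 2 a)) ≡ε)
        ; (inj₂ (k , h)) → inj₂ (suc k , trans (cong (λ n → pow n a) (*-comm 2 (2 ^ k))) (trans (pow-* (2 ^ k) 2 a) h)) }
    ; (no p≢2) → case pow q a ≟F ε of λ
        { (yes h) → torsion-split ps primes a h
        ; (no h) → inj₁ (p , p-prime , p≢2 , q , h , trans (sym (pow-* p q a)) e) } }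
    where
    open import Data.Nat using (_≟_)
    q : ℕ
    q = product ps

  finite-order : ∀ a → ∃ λ n → 0 < n × pow n a ≡ ε
  finite-order a with pigeonhole (n<1+n N) (λ (i : Fin (suc N)) → pow (toℕ i) a)
  ... | i , j , i<j , e = toℕ j ∸ toℕ i , m<n⇒0<n∸m i<j , ∙-cancelʳ {pow (toℕ i) a}
    (trans (sym (pow-+ (toℕ j ∸ toℕ i) (toℕ i) a)) (trans (cong (λ n → pow n a) (m∸n+n≡m (<⇒≤ i<j))) (trans (sym e) (sym (identityˡ _)))))

  torsion : ∀ a → OddTorsion a ⊎ (∃ λ k → pow (2 ^ k) a ≡ ε)
  torsion a with finite-order a
  ... | n , 0<n , e with factorise n {{>-nonZero 0<n}}
  ... | f = torsion-split (factors f) (factorsPrime f) a (trans (cong (λ n → pow n a) (sym (isFactorisation f))) e)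
    where open PrimeFactorisation

  all⊎any : ∀ {n} {A B : Fin n → Set} → (∀ i → A i ⊎ B i) → ∃ A ⊎ (∀ i → B i)
  all⊎any {zero} h = inj₂ λ ()
  all⊎any {suc n} h with h zero | all⊎any (h ∘ suc)
  ... | inj₁ a | _ = inj₁ (zero , a)
  ... | inj₂ _ | inj₁ (i , a) = inj₁ (suc i , a)
  ... | inj₂ b | inj₂ bs = inj₂ λ { zero → b ; (suc i) → bs i }

  module _ (odd-or-≢ : ∀ i → # (F? i) ≢ t ⊎ ¬ 2 ∣ # (F? i)) where

    -- Either some member has an element of odd prime order `r`, and the `r`-torsion has members of
    -- odd order, or every element of every member has 2-power order, and a common exponent leaves
    -- all members as they are.
    S⊆supplement : ∀ {M} (M? : Decidable M) → IsSubgroupOf M → Supplement M → ∀ σ → S σ → M σ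
    S⊆supplement M? M-sub suppl with all⊎any {N} {λ a → (∃ λ i → F i a) × OddTorsion a} {λ a → ∃ λ k → ∀ i → F i a → pow (2 ^ k) a ≡ ε} step
      where
      step : ∀ a → ((∃ λ i → F i a) × OddTorsion a) ⊎ (∃ λ k → ∀ i → F i a → pow (2 ^ k) a ≡ ε)
      step a with any? (λ i → F? i a) | torsion a
      ... | no none | _ = inj₂ (0 , λ i a∈ → ⊥-elim (none (i , a∈)))
      ... | yes a∈ | inj₁ o = inj₁ (a∈ , o)
      ... | yes _ | inj₂ (k , e) = inj₂ (k , λ _ _ → e)
    ... | inj₁ (a , (i , a∈) , r , r-prime , r≢2 , n , ≢ε , ≡ε) =
      T.S⊆supplement {k = 1} r-prime (sym (*-identityʳ r))
        (λ j → inj₂ (odd-torsion⇒odd r-prime r≢2 (λ a → F? j a ×-dec T.G? a) (∩-subgroup (F-sub j) T.G-sub) (λ (p , q) → T.F∩G-exponent p q)))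
        M? M-sub suppl
      where module T = Torsion r (pow-∈ (F-sub i) n a∈) ≢ε ≡ε
    ... | inj₂ h = T.S⊆supplement {k = k} prime[2] refl
        (λ j → subst (λ n → n ≢ t ⊎ ¬ 2 ∣ n) (#-cong (F? j) (λ a → F? j a ×-dec T.G? a) (λ a a∈ → a∈ , subst S (sym (exponent a∈)) (ε∈ S-sub)) (λ _ → proj₁)) (odd-or-≢ j))
        M? M-sub suppl
      where
      k : ℕ
      -- The sum dominates the `k` found for each single element.
      k = sum (λ a → proj₁ (h a))
      exponent : ∀ {i a} → F i a → pow (2 ^ k) a ≡ ε
      exponent {i} {a} a∈ = trans (cong (λ n → pow n a) (trans (cong (2 ^_) (sym (m∸n+n≡m (sum-≥ (λ a → proj₁ (h a)) a)))) (^-distribˡ-+-* 2 (k ∸ kₐ) kₐ)))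
        (trans (pow-* (2 ^ (k ∸ kₐ)) (2 ^ kₐ) a) (trans (cong (pow (2 ^ (k ∸ kₐ))) (proj₂ (h a) i a∈)) (pow-ε (2 ^ (k ∸ kₐ)))))
        where
        kₐ : ℕ
        kₐ = proj₁ (h a)
      seed = F-nontrivial zero
      module T = Torsion (2 ^ k) (proj₁ (proj₂ seed)) (proj₂ (proj₂ seed)) (exponent (proj₁ (proj₂ seed)))

open import Defs

-- The family of a skew translation generalized quadrangle

count≡# : ∀ {n} (f : Fin n → Bool) → count f ≡ # (λ i → f i ≟B true)
count≡# {zero} f = refl
count≡# {suc n} f with f zero
... | true = cong suc (count≡# (f ∘ suc))
... | false = count≡# (f ∘ suc)

AutGroup : Incidence → Group _ _
AutGroup 𝒮 = record
  { Carrier = Aut 𝒮 ; _≈_ = _≈_ 𝒮 ; _∙_ = _·_ 𝒮 ; ε = idAut 𝒮 ; _⁻¹ = inv 𝒮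
  ; isGroup = record
    { isMonoid = record
      { isSemigroup = record
        { isMagma = record
          { isEquivalence = record
            { refl = (λ _ → refl) , (λ _ → refl)
            ; sym = λ (p , l) → (sym ∘ p) , (sym ∘ l)
            ; trans = λ (p , l) (p′ , l′) → (λ y → trans (p y) (p′ y)) , (λ L → trans (l L) (l′ L)) }
          ; ∙-cong = λ {f} {f′} {g} {g′} (p , l) (p′ , l′) →
              (λ y → trans (cong (pt f) (p′ y)) (p (pt g′ y))) , (λ L → trans (cong (ln f) (l′ L)) (l (ln g′ L))) }
        ; assoc = λ _ _ _ → (λ _ → refl) , (λ _ → refl) }
      ; identity = (λ _ → (λ _ → refl) , (λ _ → refl)) , (λ _ → (λ _ → refl) , (λ _ → refl)) }
    ; inverse = (λ f → pt-inv₁ f , ln-inv₁ f) , (λ f → pt-inv₂ f , ln-inv₂ f)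
    ; ⁻¹-cong = λ {f} {g} (p , l) →
        (λ y → trans (sym (pt-inv₁ g (pt⁻ f y))) (cong (pt⁻ g) (trans (sym (p (pt⁻ f y))) (pt-inv₂ f y)))) ,
        (λ L → trans (sym (ln-inv₁ g (ln⁻ f L))) (cong (ln⁻ g) (trans (sym (l (ln⁻ f L))) (ln-inv₂ f L)))) } }

module Quadrangle (𝒮 : Incidence) {s t : ℕ} (thick : IsThickGQ 𝒮 s t) (x : Point 𝒮) where
  open Incidence 𝒮
  open IsThickGQ thick
  open IsGQ isGQ

  infix 4 _onᴸ_
  _onᴸ_ : Point 𝒮 → Line 𝒮 → Set
  _onᴸ_ = _on_ 𝒮

  on? : ∀ p L → Dec (p onᴸ L)
  on? p L = I p L ≟B true

  col : Point 𝒮 → Point 𝒮 → Set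
  col = Collinear 𝒮

  col? : ∀ p q → Dec (col p q)
  col? p q = any? λ L → on? p L ×-dec on? q L

  col-sym : ∀ {p q} → col p q → col q p
  col-sym (L , p∈ , q∈) = L , q∈ , p∈

  #points : ∀ L → # (λ p → on? p L) ≡ suc s
  #points L = trans (sym (count≡# (λ p → I p L))) (lineSize L)

  #lines : ∀ p → # (on? p) ≡ suc t
  #lines p = trans (sym (count≡# (I p))) (pointDeg p)

  private
    pencil : Enumeration (x onᴸ_) (suc t)
    pencil = subst (Enumeration (x onᴸ_)) (#lines x) (enumerate (on? x))
  open Enumeration pencil public using () renaming (enum to ℓ; enum-∈ to x∈ℓ; enum-inj to ℓ-inj; enum-onto to ℓ-onto)

  ∃-another-point : ∀ p L → ∃ λ q → q onᴸ L × q ≢ p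
  ∃-another-point p L with any? (λ q → on? q L ×-dec ¬? (q ≟F p))
  ... | yes h = h
  ... | no none = ⊥-elim (<⇒≱ (s≤s (≤-trans (s≤s z≤n) s≥2)) (≤-trans (≤-reflexive (sym (#points L)))
      (#-≤1 (λ q → on? q L) (λ q q′ q∈ q′∈ → trans (unique q∈) (sym (unique q′∈))))))
    where
    unique : ∀ {q} → q onᴸ L → q ≡ p
    unique {q} q∈ = decidable-stable (q ≟F p) (λ ne → none (q , q∈ , ne))

  ∃-another-line : ∀ p L → ∃ λ K → p onᴸ K × K ≢ L
  ∃-another-line p L with any? (λ K → on? p K ×-dec ¬? (K ≟F L))
  ... | yes h = h
  ... | no none = ⊥-elim (<⇒≱ (s≤s (≤-trans (s≤s z≤n) t≥2)) (≤-trans (≤-reflexive (sym (#lines p)))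
      (#-≤1 (on? p) (λ K K′ K∈ K′∈ → trans (unique K∈) (sym (unique K′∈))))))
    where
    unique : ∀ {K} → p onᴸ K → K ≡ L
    unique {K} K∈ = decidable-stable (K ≟F L) (λ ne → none (K , K∈ , ne))

  ∃-noncollinear : ∃ λ y → ¬ col x y
  ∃-noncollinear with ∃-another-point x (ℓ zero)
  ... | z , z∈ℓ , z≢x with ∃-another-line z (ℓ zero)
  ... | K , z∈K , K≢ℓ with ∃-another-point z K
  ... | y , y∈K , y≢z = y , λ x~y → y≢z (gqUnique x K y z x∉K y∈K x~y z∈K (ℓ zero , x∈ℓ zero , z∈ℓ))
    where
    x∉K : ¬ x onᴸ K
    x∉K x∈K = K≢ℓ (atMostOne x z K (ℓ zero) (z≢x ∘ sym) x∈K z∈K (x∈ℓ zero) z∈ℓ)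

  ℓ-meet : ∀ {i j w} → w ≢ x → w onᴸ ℓ i → w onᴸ ℓ j → i ≡ j
  ℓ-meet {i} {j} {w} w≢x p q = ℓ-inj (atMostOne w x (ℓ i) (ℓ j) w≢x p (x∈ℓ i) q (x∈ℓ j))

module Elations (𝒮 : Incidence) {s t : ℕ} (thick : IsThickGQ 𝒮 s t) (x : Point 𝒮) {H : Aut 𝒮 → Set}
  (elation : IsElationGroup 𝒮 x H) where
  open Quadrangle 𝒮 thick x
  open IsThickGQ thick
  open IsElationGroup elation
  open IsSubgroup subgroup using () renaming (invCl to H-⁻¹)

  on-pres : ∀ f {p L} → p onᴸ L → pt f p onᴸ ln f L
  on-pres f {p} {L} p∈ = trans (pres {𝒮} f p L) p∈

  on-pres⁻ : ∀ f {p L} → pt f p onᴸ ln f L → p onᴸ L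
  on-pres⁻ f {p} {L} p∈ = trans (sym (pres {𝒮} f p L)) p∈

  col-pres : ∀ f {p q} → col p q → col (pt f p) (pt f q)
  col-pres f (L , p∈ , q∈) = ln f L , on-pres f p∈ , on-pres f q∈

  module _ {h : Aut 𝒮} (h∈ : H h) where

    ln-ℓ : ∀ i → ln h (ℓ i) ≡ ℓ i
    ln-ℓ i = fixLines h h∈ (ℓ i) (x∈ℓ i)

    ℓ-pres : ∀ {i w} → w onᴸ ℓ i → pt h w onᴸ ℓ i
    ℓ-pres {i} w∈ = subst (pt h _ onᴸ_) (ln-ℓ i) (on-pres h w∈)

    -- `x` is the only point on two different lines `ℓ i`, and `h` fixes these lines.
    fixes-x : pt h x ≡ x
    fixes-x = decidable-stable (pt h x ≟F x) λ ne →
      let i , 0≢i = ∃-other t≥2 zero in 0≢i (ℓ-meet ne (ℓ-pres (x∈ℓ zero)) (ℓ-pres (x∈ℓ i)))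

    ≢x-pres : ∀ {w} → w ≢ x → pt h w ≢ x
    ≢x-pres {w} w≢x e = w≢x (trans (sym (pt-inv₁ h w)) (trans (cong (pt⁻ h) (trans e (sym fixes-x))) (pt-inv₁ h x)))

    x~-pres : ∀ {y} → col x y → col x (pt h y)
    x~-pres c = subst (λ p → col p (pt h _)) fixes-x (col-pres h c)

  noncol-pres : ∀ {h} → H h → ∀ {y} → ¬ col x y → ¬ col x (pt h y)
  noncol-pres {h} h∈ x≁y c = x≁y (subst (col x) (pt-inv₁ h _) (x~-pres (H-⁻¹ h∈) c))

module Opposite (𝒮 : Incidence) {s t : ℕ} (thick : IsThickGQ 𝒮 s t) (x : Point 𝒮)
  (y₀ : Point 𝒮) (x≁y₀ : ¬ Collinear 𝒮 x y₀) where
  open Quadrangle 𝒮 thick x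
  open Incidence 𝒮
  open IsThickGQ thick
  open IsGQ isGQ

  noncol-off : ∀ {y L} → ¬ col x y → x onᴸ L → ¬ y onᴸ L
  noncol-off x≁y x∈ y∈ = x≁y (_ , x∈ , y∈)

  private
    foot : ∀ i → _
    foot i = gqExists y₀ (ℓ i) (noncol-off x≁y₀ (x∈ℓ i))

  -- The points of ℓ i collinear with y₀, and the lines joining them to y₀.
  z : Fin (suc t) → Point 𝒮
  z i = proj₁ (foot i)

  m : Fin (suc t) → Line 𝒮
  m i = proj₁ (proj₂ (proj₂ (foot i)))

  z∈ℓ : ∀ i → z i onᴸ ℓ i
  z∈ℓ i = proj₁ (proj₂ (foot i))

  y₀∈m : ∀ i → y₀ onᴸ m i
  y₀∈m i = proj₁ (proj₂ (proj₂ (proj₂ (foot i))))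

  z∈m : ∀ i → z i onᴸ m i
  z∈m i = proj₂ (proj₂ (proj₂ (proj₂ (foot i))))

  x~ : ∀ {i w} → w onᴸ ℓ i → col x w
  x~ {i} w∈ = ℓ i , x∈ℓ i , w∈

  x∉m : ∀ i → ¬ x onᴸ m i
  x∉m i x∈ = x≁y₀ (m i , x∈ , y₀∈m i)

  z≢x : ∀ i → z i ≢ x
  z≢x i e = x∉m i (subst (_onᴸ m i) e (z∈m i))

  z≢y₀ : ∀ i → z i ≢ y₀
  z≢y₀ i e = x≁y₀ (subst (col x) e (x~ (z∈ℓ i)))

  x~-unique : ∀ {L w w′} → ¬ x onᴸ L → w onᴸ L → w′ onᴸ L → col x w → col x w′ → w ≡ w′
  x~-unique x∉ w∈ w′∈ c c′ = gqUnique x _ _ _ x∉ w∈ c w′∈ c′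

  ℓ-unique : ∀ {i y w w′} → ¬ col x y → w onᴸ ℓ i → w′ onᴸ ℓ i → col y w → col y w′ → w ≡ w′
  ℓ-unique {i} x≁y w∈ w′∈ c c′ = gqUnique _ (ℓ i) _ _ (noncol-off x≁y (x∈ℓ i)) w∈ c w′∈ c′

  z∉m : ∀ {i j} → i ≢ j → ¬ z j onᴸ m i
  z∉m {i} {j} i≢j h = i≢j (ℓ-meet (z≢x i) (z∈ℓ i) (subst (_onᴸ ℓ j) (sym z≡) (z∈ℓ j)))
    where
    z≡ : z i ≡ z j
    z≡ = x~-unique (x∉m i) (z∈m i) h (x~ (z∈ℓ i)) (x~ (z∈ℓ j))

  m-inj : ∀ {i j} → m i ≡ m j → i ≡ j
  m-inj {i} {j} e = decidable-stable (i ≟F j) λ i≢j → z∉m i≢j (subst (z j onᴸ_) (sym e) (z∈m j))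

  m-noncol : ∀ {i p} → p onᴸ m i → p ≢ z i → ¬ col x p
  m-noncol {i} p∈ p≢z c = p≢z (x~-unique (x∉m i) p∈ (z∈m i) c (x~ (z∈ℓ i)))

  line-through-y₀ : ∀ {L} → y₀ onᴸ L → ∃ λ i → L ≡ m i
  line-through-y₀ {L} y₀∈ with gqExists x L (λ x∈ → x≁y₀ (L , x∈ , y₀∈))
  ... | q , q∈ , K , x∈K , q∈K with ℓ-onto x∈K
  ... | i , refl = i , atMostOne y₀ (z i) L (m i) (z≢y₀ i ∘ sym) y₀∈ (subst (_onᴸ L) q≡z q∈) (y₀∈m i) (z∈m i)
    where
    q≡z : q ≡ z i
    q≡z = ℓ-unique x≁y₀ q∈K (z∈ℓ i) (L , y₀∈ , q∈) (m i , y₀∈m i , z∈m i)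

module SkewTranslation (𝒮 : Incidence) {s t : ℕ} (thick : IsThickGQ 𝒮 s t) (x : Point 𝒮) {H Sym : Aut 𝒮 → Set}
  (stgq : IsSTGQ 𝒮 s t x H Sym) (y₀ : Point 𝒮) (x≁y₀ : ¬ Collinear 𝒮 x y₀)
  {n : ℕ} (𝓜 : Model (AutGroup 𝒮) H n) where
  open Quadrangle 𝒮 thick x
  open Incidence 𝒮
  open IsThickGQ thick
  open IsGQ isGQ
  open IsSTGQ stgq
  open IsElationGroup elation
  open Elations 𝒮 thick x elation
  open Opposite 𝒮 thick x y₀ x≁y₀
  open IsSubgroup subgroup using () renaming (invCl to H-⁻¹)

  infix 4 _≈ᴬ_
  _≈ᴬ_ : Aut 𝒮 → Aut 𝒮 → Set
  _≈ᴬ_ = _≈_ 𝒮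

  fixes-m⇒fixes-z : ∀ {h i} → H h → ln h (m i) ≡ m i → pt h (z i) ≡ z i
  fixes-m⇒fixes-z {h} {i} h∈ e = x~-unique (x∉m i) (subst (pt h (z i) onᴸ_) e (on-pres h (z∈m i))) (z∈m i)
    (x~ (ℓ-pres h∈ (z∈ℓ i))) (x~ (z∈ℓ i))

  -- Both `z i` and its image are points of `ℓ i` collinear with the image of `y₀`, so they
  -- coincide; then `m i` and its image share two points.
  y₀↦m⇒fixes-m : ∀ {h i} → H h → pt h y₀ onᴸ m i → ln h (m i) ≡ m i
  y₀↦m⇒fixes-m {h} {i} h∈ e = atMostOne (pt h y₀) (z i) (ln h (m i)) (m i) (λ e′ → noncol-pres h∈ x≁y₀ (subst (col x) (sym e′) (x~ (z∈ℓ i))))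
    (on-pres h (y₀∈m i)) (subst (_onᴸ ln h (m i)) z≡ (on-pres h (z∈m i))) e (z∈m i)
    where
    z≡ : pt h (z i) ≡ z i
    z≡ = ℓ-unique (noncol-pres h∈ x≁y₀) (ℓ-pres h∈ (z∈ℓ i)) (z∈ℓ i) (ln h (m i) , on-pres h (y₀∈m i) , on-pres h (z∈m i)) (m i , e , z∈m i)

  m↦≢ℓ : ∀ {h i j} → H h → ln h (m i) ≢ ℓ j
  m↦≢ℓ {h} {i} {j} h∈ e = noncol-off (noncol-pres h∈ x≁y₀) (x∈ℓ j) (subst (pt h y₀ onᴸ_) e (on-pres h (y₀∈m i)))

  -- The image of `y₀` is the only point on the image of `m i` collinear with the image of `z j`,
  -- and an elation is determined by the image of `y₀`.
  determined : ∀ {h h′ i j} → H h → H h′ → i ≢ j → ln h (m i) ≡ ln h′ (m i) → pt h (z j) ≡ pt h′ (z j) → h ≈ᴬ h′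
  determined {h} {h′} {i} {j} h∈ h′∈ i≢j m≡ z≡ = sharp y₀ h h′ x≁y₀ h∈ h′∈
    (gqUnique (pt h (z j)) (ln h (m i)) (pt h y₀) (pt h′ y₀)
      (λ z∈ → z∉m i≢j (on-pres⁻ h z∈))
      (on-pres h (y₀∈m i)) (col-pres h (m j , z∈m j , y₀∈m j))
      (subst (pt h′ y₀ onᴸ_) (sym m≡) (on-pres h′ (y₀∈m i))) (subst (λ p → col p (pt h′ y₀)) (sym z≡) (col-pres h′ (m j , z∈m j , y₀∈m j))))

  symm : Fin t → Aut 𝒮
  symm = proj₁ symCard

  Sym-symm : ∀ k → Sym (symm k)
  Sym-symm = proj₁ (proj₂ symCard)

  symm-inj : ∀ {k l} → symm k ≈ᴬ symm l → k ≡ l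
  symm-inj = proj₁ (proj₂ (proj₂ symCard)) _ _

  symm-onto : ∀ {f} → Sym f → ∃ λ k → f ≈ᴬ symm k
  symm-onto = proj₂ (proj₂ (proj₂ symCard)) _

  H-symm : ∀ k → H (symm k)
  H-symm k = sym⊆H _ (Sym-symm k)

  symm-fixes : ∀ k {y} → col x y → pt (symm k) y ≡ y
  symm-fixes k = symmetric (symm k) (Sym-symm k) _

  -- The images of m i under the t symmetries are the t lines on z i other than ℓ i.
  fixes-two⇒symmetry : ∀ {h i j} → H h → i ≢ j → pt h (z i) ≡ z i → pt h (z j) ≡ z j → ∃ λ k → h ≈ᴬ symm k
  fixes-two⇒symmetry {h} {i} {j} h∈ i≢j zᵢ zⱼ = finish (injection-hits {P = λ (_ : Fin (suc t)) → ⊤} (λ _ → yes tt) (on? (z i)) (λ a _ → image a) (λ a _ → image-∈ a) (λ _ _ → image-inj)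
      (≤-reflexive (trans (#lines (z i)) (sym (#-full {suc t} (λ _ → yes tt) (λ _ → tt))))) (ln h (m i)) (subst (_onᴸ ln h (m i)) zᵢ (on-pres h (z∈m i))))
    where
    symm-z : ∀ k l → pt (symm k) (z l) ≡ z l
    symm-z k l = symm-fixes k (x~ (z∈ℓ l))
    image : Fin (suc t) → Line 𝒮
    image zero = ℓ i
    image (suc k) = ln (symm k) (m i)
    image-∈ : ∀ a → z i onᴸ image a
    image-∈ zero = z∈ℓ i
    image-∈ (suc k) = subst (_onᴸ ln (symm k) (m i)) (symm-z k i) (on-pres (symm k) (z∈m i))
    image-inj : ∀ {a b} → image a ≡ image b → a ≡ b
    image-inj {zero} {zero} e = refl
    image-inj {zero} {suc l} e = ⊥-elim (m↦≢ℓ (H-symm l) (sym e))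
    image-inj {suc k} {zero} e = ⊥-elim (m↦≢ℓ (H-symm k) e)
    image-inj {suc k} {suc l} e = cong suc (symm-inj (determined (H-symm k) (H-symm l) i≢j e (trans (symm-z k j) (sym (symm-z l j)))))
    finish : (∃ λ a → Σ ⊤ λ _ → image a ≡ ln h (m i)) → ∃ λ k → h ≈ᴬ symm k
    finish (zero , _ , e) = ⊥-elim (m↦≢ℓ h∈ (sym e))
    finish (suc k , _ , e) = k , determined h∈ (H-symm k) i≢j (sym e) (trans zⱼ (sym (symm-z k j)))

  open Model 𝓜
  open FinGroup Γ
  private module A = Group (AutGroup 𝒮)

  pt-∙ : ∀ g h p → pt (φ (g ∙ h)) p ≡ pt (φ g) (pt (φ h) p)
  pt-∙ g h = proj₁ (φ-∙ g h)

  pt-⁻¹ : ∀ g p → pt (φ (g ⁻¹)) p ≡ pt⁻ (φ g) p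
  pt-⁻¹ g = proj₁ (φ-⁻¹ g)

  ≡-from-y₀ : ∀ {g h} → pt (φ g) y₀ ≡ pt (φ h) y₀ → g ≡ h
  ≡-from-y₀ e = φ-inj (sharp y₀ _ _ x≁y₀ (φ-∈ _) (φ-∈ _) e)

  reach : ∀ {u} → ¬ col x u → ∃ λ g → pt (φ g) y₀ ≡ u
  reach {u} x≁u with transitive y₀ u x≁y₀ x≁u
  ... | h , h∈ , e with φ-onto h∈
  ... | g , φg≈h = g , trans (proj₁ φg≈h y₀) e

  -- Membership goes through the enumeration of `Sym`: unlike the arbitrary predicate `Sym`, it can
  -- be decided, by comparing images of `y₀`.
  S : Fin n → Set
  S g = ∃ λ k → φ g ≈ᴬ symm k

  S? : Decidable S
  S? g = any? λ k → map′ (sharp y₀ _ _ x≁y₀ (φ-∈ g) (H-symm k)) (λ e → proj₁ e y₀) (pt (φ g) y₀ ≟F pt (symm k) y₀)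

  S-from-y₀ : ∀ {f g} → Sym f → pt (φ g) y₀ ≡ pt f y₀ → S g
  S-from-y₀ {f} {g} f∈ e = let k , f≈ = symm-onto f∈ in
    k , sharp y₀ (φ g) (symm k) x≁y₀ (φ-∈ g) (H-symm k) (trans e (proj₁ f≈ y₀))

  S-sub : IsSubgroupOf S
  S-sub = record
    { ε∈ = S-from-y₀ (IsSubgroup.hasId symSub) (proj₁ φ-ε y₀)
    ; ∙∈ = λ {g} {h} (k , e) (l , e′) → S-from-y₀ (IsSubgroup.closed symSub (Sym-symm k) (Sym-symm l))
        (trans (pt-∙ g h y₀) (trans (proj₁ e _) (cong (pt (symm k)) (proj₁ e′ y₀))))
    ; ⁻¹∈ = λ {g} (k , e) → S-from-y₀ (IsSubgroup.invCl symSub (Sym-symm k))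
        (trans (pt-⁻¹ g y₀) (proj₁ (A.⁻¹-cong {φ g} {symm k} e) y₀)) }

  S-fixes : ∀ {σ} → S σ → ∀ {y} → col x y → pt (φ σ) y ≡ y
  S-fixes (k , e) {y} c = trans (proj₁ e y) (symm-fixes k c)

  infix 4 _∼_
  _∼_ : Fin n → Fin n → Set
  g ∼ h = S (g ⁻¹ ∙ h)

  ∼-from-z : ∀ {i j g h} → i ≢ j → pt (φ g) (z i) ≡ pt (φ h) (z i) → pt (φ g) (z j) ≡ pt (φ h) (z j) → g ∼ h
  ∼-from-z {g = g} {h} i≢j e e′ = fixes-two⇒symmetry (φ-∈ _) i≢j (fixes e) (fixes e′)
    where
    fixes : ∀ {p} → pt (φ g) p ≡ pt (φ h) p → pt (φ (g ⁻¹ ∙ h)) p ≡ p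
    fixes {p} e = trans (pt-∙ _ _ p) (trans (pt-⁻¹ g _) (trans (cong (pt⁻ (φ g)) (sym e)) (pt-inv₁ (φ g) p)))

  ∼-agree : ∀ {g h} → g ∼ h → ∀ {y} → col x y → pt (φ g) y ≡ pt (φ h) y
  ∼-agree {g} {h} r {y} c = trans (cong (pt (φ g)) (sym (trans (sym (trans (pt-∙ _ _ y) (pt-⁻¹ g _))) (S-fixes r c)))) (pt-inv₂ (φ g) _)

  -- The conjugate fixes the points `z` on two lines through `x`, which already makes it a symmetry.
  S-normal : ∀ g {σ} → S σ → S (g ∙ σ ∙ g ⁻¹)
  S-normal g {σ} σ∈ = let i , 0≢i = ∃-other t≥2 zero in fixes-two⇒symmetry (φ-∈ _) 0≢i (fixes zero) (fixes i)
    where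
    fixes : ∀ i → pt (φ (g ∙ σ ∙ g ⁻¹)) (z i) ≡ z i
    fixes i = trans (pt-∙ _ _ _) (trans (pt-∙ _ _ _) (trans (cong (pt (φ g)) (S-fixes σ∈ (x~-pres (φ-∈ (g ⁻¹)) (x~ (z∈ℓ i)))))
      (trans (cong (pt (φ g)) (pt-⁻¹ g _)) (pt-inv₂ (φ g) _))))

  #S : # S? ≡ t
  #S = ≤-antisym
    (≤-trans (injection-≤ {Q = λ (_ : Fin t) → ⊤} S? (λ _ → yes tt) (λ g → proj₁) (λ _ _ → tt)
        (λ { (k , e) (l , e′) refl → ≡-from-y₀ (trans (proj₁ e y₀) (sym (proj₁ e′ y₀))) })) (#-≤n {t} {λ _ → ⊤} (λ _ → yes tt)))
    (≤-trans (≤-reflexive (sym (#-full {t} (λ _ → yes tt) (λ _ → tt))))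
      (injection-≤ {P = λ (_ : Fin t) → ⊤} (λ _ → yes tt) S? (λ k _ → proj₁ (φ-onto (H-symm k))) (λ k _ → k , proj₂ (φ-onto (H-symm k)))
        (λ {k} {l} _ _ e → symm-inj (sharp y₀ (symm k) (symm l) x≁y₀ (H-symm k) (H-symm l)
          (trans (sym (proj₁ (proj₂ (φ-onto (H-symm k))) y₀)) (trans (cong (λ g → pt (φ g) y₀) e) (proj₁ (proj₂ (φ-onto (H-symm l))) y₀)))))))

  F : Fin (suc t) → Fin n → Set
  F i g = ln (φ g) (m i) ≡ m i

  F? : ∀ i → Decidable (F i)
  F? i g = ln (φ g) (m i) ≟F m i

  F-sub : ∀ i → IsSubgroupOf (F i)
  F-sub i = record
    { ε∈ = proj₂ φ-ε (m i)
    ; ∙∈ = λ {g} {h} p q → trans (proj₂ (φ-∙ g h) (m i)) (trans (cong (ln (φ g)) q) p)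
    ; ⁻¹∈ = λ {g} p → trans (proj₂ (φ-⁻¹ g) (m i)) (trans (cong (ln⁻ (φ g)) (sym p)) (ln-inv₁ (φ g) (m i))) }

  F-fixes-z : ∀ {i a} → F i a → pt (φ a) (z i) ≡ z i
  F-fixes-z = fixes-m⇒fixes-z (φ-∈ _)

  F-y₀ : ∀ {i a} → F i a → pt (φ a) y₀ onᴸ m i
  F-y₀ {i} {a} a∈ = subst (pt (φ a) y₀ onᴸ_) a∈ (on-pres (φ a) (y₀∈m i))

  F-reach : ∀ {i u} → u onᴸ m i → u ≢ z i → ∃ λ a → F i a × pt (φ a) y₀ ≡ u
  F-reach {i} u∈ u≢z with reach (m-noncol u∈ u≢z)
  ... | a , e = a , y₀↦m⇒fixes-m (φ-∈ a) (subst (_onᴸ m i) (sym e) u∈) , e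

  -- `F i` acts regularly on the points of `m i` other than `z i`.
  #F : ∀ i → # (F? i) ≡ s
  #F i = +-cancelˡ-≡ 1 _ _ (trans (cong (1 +_) (≤-antisym
      (injection-≤ (F? i) P? (λ a _ → pt (φ a) y₀) (λ a a∈ → F-y₀ a∈ , λ e → noncol-pres (φ-∈ a) x≁y₀ (subst (col x) (sym e) (x~ (z∈ℓ i)))) (λ _ _ → ≡-from-y₀))
      (injection-≤ P? (F? i) (λ u (u∈ , u≢) → proj₁ (F-reach u∈ u≢)) (λ u (u∈ , u≢) → proj₁ (proj₂ (F-reach u∈ u≢)))
        (λ (u∈ , u≢) (v∈ , v≢) e → trans (sym (proj₂ (proj₂ (F-reach u∈ u≢)))) (trans (cong (λ g → pt (φ g) y₀) e) (proj₂ (proj₂ (F-reach v∈ v≢))))))))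
    (trans (cong (_+ # P?) (sym (#-unique (λ p → on? p (m i) ×-dec (p ≟F z i)) (z i) (z∈m i , refl) (λ _ → proj₂))))
      (trans (sym (#-split (λ p → on? p (m i)) (λ p → p ≟F z i))) (#points (m i)))))
    where
    P? : Decidable (λ p → p onᴸ m i × p ≢ z i)
    P? p = on? p (m i) ×-dec ¬? (p ≟F z i)

  F-nontrivial : ∀ i → ∃ λ a → F i a × a ≢ ε
  F-nontrivial i with any? (λ a → F? i a ×-dec ¬? (a ≟F ε))
  ... | yes p = p
  ... | no none = ⊥-elim (<⇒≱ s≥2 (≤-trans (≤-reflexive (sym (#F i))) (#-≤1 (F? i) λ a b a∈ b∈ → trans (is-ε a∈) (sym (is-ε b∈)))))
    where
    is-ε : ∀ {a} → F i a → a ≡ ε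
    is-ε {a} a∈ = decidable-stable (a ≟F ε) (λ ne → none (a , a∈ , ne))

  -- `a` fixes `m i`, and it fixes `z j` because it agrees with `b` on the points collinear with
  -- `x`. By `determined` it is the identity.
  K2 : ∀ {i j a b} → i ≢ j → F i a → F j b → a ∼ b → a ≡ ε
  K2 {i} {j} {a} {b} i≢j a∈ b∈ r = φ-inj (determined (φ-∈ a) (φ-∈ ε) i≢j (trans a∈ (sym (proj₂ φ-ε (m i))))
    (trans (∼-agree r (x~ (z∈ℓ j))) (trans (F-fixes-z b∈) (sym (proj₁ φ-ε (z j))))))

  y₀-fixed⇒ε : ∀ {g} → pt (φ g) y₀ ≡ y₀ → g ≡ ε
  y₀-fixed⇒ε e = ≡-from-y₀ (trans e (sym (proj₁ φ-ε y₀)))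

  meet-m : ∀ {i j p} → i ≢ j → p onᴸ m i → p onᴸ m j → p ≡ y₀
  meet-m {i} {j} {p} i≢j p∈ p∈′ = decidable-stable (p ≟F y₀) λ ne → i≢j (m-inj (atMostOne p y₀ (m i) (m j) ne p∈ (y₀∈m i) p∈′ (y₀∈m j)))

  -- A solution would give a triangle with vertices y₀, a y₀ and c y₀.
  K1 : ∀ {i j k a b c} → i ≢ j → i ≢ k → j ≢ k → F i a → F j b → F k c → a ∙ b ≡ c → c ≡ ε
  K1 {i} {j} {k} {a} {b} {c} i≢j i≢k j≢k a∈ b∈ c∈ e with on? (pt (φ c) y₀) (m i)
  ... | yes cy∈ = y₀-fixed⇒ε (meet-m i≢k cy∈ (F-y₀ c∈))
  ... | no cy∉ = y₀-fixed⇒ε (meet-m j≢k (subst (λ g → pt (φ g) y₀ onᴸ m j) b≡c (F-y₀ b∈)) (F-y₀ c∈))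
    where
    cy≡ : pt (φ c) y₀ ≡ pt (φ a) (pt (φ b) y₀)
    cy≡ = trans (cong (λ g → pt (φ g) y₀) (sym e)) (pt-∙ a b y₀)
    y₀≡ay : y₀ ≡ pt (φ a) y₀
    y₀≡ay = gqUnique (pt (φ c) y₀) (m i) y₀ (pt (φ a) y₀) cy∉ (y₀∈m i) (m k , F-y₀ c∈ , y₀∈m k)
      (F-y₀ a∈) (subst (λ p → col p (pt (φ a) y₀)) (sym cy≡) (col-pres (φ a) (m j , F-y₀ b∈ , y₀∈m j)))
    b≡c : b ≡ c
    b≡c = trans (sym (identityˡ b)) (trans (cong (_∙ b) (sym (y₀-fixed⇒ε (sym y₀≡ay)))) e)

  module _ {i j w} (i≢j : i ≢ j) (w∈ : w onᴸ ℓ i) (w≢x : w ≢ x) where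

    private
      w∉m : ¬ w onᴸ m j
      w∉m h = i≢j (ℓ-meet w≢x w∈ (subst (_onᴸ ℓ j) (x~-unique (x∉m j) (z∈m j) h (x~ (z∈ℓ j)) (x~ w∈)) (z∈ℓ j)))

      z∉ℓ : ¬ z j onᴸ ℓ i
      z∉ℓ h = i≢j (ℓ-meet (z≢x j) h (z∈ℓ j))

      move-along : ∀ {u K} → u onᴸ m j → w onᴸ K → u onᴸ K → ∃ λ b → F j b × pt (φ b) (z i) ≡ w
      move-along {u} {K} u∈ w∈K u∈K = let b , b∈ , by≡u = F-reach u∈ u≢z in
        b , b∈ , ℓ-unique (noncol-pres (φ-∈ b) x≁y₀) (ℓ-pres (φ-∈ b) (z∈ℓ i)) w∈
          (col-pres (φ b) (m i , y₀∈m i , z∈m i)) (K , subst (_onᴸ K) (sym by≡u) u∈K , w∈K)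
        where
        u≢z : u ≢ z j
        u≢z refl = w≢x (gqUnique (z j) (ℓ i) w x z∉ℓ w∈ (K , u∈K , w∈K) (x∈ℓ i) (col-sym (x~ (z∈ℓ j))))

    -- Project `w` to a point `u` of `m j`. It is not `z j`, which would be collinear with the two
    -- points `w` and `x` of `ℓ i`. The element of `F j` taking `y₀` to `u` takes `z i` to the point
    -- of `ℓ i` collinear with `u`, which is `w`.
    move : ∃ λ b → F j b × pt (φ b) (z i) ≡ w
    move = let u , u∈ , K , w∈K , u∈K = gqExists w (m j) w∉m in move-along u∈ w∈K u∈K

  -- `b` will fix `z j`, so `a` has to move `z j` as `g` does; `b` then corrects the effect on
  -- `z i`. Agreement at both points is agreement modulo `S`.
  decompose : ∀ {i j} → i ≢ j → ∀ g → ∃ λ a → ∃ λ b → F i a × F j b × a ∙ b ∼ g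
  decompose {i} {j} i≢j g =
    let a , a∈ , az≡ = move (i≢j ∘ sym) (ℓ-pres (φ-∈ g) (z∈ℓ j)) (≢x-pres (φ-∈ g) (z≢x j))
        b , b∈ , bz≡ = move i≢j (ℓ-pres (H-⁻¹ (φ-∈ a)) (ℓ-pres (φ-∈ g) (z∈ℓ i))) (≢x-pres (H-⁻¹ (φ-∈ a)) (≢x-pres (φ-∈ g) (z≢x i)))
    in a , b , a∈ , b∈ , ∼-from-z i≢j
      (trans (pt-∙ a b _) (trans (cong (pt (φ a)) bz≡) (pt-inv₂ (φ a) _)))
      (trans (pt-∙ a b _) (trans (cong (pt (φ a)) (F-fixes-z b∈)) az≡))

  fixes-z⇒InFS : ∀ {i g} → pt (φ g) (z i) ≡ z i → ∃ λ a → F i a × a ∼ g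
  fixes-z⇒InFS {i} {g} e =
    let j , i≢j = ∃-other t≥2 i
        a , a∈ , az≡ = move (i≢j ∘ sym) (ℓ-pres (φ-∈ g) (z∈ℓ j)) (≢x-pres (φ-∈ g) (z≢x j))
    in a , a∈ , ∼-from-z i≢j (trans (F-fixes-z a∈) (sym e)) az≡

  module _ {i g} (moves-z : pt (φ g) (z i) ≢ z i) where

    private
      Factorization : Set
      Factorization = ∃ λ j → ∃ λ a → ∃ λ b → j ≢ i × F i a × F j b × g ≡ a ∙ b

      v : Point 𝒮
      v = pt (φ g) y₀

      v≁z : ¬ col v (z i)
      v≁z c = moves-z (ℓ-unique (noncol-pres (φ-∈ g) x≁y₀) (ℓ-pres (φ-∈ g) (z∈ℓ i)) (z∈ℓ i) (col-pres (φ g) (m i , y₀∈m i , z∈m i)) c)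

      v∉m : ¬ v onᴸ m i
      v∉m h = v≁z (m i , h , z∈m i)

      factor-along : ∀ {u K} → u onᴸ m i → v onᴸ K → u onᴸ K → Factorization
      factor-along {u} {K} u∈ v∈K u∈K =
        let a , a∈ , ay≡u = F-reach u∈ u≢z
            j , K≡m = line-through-y₀ (y₀∈K a ay≡u)
        in j , a , a ⁻¹ ∙ g , j≢i a∈ K≡m , a∈ , y₀↦m⇒fixes-m (φ-∈ _) (by∈ a K≡m) , solve 2 (λ a g → g ⊜ a ⊗ (a ⊖ ⊗ g)) refl a g
        where
        u≢z : u ≢ z i
        u≢z refl = v≁z (K , v∈K , u∈K)
        y₀∈K : ∀ a → pt (φ a) y₀ ≡ u → y₀ onᴸ ln⁻ (φ a) K
        y₀∈K a ay≡u = subst (_onᴸ ln⁻ (φ a) K) (trans (cong (pt⁻ (φ a)) (sym ay≡u)) (pt-inv₁ (φ a) y₀)) (on-pres (inv 𝒮 (φ a)) u∈K)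
        by∈ : ∀ a {j} → ln⁻ (φ a) K ≡ m j → pt (φ (a ⁻¹ ∙ g)) y₀ onᴸ m j
        by∈ a K≡m = subst₂ _onᴸ_ (sym (trans (pt-∙ _ _ _) (pt-⁻¹ a _))) K≡m (on-pres (inv 𝒮 (φ a)) v∈K)
        j≢i : ∀ {a j} → F i a → ln⁻ (φ a) K ≡ m j → j ≢ i
        j≢i {a} a∈ K≡m refl = v∉m (subst (v onᴸ_) (trans (sym (ln-inv₂ (φ a) K)) (trans (cong (ln (φ a)) K≡m) a∈)) v∈K)

    -- Project `v` onto `m i`. The projection is not `z i`, so it is the image of `y₀` under some
    -- `a` in `F i`. Pulled back by `a`, the projecting line passes through `y₀`, hence is some
    -- `m j`, and it contains the image of `y₀` under `a ⁻¹ ∙ g`.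
    moves-z⇒factorization : Factorization
    moves-z⇒factorization = let u , u∈ , K , v∈K , u∈K = gqExists v (m i) v∉m in factor-along u∈ v∈K u∈K

  cover : ∀ i g → (∃ λ a → F i a × a ∼ g) ⊎ (∃ λ j → ∃ λ a → ∃ λ b → j ≢ i × F i a × F j b × g ≡ a ∙ b)
  cover i g = case pt (φ g) (z i) ≟F z i of λ
    { (yes e) → inj₁ (fixes-z⇒InFS e)
    ; (no ne) → inj₂ (moves-z⇒factorization ne) }

  family : Family Γ t
  family = record
    { 2≤t = t≥2 ; S = S ; S? = S? ; S-sub = S-sub ; S-normal = S-normal ; #S = #S
    ; F = F ; F? = F? ; F-sub = F-sub ; F-nontrivial = F-nontrivial
    ; K1 = K1 ; K2 = K2 ; decompose = decompose ; cover = cover }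

  -- An element of `F i` fixes `z i`, so by the property it fixes every point of `ℓ i`, among them
  -- the preimage of `z i` under `g`. Therefore its conjugate fixes `z i` too.
  star⇒FS-normal : PropertyStar 𝒮 x H → ∀ i g {a} → F i a → ∃ λ b → F i b × b ∼ g ∙ a ∙ g ⁻¹
  star⇒FS-normal star i g {a} a∈ = fixes-z⇒InFS (trans (pt-∙ _ _ _) (trans (pt-∙ _ _ _)
    (trans (cong (λ p → pt (φ g) (pt (φ a) p)) (pt-⁻¹ g (z i)))
      (trans (cong (pt (φ g)) (star (φ a) (z i) (ℓ i) (φ-∈ a) (z≢x i) (x∈ℓ i) (z∈ℓ i) (F-fixes-z a∈) (pt⁻ (φ g) (z i)) (ℓ-pres (H-⁻¹ (φ-∈ g)) (z∈ℓ i))))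
        (pt-inv₂ (φ g) (z i))))))

-- Decidable subgroups

module Generation {N : ℕ} (Γ : FinGroup N) {M : Fin N → Set} (gen : Fin N → Fin N)
  (M-sub : FinGroup.IsSubgroupOf Γ M) (gen∈M : ∀ g → M (gen g)) where
  open FinGroup Γ
  open IsSubgroupOf

  data Generated : Fin N → Set where
    unit : Generated ε
    step : ∀ {a} → Generated a → ∀ g → Generated (a ∙ gen g)

  Generated⊆M : ∀ {a} → Generated a → M a
  Generated⊆M unit = ε∈ M-sub
  Generated⊆M (step a g) = ∙∈ M-sub (Generated⊆M a) (gen∈M g)

  private
    -- A decidable part `T` of `Generated` grows until it is closed under right multiplication by
    -- generators; `n` bounds the number of elements still outside `T`.
    complete : ∀ n {T : Fin N → Set} → (∀ {a} → T a → Generated a) → T ε → (T? : Decidable T) → N ≤ n + # T? → Decidable Generated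
    complete n {T} T⊆ Tε T? le with any? (λ a → any? λ g → T? a ×-dec ¬? (T? (a ∙ gen g)))
    ... | no closed = λ a → map′ T⊆ ⊆T (T? a)
      where
      ⊆T : ∀ {a} → Generated a → T a
      ⊆T unit = Tε
      ⊆T (step {a} p g) = decidable-stable (T? _) (λ ∉T → closed (a , g , ⊆T p , ∉T))
    complete zero {T} T⊆ Tε T? le | yes (a , g , a∈ , ∉T) =
      ⊥-elim (<⇒≱ (<-≤-trans (#-⊂ {Q = λ _ → ⊤} T? (λ _ → yes tt) (λ _ _ → tt) {a ∙ gen g} tt ∉T) (#-≤n {N} {λ _ → ⊤} (λ _ → yes tt))) le)
    complete (suc n) {T} T⊆ Tε T? le | yes (a , g , a∈ , ∉T) =
      complete n (λ { (inj₁ p) → T⊆ p ; (inj₂ refl) → step (T⊆ a∈) g }) (inj₁ Tε) T′?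
        (≤-trans le (≤-trans (≤-reflexive (sym (+-suc n (# T?)))) (+-monoʳ-≤ n (#-⊂ T? T′? (λ _ → inj₁) (inj₂ refl) ∉T))))
      where
      T′? : Decidable (λ b → T b ⊎ b ≡ a ∙ gen g)
      T′? b = T? b ⊎-dec (b ≟F a ∙ gen g)

  generated? : Decidable Generated
  generated? = complete N (λ { refl → unit }) refl (_≟F ε) (m≤m+n N _)

  generated-gen : ∀ g → Generated (gen g)
  generated-gen g = subst Generated (identityˡ _) (step unit g)

  private
    generated-∙ : ∀ {a b} → Generated a → Generated b → Generated (a ∙ b)
    generated-∙ p unit = subst Generated (sym (identityʳ _)) p
    generated-∙ p (step q g) = subst Generated (assoc _ _ _) (step (generated-∙ p q) g)

    -- `Generated` has no constructor for inverses. Left multiplication by `a` is injective on this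
    -- finite set, hence reaches `ε`.
    generated-⁻¹ : ∀ {a} → Generated a → Generated (a ⁻¹)
    generated-⁻¹ {a} p with injection-hits generated? generated? (λ b _ → a ∙ b) (λ b q → generated-∙ p q) (λ _ _ → ∙-cancelˡ) ≤-refl ε unit
    ... | b , q , ab≡ε = subst Generated (trans (solve 2 (λ a b → b ⊜ a ⊖ ⊗ (a ⊗ b)) refl a b) (trans (cong (a ⁻¹ ∙_) ab≡ε) (identityʳ _))) q

  Generated-sub : IsSubgroupOf Generated
  Generated-sub = record { ε∈ = unit ; ∙∈ = generated-∙ ; ⁻¹∈ = generated-⁻¹ }

-- From the elation group to the finite family and back

module Conclusion (S : Incidence) {s t : ℕ} (x : Point S) {H Sym M : Aut S → Set}
  (thick : IsThickGQ S s t) (stgq : IsSTGQ S s t x H Sym)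
  (hyp : (s ≡ t × Odd s) ⊎ (s ≢ t × PropertyStar S x H))
  (M-subgroup : IsSubgroup S M) (M⊆H : _⊆_ S M H)
  (factor : ∀ h → H h → ∃ λ m → ∃ λ σ → M m × Sym σ × _≈_ S h (_·_ S m σ)) where

  open Quadrangle S thick x
  open IsSTGQ stgq using (elation)
  open IsElationGroup elation

  y₀ : Point S
  y₀ = proj₁ ∃-noncollinear

  x≁y₀ : ¬ col x y₀
  x≁y₀ = proj₂ ∃-noncollinear

  private module A = Group (AutGroup S)

  module _ {n : ℕ} (𝓜 : Model (AutGroup S) H n) where
    open SkewTranslation S thick x stgq y₀ x≁y₀ 𝓜 hiding (S)
    open Model 𝓜
    open FinGroup Γ
    open FamilyProperties family using (FS-normal; commutative)

    comm : ∀ g h → g ∙ h ∼ h ∙ g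
    comm = case hyp of λ
      { (inj₁ (s≡t , _)) → commutative (FS-normal (λ i → trans (#F i) s≡t))
      ; (inj₂ (_ , star)) → commutative (star⇒FS-normal star) }

    odd-or-≢ : ∀ i → # (F? i) ≢ t ⊎ ¬ 2 ∣ # (F? i)
    odd-or-≢ i = subst (λ k → k ≢ t ⊎ ¬ 2 ∣ k) (sym (#F i)) (case hyp of λ
      { (inj₁ (_ , odd)) → inj₂ λ 2∣s → case trans (sym odd) (n∣m⇒m%n≡0 s 2 2∣s) of λ ()
      ; (inj₂ (s≢t , _)) → inj₁ s≢t })

    φM : Fin n → Set
    φM g = M (φ g)

    M-resp : ∀ f g → _≈_ S f g → M f → M g
    M-resp f g = IsSubgroup.resp M-subgroup {f} {g}

    φM-sub : IsSubgroupOf φM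
    φM-sub = record
      { ε∈ = M-resp (idAut S) (φ ε) (A.sym {φ ε} {idAut S} φ-ε) (IsSubgroup.hasId M-subgroup)
      ; ∙∈ = λ {g} {h} p q → M-resp (_·_ S (φ g) (φ h)) (φ (g ∙ h)) (A.sym {φ (g ∙ h)} {_·_ S (φ g) (φ h)} (φ-∙ g h)) (IsSubgroup.closed M-subgroup p q)
      ; ⁻¹∈ = λ {g} p → M-resp (inv S (φ g)) (φ (g ⁻¹)) (A.sym {φ (g ⁻¹)} {inv S (φ g)} (φ-⁻¹ g)) (IsSubgroup.invCl M-subgroup p) }

    supplement : ∀ g → ∃ λ m → φM m × m ∼ g
    supplement g with factor (φ g) (φ-∈ g)
    ... | m , σ , m∈ , σ∈ , e with φ-onto (M⊆H m m∈)
    ... | i , φi≈m = i , M-resp m (φ i) (A.sym {φ i} {m} φi≈m) m∈ ,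
      S-from-y₀ σ∈ (trans (pt-∙ (i ⁻¹) g y₀) (trans (pt-⁻¹ i _) (trans (cong (pt⁻ (φ i)) (trans (proj₁ e y₀) (sym (proj₁ φi≈m (pt σ y₀))))) (pt-inv₁ (φ i) (pt σ y₀)))))

    -- M need not be decidable; it is replaced by a subgroup generated by finitely many of its elements.
    open Generation Γ (λ g → proj₁ (supplement g)) φM-sub (λ g → proj₁ (proj₂ (supplement g)))

    generated-supplement : ∀ g → ∃ λ m → Generated m × m ∼ g
    generated-supplement g = _ , generated-gen g , proj₂ (proj₂ (supplement g))

    φM-full : ∀ g → φM g
    φM-full g = Generated⊆M (Supplements.S⊆M⇒full family generated? Generated-sub generated-supplement
      (Reduction.S⊆supplement family comm odd-or-≢ generated? Generated-sub generated-supplement) g)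

    H⊆M : ∀ h → H h → M h
    H⊆M h h∈ = let i , e = φ-onto h∈ in M-resp (φ i) h e (φM-full i)

  noncollinear? : Decidable (λ y → ¬ col x y)
  noncollinear? y = ¬? (col? x y)

  -- `H` acts regularly on the points not collinear with `x`, so these points index its elements
  -- through the images of `y₀`.
  elation-model : Model (AutGroup S) H (# noncollinear?)
  elation-model = model (AutGroup S) (λ i → proj₁ (h i)) (λ i → proj₁ (proj₂ (h i)))
    (λ {i} {j} e → enum-inj (trans (sym (proj₂ (proj₂ (h i)))) (trans (proj₁ e y₀) (proj₂ (proj₂ (h j))))))
    (λ {g} g∈ → let i , e = enum-onto (noncol g∈) in i , sharp y₀ (proj₁ (h i)) g x≁y₀ (proj₁ (proj₂ (h i))) g∈ (trans (proj₂ (proj₂ (h i))) e))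
    (IsSubgroup.closed subgroup) (IsSubgroup.hasId subgroup) (IsSubgroup.invCl subgroup)
    where
    open Enumeration (enumerate noncollinear?)
    h : ∀ i → ∃ λ h → H h × pt h y₀ ≡ enum i
    h i = transitive y₀ (enum i) x≁y₀ (enum-∈ i)
    noncol : ∀ {g} → H g → ¬ col x (pt g y₀)
    noncol {g} g∈ = Elations.noncol-pres S thick x elation g∈ x≁y₀

mainTheorem16 : (S : Incidence) (s t : ℕ) (x : Point S) (H Sym M : Aut S → Set) →
    IsThickGQ S s t →
    IsSTGQ S s t x H Sym →
    ((s ≡ t × Odd s) ⊎ (s ≢ t × PropertyStar S x H)) →
    IsSubgroup S M → _⊆_ S M H →
    (∀ h → H h → ∃ λ m → ∃ λ σ → M m × Sym σ × _≈_ S h (_·_ S m σ)) →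
    ∀ h → H h → M h
mainTheorem16 S s t x H Sym M thick stgq hyp M-subgroup M⊆H factor = H⊆M elation-model
  where open Conclusion S x thick stgq hyp M-subgroup M⊆H factor
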